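{- There is a function $f$ such that, for any integer $k>3$, every $3$-connected graph with order at least $f(k)$ contains a parallel minor isomorphic to $K_{3,k}'$, $W_k$, $DF_k$, or $K_k$.
   Context: All graphs are finite and simple; the order of a graph is its number of vertices. A graph $M$ is a parallel minor of a graph $G$ if $M$ is (isomorphic to) the simple graph obtained from $G$ by contracting some set of edges and then deleting all loops and all but one edge from each class of parallel edges. $K_k$ is the complete graph on $k$ vertices. $K_{3,k}'$ is obtained from the complete bipartite graph $K_{3,k}$ by adding the three edges among its three vertices of degree $k$ (so these form a triangle). The wheel $W_k$ is obtained from a cycle on $k$ vertices by adding a new vertex (hub) adjacent to every vertex of the cycle. $DF_k$ (double fan) is obtained from a path on $k$ vertices by adding two new, mutually adjacent vertices, each adjacent to every vertex of the path. -}

module Defs where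

open import Data.Nat using (ℕ; zero; suc; _+_; _∸_; _≤_; _<ᵇ_; _≡ᵇ_)
open import Data.Bool using (Bool; true; false; T; not; _∧_; _∨_; if_then_else_)
open import Data.Fin using (Fin; toℕ)
open import Data.List using (List; length)
open import Data.List.Membership.Propositional using (_∉_)
open import Data.Product using (Σ; ∃; ∃-syntax; _×_)
open import Data.Sum using (_⊎_)
open import Relation.Binary.PropositionalEquality using (_≡_; _≢_)
open import Function.Bundles using (_⇔_)

record Graph : Set where
  field
    order : ℕ
    adj   : Fin order → Fin order → Bool
open Graph public

Adj : (G : Graph) → Fin (order G) → Fin (order G) → Set
Adj G u v = T (adj G u v)

IsSimple : Graph → Set
IsSimple G = (∀ u v → adj G u v ≡ adj G v u) × (∀ u → adj G u u ≡ false)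

data Reach {n : ℕ} (R : Fin n → Fin n → Set) : Fin n → Fin n → Set where
  here : ∀ {u} → Reach R u u
  step : ∀ {u v w} → R u v → Reach R v w → Reach R u w

ThreeConnected : Graph → Set
ThreeConnected G =
  (4 ≤ order G) ×
  ((X : List (Fin (order G))) → length X ≤ 2 →
   ∀ u v → u ∉ X → v ∉ X →
   Reach (λ a b → Adj G a b × a ∉ X × b ∉ X) u v)

-- M is a parallel minor of G: there is an edge set S of G such that the
-- simple graph obtained by contracting S (vertices = components of (V(G),S),
-- two components adjacent iff distinct and joined by an edge of G) is
-- isomorphic to M; the map φ sends each vertex of G to (the image under the
-- isomorphism of) its class.
IsParallelMinor : Graph → Graph → Set
IsParallelMinor M G =
  Σ (Fin (order G) → Fin (order G) → Bool) λ S →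
  (∀ u v → T (S u v) → Adj G u v) ×
  Σ (Fin (order G) → Fin (order M)) λ φ →
  (∀ a → ∃[ u ] φ u ≡ a) ×
  (∀ u v → (φ u ≡ φ v) ⇔ Reach (λ a b → T (S a b) ⊎ T (S b a)) u v) ×
  (∀ a b → Adj M a b ⇔ (a ≢ b × ∃[ u ] ∃[ v ] (φ u ≡ a × φ v ≡ b × Adj G u v)))

-- Join of K_r (on vertices 0..r-1) with a graph h on vertices r, r+1, ...
-- (adjacency of h given on ℕ-indices shifted by r).
joinAdj : ℕ → (ℕ → ℕ → Bool) → ℕ → ℕ → Bool
joinAdj r h i j =
  if i ≡ᵇ j then false
  else if (i <ᵇ r) ∨ (j <ᵇ r) then true
  else h (i ∸ r) (j ∸ r)

onFin : ∀ {n} → (ℕ → ℕ → Bool) → Fin n → Fin n → Bool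
onFin f i j = f (toℕ i) (toℕ j)

pathAdj : ℕ → ℕ → Bool
pathAdj a b = (b ≡ᵇ suc a) ∨ (a ≡ᵇ suc b)

cycleAdj : ℕ → ℕ → ℕ → Bool
cycleAdj k a b = pathAdj a b ∨ ((a ≡ᵇ 0) ∧ (b ≡ᵇ k ∸ 1)) ∨ ((b ≡ᵇ 0) ∧ (a ≡ᵇ k ∸ 1))

Kcomplete : ℕ → Graph
Kcomplete k = record { order = k ; adj = onFin (λ i j → not (i ≡ᵇ j)) }

K3kPrime : ℕ → Graph
K3kPrime k = record { order = 3 + k ; adj = onFin (joinAdj 3 (λ _ _ → false)) }

Wheel : ℕ → Graph
Wheel k = record { order = 1 + k ; adj = onFin (joinAdj 1 (cycleAdj k)) }

DoubleFan : ℕ → Graph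
DoubleFan k = record { order = 2 + k ; adj = onFin (joinAdj 2 pathAdj) }

{-# OPTIONS --safe #-}
module Submission where

-- A row is a sequence of disjoint connected bags, consecutive ones touching. Ramsey's theorem for quadruples
-- of cut points, applied to the question which intervals of a long row touch, merges the row into bags such that
-- (a) all pairs touch, (b) an end bag touches all others, or (c) only cyclically consecutive bags touch.
-- Let a hub touch every bag of a long row whose two end bags touch. Then (a) gives K_k, (c) gives W_k, and (b) gives
-- two hubs over a row; for two hubs (a) gives K_k, (c) gives DF_k, and (b) gives three hubs over many pieces, where
-- Ramsey's theorem for pairs gives K'_{3,k} or K_k. So it suffices to contract G onto a large wheel with chords.
--
-- A large connected graph has a vertex of large degree or a long row. In case (c) of a spanning row, Menger's theorem
-- gives three disjoint paths between two far apart groups of bags. Two of them run on the same side: one is the hub,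
-- the other one is the rim, closed by the third, and every bag on that side contributes a spoke. In case (b) the
-- chords at the end bag either share a vertex, or branch at one, of large degree, or else match a row inside the end
-- bag with the old row; merging the matched bags gives a row whose case (b) is again a wheel.
-- Let v have large degree. If the neighbours of v branch at a vertex c of G - v, then v and c are two hubs over
-- pieces of the connected graph G - v - c. Otherwise G - v has a long row all of whose bags touch v, and v is the hub
-- of a rim formed by two disjoint paths through that row.

open import Defs
open import Data.Nat using (ℕ; zero; suc; _+_; _*_; _∸_; _≤_; _<_; z≤n; s≤s; _≤?_; _<?_; _<ᵇ_; _≡ᵇ_)
open import Data.Nat.Properties hiding (_≟_; suc-injective)
import Data.Nat.Properties as ℕₚ
open import Data.Bool using (Bool; true; false; T; T?; not; _∧_; _∨_; if_then_else_)
open import Data.Bool.Properties using (T-∧; ∨-comm)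
open import Data.Fin using (Fin; zero; suc; toℕ; fromℕ<; inject≤; punchOut)
open import Data.Fin.Properties using (_≟_; any?; toℕ-injective; toℕ<n; toℕ-fromℕ<; injective⇒≤; punchOut-injective; inject≤-injective)
open import Data.List using (List; []; _∷_; length; map; drop; filter; upTo; allFin; lookup; cartesianProduct)
open import Data.List.Properties using (length-map; length-upTo; filter-notAll; length-tabulate)
open import Data.List.Relation.Unary.All as All using (All; []; _∷_)
import Data.List.Relation.Unary.All.Properties as Allₚ
open import Data.List.Relation.Unary.Any as Any using (Any; here; there)
import Data.List.Relation.Unary.Any.Properties as Anyₚ
open import Data.List.Relation.Unary.AllPairs as AllPairs using (AllPairs; []; _∷_)
import Data.List.Relation.Unary.AllPairs.Properties as AllPairsₚ
open import Data.List.Relation.Unary.Unique.Propositional using (Unique)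
import Data.List.Relation.Unary.Unique.Propositional.Properties as Uniqueₚ
open import Data.List.Membership.Propositional using (_∈_; _∉_; find)
open import Data.List.Membership.Propositional.Properties using (∈-lookup; ∈-filter⁺; ∈-filter⁻; ∈-upTo⁺; ∈-upTo⁻; ∈-allFin; ∈-cartesianProduct⁺)
open import Data.List.Relation.Binary.Sublist.Propositional using (_⊆_; []; _∷_; _∷ʳ_; ⊆-refl; ⊆-trans; minimum)
open import Data.List.Relation.Binary.Sublist.Propositional.Properties using (All-resp-⊆; map⁺)
open import Data.Product using (Σ; ∃-syntax; _×_; _,_; proj₁; proj₂)
open import Data.Sum using (_⊎_; inj₁; inj₂; [_,_]′)
open import Data.Empty using (⊥; ⊥-elim)
open import Data.Unit using (⊤; tt)
open import Function using (_∘_; id; case_of_)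
open import Function.Bundles using (_⇔_; mk⇔; Equivalence)
open import Relation.Nullary using (¬_; Dec; yes; no; does)
open import Relation.Nullary.Decidable using (⌊_⌋; _×-dec_; _⊎-dec_; ¬?; toWitness; fromWitness; map′)
open import Relation.Binary.PropositionalEquality using (_≡_; _≢_; refl; sym; trans; cong; subst)
open import Relation.Binary.Definitions using (tri<; tri≈; tri>)
open import Relation.Unary using (Decidable)

-- Nothing may be deleted: every vertex has to end up in some class, and an unwanted adjacency
-- between classes cannot be dropped. Hence each construction ends in a labelling of all vertices
-- with connected classes, left-over vertices are absorbed by neighbouring classes (`fill`, `grow`),
-- and chords of a row are tamed only by merging intervals of bags until the touching pattern is
-- uniform. Two intervals with a gap between them have four end points, which is why quadruples are
-- coloured; further colourings treat the first and the last interval, since these swallow the ends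
-- of the row. A row survives merging: unions of consecutive bags are connected, neighbours still
-- touch, and a hub that touches every bag keeps doing so. Where spokes are known only for some bags
-- of a rim, the cut points are chosen with a spoke in each interval (`labelledCuts`). Long rows
-- come from `branch`, which searches a connected set from a root and keeps a tag in every bag. The
-- tags are all vertices, the neighbours of a hub, the chords at an end bag or the pieces between
-- two hubs, so one lemma serves four times.

⌊⌋-true : {P : Set} (P? : Dec P) → ⌊ P? ⌋ ≡ true → P
⌊⌋-true (yes p) _ = p

⌊⌋-false : {P : Set} (P? : Dec P) → ⌊ P? ⌋ ≡ false → ¬ P
⌊⌋-false (no ¬p) _ = ¬p

-- Ramsey's theorem

majority : {A : Set} {P Q : A → Set} → (∀ x → P x ⊎ Q x) → ∀ m m′ xs → m + m′ ≤ length xs →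
  (Σ (List A) λ ys → ys ⊆ xs × m ≤ length ys × All P ys) ⊎
  (Σ (List A) λ ys → ys ⊆ xs × m′ ≤ length ys × All Q ys)
majority d zero m′ xs le = inj₁ ([] , minimum xs , z≤n , [])
majority d (suc m) zero xs le = inj₂ ([] , minimum xs , z≤n , [])
majority d (suc m) (suc m′) (x ∷ xs) (s≤s le) with d x
... | inj₁ p with majority d m (suc m′) xs le
...   | inj₁ (ys , s , len , all) = inj₁ (x ∷ ys , refl ∷ s , s≤s len , p ∷ all)
...   | inj₂ (ys , s , len , all) = inj₂ (ys , x ∷ʳ s , len , all)
majority d (suc m) (suc m′) (x ∷ xs) (s≤s le) | inj₂ q
  with majority d (suc m) m′ xs (subst (_≤ length xs) (+-suc m m′) le)
...   | inj₁ (ys , s , len , all) = inj₁ (ys , x ∷ʳ s , len , all)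
...   | inj₂ (ys , s , len , all) = inj₂ (x ∷ ys , refl ∷ s , s≤s len , q ∷ all)

Homogeneous : ℕ → (List ℕ → Bool) → List ℕ → Bool → Set
Homogeneous r c ys b = ∀ zs → zs ⊆ ys → length zs ≡ r → c zs ≡ b

homogeneous-⊆ : ∀ {r c xs ys b} → xs ⊆ ys → Homogeneous r c ys b → Homogeneous r c xs b
homogeneous-⊆ s h zs t = h zs (⊆-trans t s)

-- The colour of a sublist of size r + 1 is the bit attached to its first element.
EndHomogeneous : ℕ → (List ℕ → Bool) → List (ℕ × Bool) → Set
EndHomogeneous r c [] = ⊤
EndHomogeneous r c ((x , b) ∷ ps) =
  Homogeneous r (c ∘ (x ∷_)) (map proj₁ ps) b × EndHomogeneous r c ps

endHomogeneous-⊆ : ∀ {r c ps qs} → qs ⊆ ps → EndHomogeneous r c ps → EndHomogeneous r c qs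
endHomogeneous-⊆ [] e = tt
endHomogeneous-⊆ (_ ∷ʳ s) (_ , e) = endHomogeneous-⊆ s e
endHomogeneous-⊆ (refl ∷ s) (h , e) =
  homogeneous-⊆ (map⁺ proj₁ s) h , endHomogeneous-⊆ s e

endHomogeneous⇒homogeneous : ∀ {r c b} ps → EndHomogeneous r c ps →
  All (λ p → proj₂ p ≡ b) ps → Homogeneous (suc r) c (map proj₁ ps) b
endHomogeneous⇒homogeneous [] e a .[] [] ()
endHomogeneous⇒homogeneous (p ∷ ps) (h , e) (_ ∷ a) zs (_ ∷ʳ s) len =
  endHomogeneous⇒homogeneous ps e a zs s len
endHomogeneous⇒homogeneous (p ∷ ps) (h , e) (q ∷ a) (z ∷ zs) (refl ∷ s) len =
  trans (h zs s (ℕₚ.suc-injective len)) q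

-- Opaque, since unfolding these towers makes type checking explode.
abstract
  ramseyNumber : ℕ → ℕ → ℕ
  endNumber : ℕ → ℕ → ℕ
  ramseyNumber zero m = m
  ramseyNumber (suc r) m = endNumber r (m + m)
  endNumber r zero = 0
  endNumber r (suc n) = suc (ramseyNumber r (endNumber r n))

  -- The Erdős-Rado argument: the first element induces a colouring of the `r`-sublists of the
  -- remaining ones; passing to a homogeneous sublist and repeating yields an end-homogeneous
  -- sequence. Half of its bits agree, whence `m + m` in `ramseyNumber`.
  ramsey : ∀ r m c xs → ramseyNumber r m ≤ length xs →
    Σ (List ℕ) λ ys → ys ⊆ xs × m ≤ length ys × ∃[ b ] Homogeneous r c ys b
  endRamsey : ∀ r n c xs → endNumber r n ≤ length xs →
    Σ (List (ℕ × Bool)) λ ps → map proj₁ ps ⊆ xs × n ≤ length ps × EndHomogeneous r c ps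

  ramsey zero m c xs le = xs , ⊆-refl , le , c [] , λ { [] _ _ → refl }
  ramsey (suc r) m c xs le with endRamsey r (m + m) c xs le
  ... | ps , s , len , e with majority bit m m ps len
    where
    bit : (p : ℕ × Bool) → (proj₂ p ≡ true) ⊎ (proj₂ p ≡ false)
    bit (_ , true) = inj₁ refl
    bit (_ , false) = inj₂ refl
  ... | inj₁ (qs , t , len′ , all) =
    map proj₁ qs , ⊆-trans (map⁺ proj₁ t) s , subst (m ≤_) (sym (length-map proj₁ qs)) len′ ,
    true , endHomogeneous⇒homogeneous qs (endHomogeneous-⊆ t e) all
  ... | inj₂ (qs , t , len′ , all) =
    map proj₁ qs , ⊆-trans (map⁺ proj₁ t) s , subst (m ≤_) (sym (length-map proj₁ qs)) len′ ,
    false , endHomogeneous⇒homogeneous qs (endHomogeneous-⊆ t e) all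

  endRamsey r zero c xs le = [] , minimum xs , z≤n , tt
  endRamsey r (suc n) c (x ∷ xs) (s≤s le) with ramsey r (endNumber r n) (c ∘ (x ∷_)) xs le
  ... | ys , s , len , b , h with endRamsey r n c ys len
  ... | ps , t , len′ , e =
    (x , b) ∷ ps , refl ∷ ⊆-trans t s , s≤s len′ , homogeneous-⊆ t h , e

-- Increasing lists of indices

Sorted : List ℕ → Set
Sorted = AllPairs _<_

allPairs-⊆ : ∀ {A : Set} {R : A → A → Set} {xs ys} → xs ⊆ ys → AllPairs R ys → AllPairs R xs
allPairs-⊆ [] [] = []
allPairs-⊆ (_ ∷ʳ s) (_ ∷ p) = allPairs-⊆ s p
allPairs-⊆ (refl ∷ s) (a ∷ p) = All-resp-⊆ s a ∷ allPairs-⊆ s p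

sorted-upTo : ∀ n → Sorted (upTo n)
sorted-upTo n = AllPairsₚ.applyUpTo⁺₁ id n λ i<j _ → i<j

-- The value 0 beyond the end of the list is junk.
nth : List ℕ → ℕ → ℕ
nth [] _ = 0
nth (x ∷ xs) zero = x
nth (x ∷ xs) (suc i) = nth xs i

nth-All : ∀ {P : ℕ → Set} {xs} → All P xs → ∀ {i} → i < length xs → P (nth xs i)
nth-All (p ∷ ps) {zero} _ = p
nth-All (p ∷ ps) {suc i} (s≤s lt) = nth-All ps lt

nth-< : ∀ {xs} → Sorted xs → ∀ {i j} → i < j → j < length xs → nth xs i < nth xs j
nth-< (a ∷ s) {zero} {suc j} _ (s≤s lt) = nth-All a lt
nth-< (a ∷ s) {suc i} {suc j} (s≤s i<j) (s≤s lt) = nth-< s i<j lt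

drop-⊆ : ∀ i (xs : List ℕ) → drop i xs ⊆ xs
drop-⊆ zero xs = ⊆-refl
drop-⊆ (suc i) [] = []
drop-⊆ (suc i) (x ∷ xs) = x ∷ʳ drop-⊆ i xs

drop-mono-⊆ : ∀ {i j} → i ≤ j → (xs : List ℕ) → drop j xs ⊆ drop i xs
drop-mono-⊆ {j = j} z≤n xs = drop-⊆ j xs
drop-mono-⊆ (s≤s le) [] = []
drop-mono-⊆ (s≤s le) (x ∷ xs) = drop-mono-⊆ le xs

nth-∷-⊆ : ∀ {i zs} (xs : List ℕ) → i < length xs → zs ⊆ drop (suc i) xs → nth xs i ∷ zs ⊆ drop i xs
nth-∷-⊆ {zero} (x ∷ xs) lt s = refl ∷ s
nth-∷-⊆ {suc i} (x ∷ xs) (s≤s lt) s = nth-∷-⊆ {i} xs lt s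

nth₂-⊆ : ∀ {i j} xs → i < j → j < length xs → nth xs i ∷ nth xs j ∷ [] ⊆ xs
nth₂-⊆ {i} {j} xs i<j j< =
  ⊆-trans (nth-∷-⊆ {i} xs (<-trans i<j j<)
    (⊆-trans (nth-∷-⊆ {j} xs j< (minimum _)) (drop-mono-⊆ i<j xs))) (drop-⊆ i xs)

nth₄-⊆ : ∀ {i j k l} xs → i < j → j < k → k < l → l < length xs →
  nth xs i ∷ nth xs j ∷ nth xs k ∷ nth xs l ∷ [] ⊆ xs
nth₄-⊆ {i} {j} {k} {l} xs i<j j<k k<l l< =
  ⊆-trans (nth-∷-⊆ {i} xs (<-trans i<j j<) (⊆-trans (nth-∷-⊆ {j} xs j<
    (⊆-trans (nth-∷-⊆ {k} xs k<
      (⊆-trans (nth-∷-⊆ {l} xs l< (minimum _)) (drop-mono-⊆ k<l xs)))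
      (drop-mono-⊆ j<k xs))) (drop-mono-⊆ i<j xs))) (drop-⊆ i xs)
  where
  k< = <-trans k<l l<
  j< = <-trans j<k k<

-- Ramsey's theorem for intervals of indices

-- The sequence b cuts [0, l] into the m + 1 intervals [b j, b (j + 1)), j ≤ m.
record Cuts (b : ℕ → ℕ) (m l : ℕ) : Set where
  field
    begins : b 0 ≡ 0
    increasing : ∀ j → j ≤ m → b j < b (suc j)
    ends : b (suc m) ≡ suc l
open Cuts public

-- Interval `j` starts at entry `j` of `ys`, but the first interval is extended down to 0 and the
-- last one up to `l`, so that nothing is left over. Entry 0 is therefore not a cut point; it only
-- witnesses that interval 0 contains it.
cut : List ℕ → ℕ → ℕ → ℕ → ℕ
cut ys m l zero = 0
cut ys m l (suc j) = if j <ᵇ m then nth ys (suc j) else suc l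

cut-inner : ∀ ys {m} l {j} → j < m → cut ys m l (suc j) ≡ nth ys (suc j)
cut-inner ys {m} l {j} lt with j <ᵇ m in eq
... | true = refl
... | false = ⊥-elim (subst T eq (<⇒<ᵇ lt))

cut-last : ∀ ys m l → cut ys m l (suc m) ≡ suc l
cut-last ys m l with m <ᵇ m in eq
... | false = refl
... | true = ⊥-elim (<-irrefl refl (<ᵇ⇒< m m (subst T (sym eq) tt)))

cut-≤ : ∀ ys m l j → j ≤ m → cut ys m l j ≤ nth ys j
cut-≤ ys m l zero le = z≤n
cut-≤ ys m l (suc j) le = ≤-reflexive (cut-inner ys l le)

<-cut : ∀ {ys m l} → Sorted ys → m < length ys → All (_≤ l) ys → ∀ j → j ≤ m →
  nth ys j < cut ys m l (suc j)
<-cut {ys} {m} {l} s lt bd j le with m≤n⇒m<n∨m≡n le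
... | inj₁ j<m = subst (nth ys j <_) (sym (cut-inner ys l j<m)) (nth-< s (n<1+n j) (≤-<-trans j<m lt))
... | inj₂ refl = subst (nth ys j <_) (sym (cut-last ys m l)) (s≤s (nth-All bd lt))

cut-Cuts : ∀ {ys m l} → Sorted ys → m < length ys → All (_≤ l) ys → Cuts (cut ys m l) m l
cut-Cuts {ys} {m} {l} s lt bd = record
  { begins = refl
  ; increasing = λ j le → ≤-<-trans (cut-≤ ys m l j le) (<-cut s lt bd j le)
  ; ends = cut-last ys m l
  }

cuts-mono : ∀ {b m l} → Cuts b m l → ∀ {i j} → i ≤ j → j ≤ suc m → b i ≤ b j
cuts-mono {b} C {j = j} i≤j j≤ with m≤n⇒m<n∨m≡n i≤j
... | inj₂ refl = ≤-refl
cuts-mono {b} C {j = suc j} i≤j (s≤s j≤) | inj₁ (s≤s lt) =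
  ≤-trans (cuts-mono C lt (m≤n⇒m≤1+n j≤)) (<⇒≤ (increasing C j j≤))

unique-lookup : ∀ {A : Set} {xs : List A} → Unique xs → ∀ i j → lookup xs i ≡ lookup xs j → i ≡ j
unique-lookup (a ∷ u) zero zero e = refl
unique-lookup (a ∷ u) zero (suc j) e = ⊥-elim (All.lookup a (∈-lookup j) e)
unique-lookup (a ∷ u) (suc i) zero e = ⊥-elim (All.lookup a (∈-lookup i) (sym e))
unique-lookup (a ∷ u) (suc i) (suc j) e = cong suc (unique-lookup u i j e)

unique-⊆⇒≤ : ∀ {A : Set} {xs ys : List A} → Unique xs → All (_∈ ys) xs → length xs ≤ length ys
unique-⊆⇒≤ {xs = xs} {ys} uniq xs∈ = injective⇒≤ {f = λ i → Any.index (All.lookup xs∈ (∈-lookup i))} λ {i} {j} e →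
  unique-lookup uniq i j (trans (Anyₚ.lookup-index (All.lookup xs∈ (∈-lookup i)))
    (trans (cong (lookup ys) e) (sym (Anyₚ.lookup-index (All.lookup xs∈ (∈-lookup j))))))

-- The list `xs` comes in no particular order and serves as a count: filtering `upTo` recovers at
-- least as many labelled numbers in increasing order, and these become the cut points. The label
-- will say that a bag carries a spoke.
labelledCuts : ∀ {L : ℕ → Set} → (∀ x → Dec (L x)) → ∀ l m xs → Unique xs → All (λ x → x ≤ l × L x) xs → m < length xs →
  Σ (ℕ → ℕ) λ b → Cuts b m l × (∀ j → j ≤ m → ∃[ x ] (b j ≤ x × x < b (suc j) × L x))
labelledCuts {L} L? l m xs uniq labels long = cut ys m l , cut-Cuts sorted long′ bounded , λ j j≤ →
  nth ys j , cut-≤ ys m l j j≤ , <-cut sorted long′ bounded j j≤ , nth-All (Allₚ.all-filter L? (upTo (suc l))) (≤-<-trans j≤ long′)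
  where
  ys : List ℕ
  ys = filter L? (upTo (suc l))
  sorted : Sorted ys
  sorted = AllPairsₚ.filter⁺ L? (sorted-upTo (suc l))
  bounded : All (_≤ l) ys
  bounded = All.tabulate λ y∈ → ≤-pred (∈-upTo⁻ (proj₁ (∈-filter⁻ L? {xs = upTo (suc l)} y∈)))
  long′ : m < length ys
  long′ = <-≤-trans long (unique-⊆⇒≤ uniq (All.map (λ (x≤ , lx) → ∈-filter⁺ L? (∈-upTo⁺ (s≤s x≤)) lx) labels))

locate : (ℕ → ℕ) → ℕ → ℕ → ℕ
locate b zero i = 0
locate b (suc m) i with b (suc m) ≤? i
... | yes _ = suc m
... | no _ = locate b m i

locate-≤ : ∀ (b : ℕ → ℕ) m i → locate b m i ≤ m
locate-≤ b zero i = z≤n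
locate-≤ b (suc m) i with b (suc m) ≤? i
... | yes _ = ≤-refl
... | no _ = m≤n⇒m≤1+n (locate-≤ b m i)

locate-lower : ∀ {b : ℕ → ℕ} → b 0 ≡ 0 → ∀ m i → b (locate b m i) ≤ i
locate-lower {b} b0 zero i = subst (_≤ i) (sym b0) z≤n
locate-lower {b} b0 (suc m) i with b (suc m) ≤? i
... | yes p = p
... | no _ = locate-lower {b} b0 m i

locate-upper : ∀ (b : ℕ → ℕ) m i → i < b (suc m) → i < b (suc (locate b m i))
locate-upper b zero i lt = lt
locate-upper b (suc m) i lt with b (suc m) ≤? i
... | yes p = lt
... | no ¬p = locate-upper b m i (≰⇒> ¬p)

locate-unique : ∀ {b m l} → Cuts b m l → ∀ {i j} → j ≤ m → b j ≤ i → i < b (suc j) → locate b m i ≡ j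
locate-unique {b} {m} {l} C {i} {j} j≤m lo hi with <-cmp (locate b m i) j
... | tri≈ _ eq _ = eq
... | tri< lt _ _ = ⊥-elim (<⇒≱ (locate-upper b m i i<)
        (≤-trans (cuts-mono C lt (m≤n⇒m≤1+n j≤m)) lo))
  where
  i< : i < b (suc m)
  i< = <-≤-trans hi (cuts-mono C (s≤s j≤m) ≤-refl)
... | tri> _ _ gt = ⊥-elim (<⇒≱ hi
        (≤-trans (cuts-mono C gt (m≤n⇒m≤1+n (locate-≤ b m i))) (locate-lower {b} (begins C) m i)))

-- Each upper bound directly follows its witness, the shape that `anyUpTo?` decides; the lower
-- bounds are part of the predicate searched for.
IntervalTouch : (ℕ → ℕ → Set) → ℕ → ℕ → ℕ → ℕ → Set
IntervalTouch R a b c d = ∃[ x ] (x < b × ∃[ y ] (y < d × a ≤ x × c ≤ y × R x y))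

CutTouch : (ℕ → ℕ → Set) → (ℕ → ℕ) → ℕ → ℕ → Set
CutTouch R b i j = IntervalTouch R (b i) (b (suc i)) (b j) (b (suc j))

intervalTouch? : ∀ {R : ℕ → ℕ → Set} → (∀ x y → Dec (R x y)) → ∀ a b c d → Dec (IntervalTouch R a b c d)
intervalTouch? R? a b c d =
  anyUpTo? (λ x → anyUpTo? (λ y → (a ≤? x) ×-dec (c ≤? y) ×-dec R? x y) d) b

intervalTouch-mono : ∀ {R a a′ b b′ c c′ d d′} → a′ ≤ a → b ≤ b′ → c′ ≤ c → d ≤ d′ →
  IntervalTouch R a b c d → IntervalTouch R a′ b′ c′ d′
intervalTouch-mono p q r s (x , x< , y , y< , ax , cy , t) =
  x , <-≤-trans x< q , y , <-≤-trans y< s , ≤-trans p ax , ≤-trans r cy , t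

-- Nothing is claimed about consecutive intervals, since `R` is arbitrary; in a row they touch
-- anyway. The two hub outcomes are mirror images and get identified by reversing the row.
data CutOutcome (R : ℕ → ℕ → Set) (mK mH mN l : ℕ) : Set where
  complete : ∀ b → Cuts b mK l → (∀ i j → suc (suc i) ≤ j → j ≤ mK → CutTouch R b i j) →
    CutOutcome R mK mH mN l
  firstHub : ∀ b → Cuts b mH l → (∀ j → 2 ≤ j → j ≤ mH → CutTouch R b 0 j) →
    CutOutcome R mK mH mN l
  lastHub : ∀ b → Cuts b mH l → (∀ i → suc (suc i) ≤ mH → CutTouch R b i mH) →
    CutOutcome R mK mH mN l
  cyclic : ∀ b → Cuts b mN l →
    (∀ i j → suc (suc i) ≤ j → j ≤ mN → CutTouch R b i j → i ≡ 0 × j ≡ mN) →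
    CutOutcome R mK mH mN l

-- One Ramsey number for each of three colourings, applied in turn to the surviving points. The
-- outcome is not known beforehand, so the three lengths are added; 5 leaves room for a point before
-- the intervals and for padding points behind them.
cutNumber : ℕ → ℕ → ℕ → ℕ
cutNumber mK mH mN =
  ramseyNumber 4 (ramseyNumber 4 (ramseyNumber 4 (5 + (mK + (mH + mN)))))

module _ {R : ℕ → ℕ → Set} (R? : ∀ x y → Dec (R x y)) (l : ℕ) where
  private
    -- Pairs of intervals with a gap between them: two inner ones, an initial one and an inner one,
    -- an inner one and a final one. The last two kinds need three points and are padded to
    -- quadruples, so that all colourings have the same arity.
    touch₁ touch₂ touch₃ : List ℕ → Bool
    touch₁ (i ∷ j ∷ k ∷ h ∷ []) = ⌊ intervalTouch? R? i j k h ⌋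
    touch₁ _ = false
    touch₂ (i ∷ j ∷ k ∷ h ∷ []) = ⌊ intervalTouch? R? 0 i j k ⌋
    touch₂ _ = false
    touch₃ (i ∷ j ∷ k ∷ h ∷ []) = ⌊ intervalTouch? R? j k h (suc l) ⌋
    touch₃ _ = false

  cutRamsey : ∀ mK mH mN → cutNumber mK mH mN ≤ suc l → CutOutcome R mK mH mN l
  cutRamsey mK mH mN le
    with ramsey 4 _ touch₁ (upTo (suc l)) (subst (cutNumber mK mH mN ≤_) (sym (length-upTo (suc l))) le)
  ... | ys₁ , s₁ , len₁ , b₁ , h₁ with ramsey 4 _ touch₂ ys₁ len₁
  ... | ys₂ , s₂ , len₂ , b₂ , h₂ with ramsey 4 _ touch₃ ys₂ len₂
  ... | [] , _ , () , _
  ... | y ∷ ys , s₃ , s≤s len , b₃ , h₃ =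
    outcome b₁ b₂ b₃ (homogeneous-⊆ {r = 4} (⊆-trans s₃ s₂) h₁) (homogeneous-⊆ {r = 4} s₃ h₂) h₃
    where
    s : y ∷ ys ⊆ upTo (suc l)
    s = ⊆-trans s₃ (⊆-trans s₂ s₁)
    sorted : Sorted (y ∷ ys)
    sorted = allPairs-⊆ s (sorted-upTo (suc l))
    tailSorted : Sorted ys
    tailSorted = AllPairs.tail sorted
    bounded : All (_≤ l) (y ∷ ys)
    bounded = All-resp-⊆ s (All.tabulate λ i∈ → ≤-pred (∈-upTo⁻ i∈))
    tailBounded : All (_≤ l) ys
    tailBounded = All.tail bounded
    long : ∀ {m} → m ≤ mK + (mH + mN) → ∀ {j} → j ≤ 3 + m → suc j ≤ length ys
    long m≤ j≤ = ≤-trans (s≤s (≤-trans j≤ (+-monoʳ-≤ 3 m≤))) len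
    K≤ : mK ≤ mK + (mH + mN)
    K≤ = m≤m+n mK _
    H≤ : mH ≤ mK + (mH + mN)
    H≤ = ≤-trans (m≤m+n mH mN) (m≤n+m _ mK)
    N≤ : mN ≤ mK + (mH + mN)
    N≤ = ≤-trans (m≤n+m mN mH) (m≤n+m _ mK)
    h : ℕ → ℕ
    h = nth (y ∷ ys)
    four : ∀ {i j k n} → i < j → j < k → k < n → n < suc (length ys) →
      h i ∷ h j ∷ h k ∷ h n ∷ [] ⊆ y ∷ ys
    four {i} = nth₄-⊆ {i} (y ∷ ys)
    mono : ∀ {i j} → i ≤ j → j < suc (length ys) → h i ≤ h j
    mono i≤j lt with m≤n⇒m<n∨m≡n i≤j
    ... | inj₁ i<j = <⇒≤ (nth-< sorted i<j lt)
    ... | inj₂ refl = ≤-refl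
    -- Interval j of the cutting is [h (j+1), h (j+2)), the first and last ones being enlarged.
    c : ℕ → ℕ → ℕ
    c m = cut ys m l
    cuts : ∀ {m} → m ≤ mK + (mH + mN) → Cuts (c m) m l
    cuts m≤ = cut-Cuts tailSorted (long m≤ (m≤n+m _ 3)) tailBounded
    lower : ∀ {m} → m ≤ mK + (mH + mN) → ∀ j → j ≤ m → c m j ≤ h (suc j)
    lower {m} m≤ j j≤m = cut-≤ ys m l j j≤m
    inner : ∀ {m} j → j < m → c m (suc j) ≡ h (suc (suc j))
    inner j lt = cut-inner ys l lt
    upper : ∀ {m} → m ≤ mK + (mH + mN) → ∀ j → j ≤ m → h (suc (suc j)) ≤ c m (suc j)
    upper {m} m≤ j j≤m with m≤n⇒m<n∨m≡n j≤m
    ... | inj₁ j<m = ≤-reflexive (sym (inner j j<m))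
    ... | inj₂ refl = subst (nth ys (suc j) ≤_) (sym (cut-last ys m l))
            (m≤n⇒m≤1+n (nth-All tailBounded (long m≤ (m≤n+m (suc j) 2))))
    outcome : ∀ b₁ b₂ b₃ → Homogeneous 4 touch₁ (y ∷ ys) b₁ → Homogeneous 4 touch₂ (y ∷ ys) b₂ →
      Homogeneous 4 touch₃ (y ∷ ys) b₃ → CutOutcome R mK mH mN l
    outcome true _ _ h₁ _ _ = complete (c mK) (cuts K≤) λ i j i+2≤j j≤ →
      intervalTouch-mono (lower K≤ i (≤-trans (≤-trans (m≤n+m i 2) i+2≤j) j≤))
        (upper K≤ i (≤-trans (≤-trans (m≤n+m i 2) i+2≤j) j≤)) (lower K≤ j j≤) (upper K≤ j j≤)
        (⌊⌋-true _ (h₁ _ (four {suc i} ≤-refl (s≤s i+2≤j) ≤-refl (s≤s (long K≤ (≤-trans (s≤s j≤) (m≤n+m _ 2))))) refl))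
    outcome false true _ _ h₂ _ = firstHub (c mH) (cuts H≤) λ j 2≤j j≤ →
      intervalTouch-mono z≤n (≤-trans (mono {0} {2} z≤n (s≤s (long H≤ {1} (s≤s z≤n)))) (upper H≤ 0 z≤n))
        (lower H≤ j j≤) (upper H≤ j j≤)
        (⌊⌋-true _ (h₂ _ (four {0} {suc j} {suc (suc j)} {suc (suc (suc j))} (s≤s z≤n) ≤-refl ≤-refl
          (s≤s (long H≤ (≤-trans (s≤s (s≤s j≤)) (m≤n+m _ 1))))) refl))
    outcome false false true _ _ h₃ = lastHub (c mH) (cuts H≤) λ i i+2≤ →
      intervalTouch-mono (lower H≤ i (≤-trans (m≤n+m i 2) i+2≤)) (upper H≤ i (≤-trans (m≤n+m i 2) i+2≤))
        (lower H≤ mH ≤-refl) (≤-reflexive (sym (cut-last ys mH l)))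
        (⌊⌋-true _ (h₃ _ (four {0} {suc i} {suc (suc i)} {suc mH} (s≤s z≤n) ≤-refl (s≤s i+2≤)
          (s≤s (long H≤ (m≤n+m mH 3)))) refl))
    -- The negative colours exclude, in this order, two inner intervals, the first with an inner
    -- one, and an inner one with the last. Only the pair of the first and the last interval is left
    -- undecided.
    outcome false false false h₁ h₂ h₃ = cyclic (c mN) (cuts N≤) λ i j i+2≤j j≤ t → apart i j i+2≤j j≤ t
      where
      apart : ∀ i j → suc (suc i) ≤ j → j ≤ mN → CutTouch R (c mN) i j → i ≡ 0 × j ≡ mN
      apart i j i+2≤j j≤ t with m≤n⇒m<n∨m≡n j≤
      apart zero j i+2≤j j≤ t | inj₂ eq = refl , eq
      apart (suc i) j i+2≤j j≤ t | inj₂ refl = ⊥-elim (⌊⌋-false _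
        (h₃ _ (four {0} {suc (suc i)} {suc (suc (suc i))} {suc j} (s≤s z≤n) ≤-refl (s≤s i+2≤j) (s≤s (long N≤ (m≤n+m j 3)))) refl)
        (intervalTouch-mono (≤-reflexive (sym (inner i i<))) (≤-reflexive (inner (suc i) i+1<))
          (≤-reflexive (sym (inner′ j j≥1))) (≤-reflexive (cut-last ys mN l)) t))
        where
        i+1< : suc i < j
        i+1< = ≤-trans (n≤1+n _) i+2≤j
        i< : i < j
        i< = <-trans (n<1+n i) i+1<
        j≥1 : 1 ≤ j
        j≥1 = ≤-trans (s≤s z≤n) i+2≤j
        inner′ : ∀ j → 1 ≤ j → c j j ≡ h (suc j)
        inner′ (suc j) _ = inner j ≤-refl
      apart zero (suc j) (s≤s i+2≤j) j≤ t | inj₁ j< = ⊥-elim (⌊⌋-false _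
        (h₂ _ (four {2} {suc (suc j)} {suc (suc (suc j))} {suc (suc (suc (suc j)))} (s≤s (s≤s i+2≤j)) ≤-refl ≤-refl
          (s≤s (long N≤ (≤-trans (s≤s (s≤s j≤)) (m≤n+m _ 1))))) refl)
        (intervalTouch-mono z≤n (≤-reflexive (inner 0 (≤-trans (s≤s z≤n) j≤)))
          (≤-reflexive (sym (inner j j≤))) (≤-reflexive (inner (suc j) j<)) t))
      apart (suc i) (suc j) i+2≤j j≤ t | inj₁ j< = ⊥-elim (⌊⌋-false _
        (h₁ _ (four {suc (suc i)} {suc (suc (suc i))} {suc (suc j)} {suc (suc (suc j))} ≤-refl (s≤s i+2≤j) ≤-refl
          (s≤s (long N≤ (≤-trans (s≤s j≤) (m≤n+m _ 2))))) refl)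
        (intervalTouch-mono (≤-reflexive (sym (inner i i<))) (≤-reflexive (inner (suc i) i+1<))
          (≤-reflexive (sym (inner j j≤))) (≤-reflexive (inner (suc j) j<)) t))
        where
        i+1< : suc i < mN
        i+1< = ≤-trans (≤-trans (n≤1+n _) i+2≤j) j≤
        i< : i < mN
        i< = <-trans (n<1+n i) i+1<

-- Reachability

reach-map : ∀ {n} {R S : Fin n → Fin n → Set} → (∀ {a b} → R a b → S a b) →
  ∀ {u v} → Reach R u v → Reach S u v
reach-map f here = here
reach-map f (step r p) = step (f r) (reach-map f p)

reach-trans : ∀ {n} {R : Fin n → Fin n → Set} {u v w} → Reach R u v → Reach R v w → Reach R u w
reach-trans here q = q
reach-trans (step r p) q = step r (reach-trans p q)

reach-sym : ∀ {n} {R : Fin n → Fin n → Set} → (∀ {a b} → R a b → R b a) →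
  ∀ {u v} → Reach R u v → Reach R v u
reach-sym s here = here
reach-sym s (step r p) = reach-trans (reach-sym s p) (step (s r) here)

-- Warshall's algorithm: Via xs u v says that v is reached from u through intermediate vertices in xs.
module _ {n : ℕ} {R : Fin n → Fin n → Set} (R? : ∀ u v → Dec (R u v)) where
  private
    Via : List (Fin n) → Fin n → Fin n → Set
    Via [] u v = u ≡ v ⊎ R u v
    Via (x ∷ xs) u v = Via xs u v ⊎ (Via xs u x × Via xs x v)

    via? : ∀ xs u v → Dec (Via xs u v)
    via? [] u v = (u ≟ v) ⊎-dec R? u v
    via? (x ∷ xs) u v = via? xs u v ⊎-dec (via? xs u x ×-dec via? xs x v)

    via⇒reach : ∀ xs {u v} → Via xs u v → Reach R u v
    via⇒reach [] (inj₁ refl) = here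
    via⇒reach [] (inj₂ r) = step r here
    via⇒reach (x ∷ xs) (inj₁ p) = via⇒reach xs p
    via⇒reach (x ∷ xs) (inj₂ (p , q)) = reach-trans (via⇒reach xs p) (via⇒reach xs q)

    via-base : ∀ xs {u v} → u ≡ v ⊎ R u v → Via xs u v
    via-base [] p = p
    via-base (x ∷ xs) p = inj₁ (via-base xs p)

    via-trans : ∀ xs {u x v} → x ∈ xs → Via xs u x → Via xs x v → Via xs u v
    via-trans (y ∷ ys) (here refl) p q = inj₂ (left p , right q)
      where
      left : ∀ {u} → Via (y ∷ ys) u y → Via ys u y
      left (inj₁ p) = p
      left (inj₂ (p , _)) = p
      right : ∀ {v} → Via (y ∷ ys) y v → Via ys y v
      right (inj₁ p) = p
      right (inj₂ (_ , p)) = p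
    via-trans (y ∷ ys) (there x∈) (inj₁ p) (inj₁ q) = inj₁ (via-trans ys x∈ p q)
    via-trans (y ∷ ys) (there x∈) (inj₁ p) (inj₂ (q , r)) = inj₂ (via-trans ys x∈ p q , r)
    via-trans (y ∷ ys) (there x∈) (inj₂ (p , q)) (inj₁ r) = inj₂ (p , via-trans ys x∈ q r)
    via-trans (y ∷ ys) (there x∈) (inj₂ (p , _)) (inj₂ (_ , r)) = inj₂ (p , r)

    reach⇒via : ∀ {u v} → Reach R u v → Via (allFin n) u v
    reach⇒via here = via-base (allFin n) (inj₁ refl)
    reach⇒via (step {v = v} r p) = via-trans (allFin n) (∈-allFin v) (via-base (allFin n) (inj₂ r)) (reach⇒via p)

  reach? : ∀ u v → Dec (Reach R u v)
  reach? u v = map′ (via⇒reach (allFin n)) reach⇒via (via? (allFin n) u v)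

-- Connected sets and rows of bags

module Graphs {n : ℕ} (E : Fin n → Fin n → Set) (E? : ∀ u v → Dec (E u v)) (E-sym : ∀ {u v} → E u v → E v u) where

  In : (Fin n → Set) → Fin n → Fin n → Set
  In P a b = E a b × P a × P b

  Conn : (Fin n → Set) → Set
  Conn P = ∀ {u v} → P u → P v → Reach (In P) u v

  Touch : (Fin n → Set) → (Fin n → Set) → Set
  Touch P Q = ∃[ u ] ∃[ v ] (P u × Q v × E u v)

  in? : ∀ {P} → (∀ u → Dec (P u)) → ∀ u v → Dec (In P u v)
  in? P? u v = E? u v ×-dec P? u ×-dec P? v

  touch? : ∀ {P Q} → (∀ u → Dec (P u)) → (∀ u → Dec (Q u)) → Dec (Touch P Q)
  touch? P? Q? = any? λ u → any? λ v → P? u ×-dec Q? v ×-dec E? u v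

  touch-sym : ∀ {P Q} → Touch P Q → Touch Q P
  touch-sym (u , v , p , q , e) = v , u , q , p , E-sym e

  touch-mono : ∀ {P P′ Q Q′ : Fin n → Set} → (∀ {u} → P u → P′ u) → (∀ {u} → Q u → Q′ u) →
    Touch P Q → Touch P′ Q′
  touch-mono f g (u , v , p , q , e) = u , v , f p , g q , e

  in-sym : ∀ {P a b} → In P a b → In P b a
  in-sym (e , p , q) = E-sym e , q , p

  in-mono : ∀ {P Q : Fin n → Set} → (∀ {u} → P u → Q u) → ∀ {u v} → Reach (In P) u v → Reach (In Q) u v
  in-mono f = reach-map λ (e , p , q) → e , f p , f q

  reach-end : ∀ {P u v} → P u → Reach (In P) u v → P v
  reach-end p here = p
  reach-end p (step (_ , _ , q) r) = reach-end q r

  conn-cong : ∀ {P Q : Fin n → Set} → (∀ {u} → P u → Q u) → (∀ {u} → Q u → P u) → Conn P → Conn Q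
  conn-cong f g c p q = in-mono f (c (g p) (g q))

  conn-root : ∀ {P} r → (∀ {u} → P u → Reach (In P) u r) → Conn P
  conn-root r f p q = reach-trans (f p) (reach-sym in-sym (f q))

  conn-∪ : ∀ {P Q} → Conn P → Conn Q → Touch P Q → Conn (λ u → P u ⊎ Q u)
  conn-∪ cP cQ (x , y , px , qy , e) = conn-root y λ
    { (inj₁ p) → reach-trans (in-mono inj₁ (cP p px)) (step (e , inj₁ px , inj₂ qy) here)
    ; (inj₂ q) → in-mono inj₂ (cQ q qy) }

  reach-component : ∀ {P a x u} → Reach (In P) a x → Reach (In P) x u →
    Reach (In (λ w → Reach (In P) a w)) x u
  reach-component p here = here
  reach-component p (step r q) = step (proj₁ r , p , p′) (reach-component p′ q)
    where p′ = reach-trans p (step r here)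

  conn-component : ∀ {P} a → Conn (λ u → Reach (In P) a u)
  conn-component a = conn-root a λ p → reach-sym in-sym (reach-component here p)

  -- Besides the edge entering `R`, the initial part of the walk is returned inside `Q` minus `R`:
  -- this is what places the vertex `x` in the same component off `R` as the start.
  firstHit : ∀ {Q R : Fin n → Set} → (∀ u → Dec (R u)) → ∀ {u v} → Reach (In Q) u v → Q u → R v → ¬ R u →
    ∃[ x ] ∃[ y ] (Reach (In (λ w → Q w × ¬ R w)) u x × Q x × ¬ R x × Q y × R y × E x y)
  firstHit R? here q rv ¬ru = ⊥-elim (¬ru rv)
  firstHit R? (step {u} {v} (e , qu , qv) p) q rw ¬ru with R? v
  ... | yes rv = u , v , here , qu , ¬ru , qv , rv , e
  ... | no ¬rv with firstHit R? p qv rw ¬rv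
  ... | x , y , walk , rest = x , y , step (e , (qu , ¬ru) , qv , ¬rv) walk , rest

  -- Consecutive bags touch; other pairs of bags may touch as well.
  record Bags (P : Fin n → Set) (l : ℕ) : Set where
    field
      index : Fin n → ℕ
      index≤ : ∀ {u} → P u → index u ≤ l
      conn : ∀ i → Conn (λ u → P u × index u ≡ i)
      touch : ∀ i → i < l → Touch (λ u → P u × index u ≡ i) (λ u → P u × index u ≡ suc i)
      inhabited : ∀ i → i ≤ l → ∃[ u ] (P u × index u ≡ i)
  open Bags public

  Bag : ∀ {P l} → Bags P l → ℕ → Fin n → Set
  Bag {P} B i u = P u × index B u ≡ i

  bag? : ∀ {P l} (B : Bags P l) → (∀ u → Dec (P u)) → ∀ i u → Dec (Bag B i u)
  bag? B P? i u = P? u ×-dec (index B u ℕₚ.≟ i)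

  bags-cong : ∀ {P Q : Fin n → Set} {l} → (∀ {u} → P u → Q u) → (∀ {u} → Q u → P u) → Bags P l → Bags Q l
  bags-cong f g B = record
    { index = index B
    ; index≤ = λ q → index≤ B (g q)
    ; conn = λ i → conn-cong (λ (p , e) → f p , e) (λ (q , e) → g q , e) (conn B i)
    ; touch = λ i lt → touch-mono (λ (p , e) → f p , e) (λ (p , e) → f p , e) (touch B i lt)
    ; inhabited = λ i le → let (u , p , e) = inhabited B i le in u , f p , e
    }

  oneBag : ∀ {P r} → Conn P → P r → Bags P 0
  oneBag {r = r} c p = record
    { index = λ _ → 0
    ; index≤ = λ _ → z≤n
    ; conn = λ i → λ { (p , refl) (q , _) → in-mono (λ p → p , refl) (c p q) }
    ; touch = λ i ()
    ; inhabited = λ { zero z≤n → r , p , refl }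
    }

  module _ {P : Fin n → Set} {l : ℕ} (B : Bags P l) where

    private
      Segment : ℕ → ℕ → Fin n → Set
      Segment a b u = P u × a ≤ index B u × index B u < b

      climb : ∀ {a b} d {u v} → Segment a b u → Segment a b v → index B u + d ≡ index B v →
        Reach (In (Segment a b)) u v
      climb zero {u} {v} (p , lo , hi) (q , _) eq =
        in-mono (λ { (r , e) → r , subst (_ ≤_) (sym e) lo , subst (_< _) (sym e) hi })
          (conn B (index B u) (p , refl) (q , trans (sym eq) (+-identityʳ _)))
      climb (suc d) {u} {v} (p , lo , hi) (q , lo′ , hi′) eq
        with touch B (index B u) (≤-trans i< (index≤ B q))
        where
        i< : index B u < index B v
        i< = subst (index B u <_) eq (m<m+n (index B u) (s≤s z≤n))
      ... | x , y , (px , ex) , (py , ey) , e =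
        reach-trans (climb zero {u} {x} (p , lo , hi) segx (trans (+-identityʳ _) (sym ex)))
          (step (e , segx , segy) (climb d {y} {v} segy (q , lo′ , hi′)
            (trans (cong (_+ d) ey) (trans (sym (+-suc (index B u) d)) eq))))
        where
        i< : index B u < index B v
        i< = subst (index B u <_) eq (m<m+n (index B u) (s≤s z≤n))
        segx : Segment _ _ x
        segx = px , subst (_ ≤_) (sym ex) lo , subst (_< _) (sym ex) hi
        segy : Segment _ _ y
        segy = py , subst (_ ≤_) (sym ey) (m≤n⇒m≤1+n lo) , subst (_< _) (sym ey) (≤-<-trans i< hi′)

    conn-segment : ∀ a b → Conn (λ u → P u × a ≤ index B u × index B u < b)
    conn-segment a b {u} {v} p q with ≤-total (index B u) (index B v)
    ... | inj₁ le = climb (index B v ∸ index B u) p q (m+[n∸m]≡n le)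
    ... | inj₂ le = reach-sym in-sym (climb (index B u ∸ index B v) q p (m+[n∸m]≡n le))

    conn-bags : Conn P
    conn-bags = conn-cong proj₁ (λ p → p , z≤n , s≤s (index≤ B p)) (conn-segment 0 (suc l))

    coarsen : ∀ {b m} → Cuts b m l → Bags P m
    coarsen {b} {m} C = record
      { index = λ u → locate b m (index B u)
      ; index≤ = λ {u} _ → locate-≤ b m (index B u)
      ; conn = λ i → conn-coarse i
      ; touch = coarse-touch
      ; inhabited = λ i i≤ → let (u , p , e) = inhabited B (b i) (b≤ i i≤) in
          u , p , locate-unique C i≤ (≤-reflexive (sym e)) (subst (_< b (suc i)) (sym e) (increasing C i i≤))
      }
      where
      b≤ : ∀ i → i ≤ m → b i ≤ l
      b≤ i i≤ = ≤-pred (subst (b i <_) (ends C) (<-≤-trans (increasing C i i≤) (cuts-mono C (s≤s i≤) ≤-refl)))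
      top : ∀ {u} → P u → index B u < b (suc m)
      top p = subst (_ <_) (sym (ends C)) (s≤s (index≤ B p))
      conn-coarse : ∀ i → Conn (λ u → P u × locate b m (index B u) ≡ i)
      conn-coarse i {u} {v} (p , refl) (q , e) =
        in-mono (λ (r , lo , hi) → r , locate-unique C (locate-≤ b m (index B u)) lo hi)
          (conn-segment (b i) (b (suc i))
            (p , locate-lower {b} (begins C) m _ , locate-upper b m _ (top p))
            (q , subst (λ j → b j ≤ index B v) e (locate-lower {b} (begins C) m _)
               , subst (λ j → index B v < b (suc j)) e (locate-upper b m _ (top q))))
      coarse-touch : ∀ i → i < m → Touch (λ u → P u × locate b m (index B u) ≡ i) (λ u → P u × locate b m (index B u) ≡ suc i)
      coarse-touch i lt with b (suc i) in eq | increasing C i (<⇒≤ lt) | b≤ (suc i) lt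
      ... | suc j | s≤s lo | j< = touch-mono
        (λ { (p , refl) → p , locate-unique C (<⇒≤ lt) lo (≤-reflexive (sym eq)) })
        (λ { (p , e) → p , locate-unique C lt (≤-reflexive (trans eq (sym e)))
               (subst (_< _) (trans eq (sym e)) (increasing C (suc i) lt)) })
        (touch B j j<)

    coarsen-index : ∀ {b m} (C : Cuts b m l) {u j} → j ≤ m → b j ≤ index B u → index B u < b (suc j) →
      index (coarsen C) u ≡ j
    coarsen-index C = locate-unique C

    reverse : Bags P l
    reverse = record
      { index = λ u → l ∸ index B u
      ; index≤ = λ {u} _ → m∸n≤m l (index B u)
      ; conn = λ i → λ { {u} {v} (p , refl) (q , e) →
          in-mono (λ { (r , e′) → r , cong (l ∸_) e′ })
            (conn B (index B u) (p , refl) (q , ∸-cancelˡ-≡ (index≤ B q) (index≤ B p) e)) }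
      ; touch = λ i lt → touch-mono
          (λ { (p , e) → p , trans (cong (l ∸_) (trans e (sym (+-∸-assoc 1 lt)))) (m∸[m∸n]≡n (<⇒≤ lt)) })
          (λ { (p , e) → p , trans (cong (l ∸_) e) (m∸[m∸n]≡n lt) })
          (touch-sym (touch B (l ∸ suc i) (∸-monoʳ-< (s≤s z≤n) lt)))
      ; inhabited = λ i le → let (u , p , e) = inhabited B (l ∸ i) (m∸n≤m l i) in
          u , p , trans (cong (l ∸_) e) (m∸[m∸n]≡n le)
      }

    prepend : ∀ {Q : Fin n → Set} → (∀ u → Dec (Q u)) → Conn Q → (∀ {u} → Q u → P u → ⊥) → Touch Q (Bag B 0) →
      Bags (λ u → Q u ⊎ P u) (suc l)
    prepend {Q} Q? cQ disjoint tQ = record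
      { index = index′
      ; index≤ = λ {u} → bound u
      ; conn = λ { zero → conn-cong (λ q → inj₁ q , index-Q q) (λ (p , e) → zero⇒Q p e) cQ
                 ; (suc i) → conn-cong (λ (p , e) → inj₂ p , trans (index-P p) (cong suc e))
                     (λ (p , e) → suc⇒P p e) (conn B i) }
      ; touch = λ { zero _ → touch-mono (λ q → inj₁ q , index-Q q)
                      (λ (p , e) → inj₂ p , trans (index-P p) (cong suc e)) tQ
                  ; (suc i) (s≤s lt) → touch-mono (λ (p , e) → inj₂ p , trans (index-P p) (cong suc e))
                      (λ (p , e) → inj₂ p , trans (index-P p) (cong suc e)) (touch B i lt) }
      ; inhabited = λ { zero _ → let (u , _ , q , _) = tQ in u , inj₁ q , index-Q q
                      ; (suc i) (s≤s le) → let (u , p , e) = inhabited B i le in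
                          u , inj₂ p , trans (index-P p) (cong suc e) }
      }
      where
      index′ : Fin n → ℕ
      index′ u = if does (Q? u) then 0 else suc (index B u)
      index-Q : ∀ {u} → Q u → index′ u ≡ 0
      index-Q {u} q with Q? u
      ... | yes _ = refl
      ... | no ¬q = ⊥-elim (¬q q)
      index-P : ∀ {u} → P u → index′ u ≡ suc (index B u)
      index-P {u} p with Q? u
      ... | yes q = ⊥-elim (disjoint q p)
      ... | no _ = refl
      bound : ∀ u → Q u ⊎ P u → index′ u ≤ suc l
      bound u (inj₁ q) = subst (_≤ suc l) (sym (index-Q q)) z≤n
      bound u (inj₂ p) = subst (_≤ suc l) (sym (index-P p)) (s≤s (index≤ B p))
      zero⇒Q : ∀ {u} → Q u ⊎ P u → index′ u ≡ 0 → Q u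
      zero⇒Q (inj₁ q) _ = q
      zero⇒Q (inj₂ p) e with trans (sym (index-P p)) e
      ... | ()
      suc⇒P : ∀ {u i} → Q u ⊎ P u → index′ u ≡ suc i → P u × index B u ≡ i
      suc⇒P (inj₁ q) e with trans (sym (index-Q q)) e
      ... | ()
      suc⇒P (inj₂ p) e = p , ℕₚ.suc-injective (trans (sym (index-P p)) e)

    prepend-zero : ∀ {Q : Fin n → Set} (Q? : ∀ u → Dec (Q u)) (cQ : Conn Q) (disjoint : ∀ {u} → Q u → P u → ⊥) tQ {u} → Q u →
      index (prepend {Q} Q? cQ disjoint tQ) u ≡ 0
    prepend-zero Q? cQ disjoint tQ {u} q with Q? u
    ... | yes _ = refl
    ... | no ¬q = ⊥-elim (¬q q)

    prepend-suc : ∀ {Q : Fin n → Set} (Q? : ∀ u → Dec (Q u)) (cQ : Conn Q) (disjoint : ∀ {u} → Q u → P u → ⊥) tQ {u} → P u →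
      index (prepend {Q} Q? cQ disjoint tQ) u ≡ suc (index B u)
    prepend-suc Q? cQ disjoint tQ {u} p with Q? u
    ... | yes q = ⊥-elim (disjoint q p)
    ... | no _ = refl

    absorb : ∀ {Q : Fin n → Set} → (∀ u → Dec (Q u)) → Conn Q → (∀ {u} → Q u → P u → ⊥) →
      ∀ k → k ≤ l → Touch Q (Bag B k) → Bags (λ u → Q u ⊎ P u) l
    absorb {Q} Q? cQ disjoint k k≤ tQ = record
      { index = index′
      ; index≤ = λ { {u} (inj₁ q) → subst (_≤ l) (sym (index-Q q)) k≤
                   ; {u} (inj₂ p) → subst (_≤ l) (sym (index-P p)) (index≤ B p) }
      ; conn = connected
      ; touch = λ i lt → touch-mono keep keep (touch B i lt)
      ; inhabited = λ i le → let (u , p , e) = inhabited B i le in u , keep (p , e)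
      }
      where
      index′ : Fin n → ℕ
      index′ u = if does (Q? u) then k else index B u
      index-Q : ∀ {u} → Q u → index′ u ≡ k
      index-Q {u} q with Q? u
      ... | yes _ = refl
      ... | no ¬q = ⊥-elim (¬q q)
      index-P : ∀ {u} → P u → index′ u ≡ index B u
      index-P {u} p with Q? u
      ... | yes q = ⊥-elim (disjoint q p)
      ... | no _ = refl
      keep : ∀ {u i} → P u × index B u ≡ i → (Q u ⊎ P u) × index′ u ≡ i
      keep (p , e) = inj₂ p , trans (index-P p) e
      connected : ∀ i → Conn (λ u → (Q u ⊎ P u) × index′ u ≡ i)
      connected i with i ℕₚ.≟ k
      ... | yes refl = conn-cong
        (λ { (inj₁ q) → inj₁ q , index-Q q ; (inj₂ b) → keep b })
        (λ { (inj₁ q , _) → inj₁ q ; (inj₂ p , e) → inj₂ (p , trans (sym (index-P p)) e) })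
        (conn-∪ cQ (conn B k) tQ)
      ... | no i≢k = conn-cong keep
        (λ { (inj₁ q , e) → ⊥-elim (i≢k (trans (sym e) (index-Q q)))
           ; (inj₂ p , e) → p , trans (sym (index-P p)) e })
        (conn B i)

    absorb-new : ∀ {Q : Fin n → Set} (Q? : ∀ u → Dec (Q u)) (cQ : Conn Q) (disjoint : ∀ {u} → Q u → P u → ⊥) k k≤ tQ {u} → Q u →
      index (absorb {Q} Q? cQ disjoint k k≤ tQ) u ≡ k
    absorb-new Q? cQ disjoint k k≤ tQ {u} q with Q? u
    ... | yes _ = refl
    ... | no ¬q = ⊥-elim (¬q q)

    absorb-old : ∀ {Q : Fin n → Set} (Q? : ∀ u → Dec (Q u)) (cQ : Conn Q) (disjoint : ∀ {u} → Q u → P u → ⊥) k k≤ tQ {u} → P u →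
      index (absorb {Q} Q? cQ disjoint k k≤ tQ) u ≡ index B u
    absorb-old Q? cQ disjoint k k≤ tQ {u} p with Q? u
    ... | yes q = ⊥-elim (disjoint q p)
    ... | no _ = refl

  range : ∀ {P l} (B : Bags P l) a m → a + m ≤ l → Bags (λ u → P u × a ≤ index B u × index B u ≤ a + m) m
  range {P} {l} B a m le = record
    { index = λ u → index B u ∸ a
    ; index≤ = λ {u} (p , lo , hi) → subst (index B u ∸ a ≤_) (m+n∸m≡n a m) (∸-monoˡ-≤ a hi)
    ; conn = conn-range
    ; touch = λ i lt → touch-mono (to (<⇒≤ lt)) (λ (p , e) → to lt (p , trans e (sym (+-suc a i))))
        (touch B (a + i) (<-≤-trans (+-monoʳ-< a lt) le))
    ; inhabited = λ i i≤ → let (u , b) = inhabited B (a + i) (≤-trans (+-monoʳ-≤ a i≤) le) in u , to i≤ b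
    }
    where
    to : ∀ {u i} → i ≤ m → Bag B (a + i) u → (P u × a ≤ index B u × index B u ≤ a + m) × index B u ∸ a ≡ i
    to {u} {i} i≤ (p , e) = (p , subst (a ≤_) (sym e) (m≤m+n a i) , subst (_≤ a + m) (sym e) (+-monoʳ-≤ a i≤)) ,
      trans (cong (_∸ a) e) (m+n∸m≡n a i)
    conn-range : ∀ i → Conn (λ u → (P u × a ≤ index B u × index B u ≤ a + m) × index B u ∸ a ≡ i)
    conn-range i {u} {v} ((p , lo , hi) , refl) ((q , lo′ , _) , e) =
      in-mono (to (subst (index B u ∸ a ≤_) (m+n∸m≡n a m) (∸-monoˡ-≤ a hi)))
        (conn B (a + (index B u ∸ a)) (p , sym (m+[n∸m]≡n lo)) (q , trans (sym (m+[n∸m]≡n lo′)) (cong (a +_) e)))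

  suffix : ∀ {P l} a (B : Bags P (a + l)) → Bags (λ u → P u × a ≤ index B u) l
  suffix {P} {l} a B = bags-cong (λ (p , lo , _) → p , lo) (λ (p , lo) → p , lo , index≤ B p) (range B a l ≤-refl)

-- Menger's theorem

injective⇒surjective : ∀ {k m} (f : Fin k → Fin m) → (∀ {i j} → f i ≡ f j → i ≡ j) → m ≤ k →
  ∀ y → ∃[ x ] f x ≡ y
injective⇒surjective {k} {suc m} f inj m≤k y with any? (λ x → f x ≟ y)
... | yes p = p
... | no ¬p = ⊥-elim (<⇒≱ m≤k (injective⇒≤ {f = λ x → punchOut (λ e → ¬p (x , sym e))}
    λ {i} {j} e → inj (punchOut-injective {i = y} (λ e′ → ¬p (i , sym e′)) (λ e′ → ¬p (j , sym e′)) e)))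

module Menger {n : ℕ} where
  private
    V : Set
    V = Fin n

  _∈?_ : ∀ (u : V) xs → Dec (u ∈ xs)
  u ∈? xs = Any.any? (u ≟_) xs

  Edge : List (V × V) → V → V → Set
  Edge es u v = (u , v) ∈ es ⊎ (v , u) ∈ es

  edge? : ∀ es u v → Dec (Edge es u v)
  edge? es u v = member (u , v) ⊎-dec member (v , u)
    where
    member : ∀ p → Dec (p ∈ es)
    member (a , b) = Any.any? (λ (c , d) → map′ (λ { (refl , refl) → refl }) (λ { refl → refl , refl }) ((a ≟ c) ×-dec (b ≟ d))) es

  edge-sym : ∀ {es u v} → Edge es u v → Edge es v u
  edge-sym (inj₁ p) = inj₂ p
  edge-sym (inj₂ p) = inj₁ p

  Inside : List (V × V) → (V → Set) → V → V → Set
  Inside es P a b = Edge es a b × P a × P b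

  inside-sym : ∀ {es P a b} → Inside es P a b → Inside es P b a
  inside-sym {es} (e , p , q) = edge-sym {es} e , q , p

  Separates : List (V × V) → (V → Set) → (V → Set) → List V → Set
  Separates es S T X = ∀ {s t} → S s → T t → s ∉ X → t ∉ X → ¬ Reach (Inside es (_∉ X)) s t

  -- A path is a set `on i` containing a walk from its source to its target. Only these sets are
  -- disjoint, and a walk may repeat vertices; this makes gluing easy, and `simplePath` erases loops
  -- later.
  record DisjointPaths (es : List (V × V)) (S T : V → Set) (k : ℕ) : Set₁ where
    field
      on : Fin k → V → Set
      source target : Fin k → V
      source∈ : ∀ i → S (source i)
      target∈ : ∀ i → T (target i)
      on-source : ∀ i → on i (source i)
      path : ∀ i → Reach (Inside es (on i)) (source i) (target i)
      disjoint : ∀ {i j u} → on i u → on j u → i ≡ j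

  -- When the target set Z has no more elements than there are paths, cutting every path at its first
  -- vertex in Z leaves exactly one element of Z on each path.
  module Trim {es S Z k} (D : DisjointPaths es S (_∈ Z) k) (Z≤k : length Z ≤ k) where
    private
      module D = DisjointPaths D

      Leave : Fin k → V → V → Set
      Leave i a b = Inside es (D.on i) a b × a ∉ Z

      cutAtZ : ∀ i {u v} → Reach (Inside es (D.on i)) u v → v ∈ Z → ∃[ t ] (t ∈ Z × Reach (Leave i) u t)
      cutAtZ i {u} p v∈ with u ∈? Z
      cutAtZ i {u} p v∈ | yes u∈ = u , u∈ , here
      cutAtZ i here v∈ | no u∉ = ⊥-elim (u∉ v∈)
      cutAtZ i (step e p) v∈ | no u∉ with cutAtZ i p v∈
      ... | t , t∈ , q = t , t∈ , step (e , u∉) q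

      hit : ∀ i → ∃[ t ] (t ∈ Z × Reach (Leave i) (D.source i) t)
      hit i = cutAtZ i (D.path i) (D.target∈ i)

    end : Fin k → V
    end i = proj₁ (hit i)

    Trimmed : Fin k → V → Set
    Trimmed i u = Reach (Leave i) (D.source i) u

    trimmed-end : ∀ i → Trimmed i (end i)
    trimmed-end i = proj₂ (proj₂ (hit i))

    trimmed⇒on : ∀ {i u} → Trimmed i u → D.on i u
    trimmed⇒on {i} = go (D.on-source i)
      where
      go : ∀ {u v} → D.on i u → Reach (Leave i) u v → D.on i v
      go p here = p
      go p (step ((_ , _ , q) , _) r) = go q r

    trimmed-path : ∀ {i} → Reach (Inside es (Trimmed i)) (D.source i) (end i)
    trimmed-path {i} = go here (trimmed-end i)
      where
      go : ∀ {u v} → Trimmed i u → Reach (Leave i) u v → Reach (Inside es (Trimmed i)) u v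
      go p here = here
      go p (step r q) = step (proj₁ (proj₁ r) , p , p′) (go p′ q)
        where p′ = reach-trans p (step r here)

    outside : ∀ {i u} X → (∀ {w} → w ∈ X → w ∈ Z) → u ∉ X → Trimmed i u →
      D.source i ∉ X × Reach (Inside es (_∉ X)) (D.source i) u
    outside {i} X X⊆Z u∉ = go
      where
      go : ∀ {w} → Reach (Leave i) w _ → w ∉ X × Reach (Inside es (_∉ X)) w _
      go here = u∉ , here
      go (step ((e , _ , _) , w∉) r) with go r
      ... | v∉ , q = (λ w∈ → w∉ (X⊆Z w∈)) , step (e , (λ w∈ → w∉ (X⊆Z w∈)) , v∉) q

    position : Fin k → Fin (length Z)
    position i = Any.index (proj₁ (proj₂ (hit i)))

    lookup-position : ∀ i → end i ≡ lookup Z (position i)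
    lookup-position i = Anyₚ.lookup-index (proj₁ (proj₂ (hit i)))

    position-injective : ∀ {i j} → position i ≡ position j → i ≡ j
    position-injective {i} {j} e = D.disjoint (trimmed⇒on (trimmed-end i))
      (subst (D.on j) (trans (lookup-position j) (trans (cong (lookup Z) (sym e)) (sym (lookup-position i))))
        (trimmed⇒on (trimmed-end j)))

    position-surjective : ∀ q → ∃[ i ] position i ≡ q
    position-surjective = injective⇒surjective position position-injective Z≤k

    position-unique : ∀ {i u} q → Trimmed i u → u ≡ lookup Z q → position i ≡ q
    position-unique {i} q p refl with position-surjective q
    ... | j , refl = cong position (D.disjoint (trimmed⇒on p)
            (subst (D.on j) (lookup-position j) (trimmed⇒on (trimmed-end j))))

  -- Göring's induction step: the edge xy crosses the cut X, which separates S from T in the other edges es.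
  module Augment {es es⁺ : List (V × V)} {x y : V} {S T : V → Set} (X : List V)
    (split : ∀ {u v} → Edge es⁺ u v → Edge es u v ⊎ (u ≡ x × v ≡ y) ⊎ (u ≡ y × v ≡ x))
    (extend : ∀ {u v} → Edge es u v → Edge es⁺ u v) (xy : Edge es⁺ x y)
    (separates : Separates es S T X)
    (A? : ∀ u → Dec (∃[ s ] (S s × s ∉ X × Reach (Inside es (_∉ X)) s u)))
    where

    A : V → Set
    A u = ∃[ s ] (S s × s ∉ X × Reach (Inside es (_∉ X)) s u)

    A-step : ∀ {u v} → A u → u ∉ X → v ∉ X → Edge es u v → A v
    A-step (s , s∈ , s∉ , p) u∉ v∉ e = s , s∈ , s∉ , reach-trans p (step (e , u∉ , v∉) here)

    A-outside : ∀ {u} → A u → u ∉ X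
    A-outside (s , _ , s∉ , p) = go s∉ p
      where
      go : ∀ {u v} → u ∉ X → Reach (Inside es (_∉ X)) u v → v ∉ X
      go p here = p
      go _ (step (_ , _ , q) r) = go q r

    A-T : ∀ {u} → A u → ¬ T u
    A-T a@(s , s∈ , s∉ , p) t∈ = separates s∈ t∈ s∉ (A-outside a) p

    separates-source : ¬ A y → ∀ {Y} → Separates es S (_∈ x ∷ X) Y → Separates es⁺ S T Y
    separates-source ¬Ay {Y} sep {s} {t} s∈ t∈ s∉ t∉ = start
      where
      go : ∀ {u} → A u → u ∉ Y → Reach (Inside es (_∉ Y)) s u → ¬ Reach (Inside es⁺ (_∉ Y)) u t
      go {u} a u∉ acc p with u ≟ x
      go {u} a u∉ acc p | yes refl = sep s∈ (here refl) s∉ u∉ acc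
      go {u} a u∉ acc here | no _ = A-T a t∈
      go {u} a u∉ acc (step {v = v} (e , _ , v∉) p) | no u≢x with split e
      ... | inj₂ (inj₁ (u≡x , _)) = u≢x u≡x
      ... | inj₂ (inj₂ (refl , _)) = ¬Ay a
      ... | inj₁ e′ with v ∈? X
      ...   | yes v∈ = sep s∈ (there v∈) s∉ v∉ (reach-trans acc (step (e′ , u∉ , v∉) here))
      ...   | no v∉X = go (A-step a (A-outside a) v∉X e′) v∉ (reach-trans acc (step (e′ , u∉ , v∉) here)) p
      start : ¬ Reach (Inside es⁺ (_∉ Y)) s t
      start p with s ∈? X
      ... | yes s∈X = sep s∈ (there s∈X) s∉ s∉ here
      ... | no s∉X = go (s , s∈ , s∉X , here) s∉ here p

    -- The walk is read from its end. As long as neither `y` nor `X` has been met, the suffix is a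
    -- walk in `es` outside `A`: entering `A` would take an edge of `es` through `X` or the edge
    -- `xy` from `y`. Since the start lies in `S`, the suffix cannot stay clean to the beginning.
    separates-target : A x → ¬ A y → ∀ {Y} → Separates es T (_∈ y ∷ X) Y → Separates es⁺ S T Y
    separates-target Ax ¬Ay {Y} sep {s} {t} s∈ t∈ s∉ t∉ p = finish (go s∉ p)
      where
      Late Clean : V → Set
      Late _ = ∃[ z ] (z ∈ y ∷ X × z ∉ Y × Reach (Inside es (_∉ Y)) z t)
      Clean u = Reach (Inside es (_∉ Y)) u t × ¬ A u × u ∉ X
      go : ∀ {u} → u ∉ Y → Reach (Inside es⁺ (_∉ Y)) u t → Late u ⊎ Clean u
      go u∉ here with t ∈? X
      ... | yes t∈X = inj₁ (t , there t∈X , u∉ , here)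
      ... | no t∉X = inj₂ (here , (λ a → A-T a t∈) , t∉X)
      go {u} u∉ (step {v = v} (e , _ , v∉) q) with go v∉ q
      ... | inj₁ late = inj₁ late
      ... | inj₂ (r , ¬Av , v∉X) with split e
      ... | inj₂ (inj₁ (_ , refl)) = inj₁ (v , here refl , v∉ , r)
      ... | inj₂ (inj₂ (_ , refl)) = ⊥-elim (¬Av Ax)
      ... | inj₁ e′ with u ∈? X
      ...   | yes u∈X = inj₁ (u , there u∈X , u∉ , step (e′ , u∉ , v∉) r)
      ...   | no u∉X = inj₂ (step (e′ , u∉ , v∉) r , (λ a → ¬Av (A-step a u∉X v∉X e′)) , u∉X)
      finish : Late s ⊎ Clean s → ⊥
      finish (inj₁ (z , z∈ , z∉ , r)) = sep t∈ z∈ t∉ z∉ (reach-sym (inside-sym {es}) r)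
      finish (inj₂ (_ , ¬As , s∉X)) = ¬As (s , s∈ , s∉X , here)

    -- As `x ∷ X` and `y ∷ X` have at most `k` elements, trimming leaves each element on exactly one
    -- path of either system; `partner` matches the paths by position in these lists. A vertex
    -- common to both systems lies in `X`, for otherwise `S` and `T` would be joined in `es` off
    -- `X`.
    join : ∀ {k} → length X < k → DisjointPaths es S (_∈ x ∷ X) k → DisjointPaths es T (_∈ y ∷ X) k →
      DisjointPaths es⁺ S T k
    join {k} lt D₁ D₂ = record
      { on = λ i u → Trim₁.Trimmed i u ⊎ Trim₂.Trimmed (partner i) u
      ; source = D₁.source
      ; target = λ i → D₂.source (partner i)
      ; source∈ = D₁.source∈
      ; target∈ = λ i → D₂.source∈ (partner i)
      ; on-source = λ i → inj₁ here
      ; path = λ i → reach-trans (reach-map (λ (e , p , q) → extend e , inj₁ p , inj₁ q) Trim₁.trimmed-path)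
          (reach-trans (link i (Trim₁.position i) (Trim₁.lookup-position i)
              (trans (Trim₂.lookup-position (partner i)) (cong (lookup (y ∷ X)) (partner-position i))))
            (reach-map (λ (e , p , q) → extend e , inj₂ p , inj₂ q)
              (reach-sym (inside-sym {es}) Trim₂.trimmed-path)))
      ; disjoint = disjoint′
      }
      where
      module D₁ = DisjointPaths D₁
      module D₂ = DisjointPaths D₂
      module Trim₁ = Trim D₁ lt
      module Trim₂ = Trim D₂ lt
      partner : Fin k → Fin k
      partner i = proj₁ (Trim₂.position-surjective (Trim₁.position i))
      partner-position : ∀ i → Trim₂.position (partner i) ≡ Trim₁.position i
      partner-position i = proj₂ (Trim₂.position-surjective (Trim₁.position i))
      link : ∀ i q → Trim₁.end i ≡ lookup (x ∷ X) q → Trim₂.end (partner i) ≡ lookup (y ∷ X) q →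
        Reach (Inside es⁺ (λ u → Trim₁.Trimmed i u ⊎ Trim₂.Trimmed (partner i) u)) (Trim₁.end i) (Trim₂.end (partner i))
      -- Position 0 is `x` on one side and `y` on the other, joined by the new edge; any other
      -- position is the same vertex of `X` on both sides.
      link i zero e₁ e₂ = step (subst (Edge es⁺ _) (sym e₂) (subst (λ a → Edge es⁺ a y) (sym e₁) xy)
        , inj₁ (Trim₁.trimmed-end i) , inj₂ (Trim₂.trimmed-end (partner i))) here
      link i (suc q) e₁ e₂ = subst (Reach _ (Trim₁.end i)) (trans e₁ (sym e₂)) here
      crossing : ∀ {i j u} → Trim₁.Trimmed i u → Trim₂.Trimmed (partner j) u → i ≡ j
      crossing {i} {j} {u} p q with u ∈? X
      ... | yes u∈ = Trim₁.position-injective (trans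
              (Trim₁.position-unique (suc (Any.index u∈)) p (Anyₚ.lookup-index u∈))
              (sym (trans (sym (partner-position j))
                (Trim₂.position-unique (suc (Any.index u∈)) q (Anyₚ.lookup-index u∈)))))
      ... | no u∉ with Trim₁.outside X there u∉ p | Trim₂.outside X there u∉ q
      ...   | s∉ , walk₁ | t∉ , walk₂ = ⊥-elim (separates (D₁.source∈ i) (D₂.source∈ (partner j)) s∉ t∉
                (reach-trans walk₁ (reach-sym (inside-sym {es}) walk₂)))
      disjoint′ : ∀ {i j u} → Trim₁.Trimmed i u ⊎ Trim₂.Trimmed (partner i) u →
        Trim₁.Trimmed j u ⊎ Trim₂.Trimmed (partner j) u → i ≡ j
      disjoint′ (inj₁ p) (inj₁ q) = D₁.disjoint (Trim₁.trimmed⇒on p) (Trim₁.trimmed⇒on q)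
      disjoint′ (inj₁ p) (inj₂ q) = crossing p q
      disjoint′ (inj₂ p) (inj₁ q) = sym (crossing q p)
      disjoint′ {i} {j} (inj₂ p) (inj₂ q) = Trim₁.position-injective
        (trans (sym (partner-position i)) (trans
          (cong Trim₂.position (D₂.disjoint (Trim₂.trimmed⇒on p) (Trim₂.trimmed⇒on q))) (partner-position j)))

  MengerOutcome : List (V × V) → ℕ → (V → Set) → (V → Set) → Set₁
  MengerOutcome es k S T = (∃[ X ] (length X < k × Separates es S T X)) ⊎ DisjointPaths es S T k

  -- Induction on the edge list; without edges, paths are single vertices in both sets. A small cut
  -- `X` of the graph without `xy` still works unless exactly one end of `xy` lies on the side of
  -- `S`. In that case the induction hypothesis is used twice, for `S` and for `T`, each against `X`
  -- enlarged by the end of `xy` on its own side.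
  menger : ∀ es k {S T : V → Set} → (∀ u → Dec (S u)) → (∀ u → Dec (T u)) → MengerOutcome es k S T
  menger [] k {S} {T} S? T? with k ≤? length (filter (λ u → S? u ×-dec T? u) (allFin n))
  ... | yes le = inj₂ record
    { on = λ i u → u ≡ vertex i
    ; source = vertex ; target = vertex
    ; source∈ = λ i → proj₁ (vertex∈ i) ; target∈ = λ i → proj₂ (vertex∈ i)
    ; on-source = λ i → refl
    ; path = λ i → here
    ; disjoint = λ { {i} {j} refl e → inject≤-injective le le i j
        (unique-lookup (Uniqueₚ.filter⁺ (λ u → S? u ×-dec T? u) (Uniqueₚ.allFin⁺ n)) _ _ e) }
    }
    where
    both : List V
    both = filter (λ u → S? u ×-dec T? u) (allFin n)
    vertex : Fin k → V
    vertex i = lookup both (inject≤ i le)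
    vertex∈ : ∀ i → S (vertex i) × T (vertex i)
    vertex∈ i = proj₂ (∈-filter⁻ (λ u → S? u ×-dec T? u) {xs = allFin n} (∈-lookup {xs = both} (inject≤ i le)))
  ... | no ¬le = inj₁ (_ , ≰⇒> ¬le , λ
    { s∈ t∈ s∉ t∉ here → s∉ (∈-filter⁺ (λ u → S? u ×-dec T? u) (∈-allFin _) (s∈ , t∈))
    ; s∈ t∈ s∉ t∉ (step (inj₁ () , _) _)
    ; s∈ t∈ s∉ t∉ (step (inj₂ () , _) _) })
  menger ((x , y) ∷ es) k {S} {T} S? T? with menger es k S? T?
  ... | inj₂ D = inj₂ record
    { on = D.on ; source = D.source ; target = D.target ; source∈ = D.source∈ ; target∈ = D.target∈
    ; on-source = D.on-source
    ; path = λ i → reach-map (λ { (inj₁ e , p) → inj₁ (there e) , p ; (inj₂ e , p) → inj₂ (there e) , p }) (D.path i)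
    ; disjoint = D.disjoint }
    where module D = DisjointPaths D
  ... | inj₁ (X , lt , sep) = cross (A? x) (A? y)
    where
    es⁺ : List (V × V)
    es⁺ = (x , y) ∷ es
    A? : ∀ u → Dec (∃[ s ] (S s × s ∉ X × Reach (Inside es (_∉ X)) s u))
    A? u = any? λ s → S? s ×-dec ¬? (s ∈? X) ×-dec
      reach? (λ a b → edge? es a b ×-dec ¬? (a ∈? X) ×-dec ¬? (b ∈? X)) s u
    extend : ∀ {u v} → Edge es u v → Edge es⁺ u v
    extend (inj₁ e) = inj₁ (there e)
    extend (inj₂ e) = inj₂ (there e)
    split : ∀ {u v} → Edge es⁺ u v → Edge es u v ⊎ (u ≡ x × v ≡ y) ⊎ (u ≡ y × v ≡ x)
    split (inj₁ (here refl)) = inj₂ (inj₁ (refl , refl))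
    split (inj₁ (there e)) = inj₁ (inj₁ e)
    split (inj₂ (here refl)) = inj₂ (inj₂ (refl , refl))
    split (inj₂ (there e)) = inj₁ (inj₂ e)
    split′ : ∀ {u v} → Edge es⁺ u v → Edge es u v ⊎ (u ≡ y × v ≡ x) ⊎ (u ≡ x × v ≡ y)
    split′ e with split e
    ... | inj₁ p = inj₁ p
    ... | inj₂ (inj₁ p) = inj₂ (inj₂ p)
    ... | inj₂ (inj₂ p) = inj₂ (inj₁ p)
    module Forward = Augment {es} {es⁺} {x} {y} {S} {T} X split extend (inj₁ (here refl)) sep A?
    module Backward = Augment {es} {es⁺} {y} {x} {S} {T} X split′ extend (inj₂ (here refl)) sep A?
    closed : (∀ {u v} → Forward.A u → v ∉ X → Edge es⁺ u v → Forward.A v) → Separates es⁺ S T X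
    closed next s∈ t∈ s∉ t∉ p = go (_ , s∈ , s∉ , here) p
      where
      go : ∀ {u} → Forward.A u → ¬ Reach (Inside es⁺ (_∉ X)) u _
      go a here = Forward.A-T a t∈
      go a (step (e , _ , v∉) q) = go (next a v∉ e) q
    cross : Dec (Forward.A x) → Dec (Forward.A y) → MengerOutcome es⁺ k S T
    cross (yes Ax) (yes Ay) = inj₁ (X , lt , closed λ a v∉ e → case split e of λ
      { (inj₁ e′) → Forward.A-step a (Forward.A-outside a) v∉ e′
      ; (inj₂ (inj₁ (_ , refl))) → Ay ; (inj₂ (inj₂ (_ , refl))) → Ax })
    cross (no ¬Ax) (no ¬Ay) = inj₁ (X , lt , closed λ a v∉ e → case split e of λ
      { (inj₁ e′) → Forward.A-step a (Forward.A-outside a) v∉ e′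
      ; (inj₂ (inj₁ (refl , _))) → ⊥-elim (¬Ax a) ; (inj₂ (inj₂ (refl , _))) → ⊥-elim (¬Ay a) })
    cross (yes Ax) (no ¬Ay) with menger es k S? (_∈? (x ∷ X)) | menger es k T? (_∈? (y ∷ X))
    ... | inj₁ (Y , lt′ , sep′) | _ = inj₁ (Y , lt′ , Forward.separates-source ¬Ay sep′)
    ... | inj₂ _ | inj₁ (Y , lt′ , sep′) = inj₁ (Y , lt′ , Forward.separates-target Ax ¬Ay sep′)
    ... | inj₂ D₁ | inj₂ D₂ = inj₂ (Forward.join lt D₁ D₂)
    cross (no ¬Ax) (yes Ay) with menger es k S? (_∈? (y ∷ X)) | menger es k T? (_∈? (x ∷ X))
    ... | inj₁ (Y , lt′ , sep′) | _ = inj₁ (Y , lt′ , Backward.separates-source ¬Ax sep′)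
    ... | inj₂ _ | inj₁ (Y , lt′ , sep′) = inj₁ (Y , lt′ , Backward.separates-target Ay ¬Ax sep′)
    ... | inj₂ D₁ | inj₂ D₂ = inj₂ (Backward.join lt D₁ D₂)

-- Growing classes over a graph, and branching of tagged sets

filter-split : ∀ {A : Set} {P : A → Set} (P? : Decidable P) xs →
  length (filter P? xs) + length (filter (¬? ∘ P?) xs) ≡ length xs
filter-split P? [] = refl
filter-split P? (x ∷ xs) with P? x
... | yes _ = cong suc (filter-split P? xs)
... | no _ = trans (+-suc _ _) (cong suc (filter-split P? xs))

-- Greedy choice: keep the first element and discard everything related to it, which costs at most
-- `m` elements per round unless a large class has been found.
inequivalent⊎class : ∀ {A : Set} {_∼_ : A → A → Set} (∼? : ∀ a b → Dec (a ∼ b)) d m xs → d * m < length xs →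
  (Σ (List A) λ ys → d ≤ length ys × All (_∈ xs) ys × AllPairs (λ a b → ¬ a ∼ b) ys) ⊎
  (∃[ a ] (a ∈ xs × m < length (filter (∼? a) xs)))
inequivalent⊎class ∼? zero m xs lt = inj₁ ([] , z≤n , [] , [])
inequivalent⊎class ∼? (suc d) m (x ∷ xs) lt with suc m ≤? length (filter (∼? x) (x ∷ xs))
... | yes big = inj₂ (x , here refl , big)
... | no ¬big with inequivalent⊎class ∼? d m rest (+-cancelˡ-< m (d * m) (length rest)
      (<-≤-trans lt (subst (_≤ m + length rest) (filter-split (∼? x) (x ∷ xs)) (+-monoˡ-≤ (length rest) (≮⇒≥ ¬big)))))
  where rest = filter (¬? ∘ ∼? x) (x ∷ xs)
... | inj₁ (ys , len , ys∈ , apart) = inj₁ (x ∷ ys , s≤s len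
      , here refl ∷ All.map (λ y∈ → proj₁ (∈-filter⁻ (¬? ∘ ∼? x) {xs = x ∷ xs} y∈)) ys∈
      , All.map (λ y∈ → proj₂ (∈-filter⁻ (¬? ∘ ∼? x) {xs = x ∷ xs} y∈)) ys∈ ∷ apart)
... | inj₂ (y , y∈ , big) = inj₂ (y , proj₁ (∈-filter⁻ (¬? ∘ ∼? x) {xs = x ∷ xs} y∈)
      , <-≤-trans big (filter-filter-≤ (∼? y) (¬? ∘ ∼? x) (x ∷ xs)))
  where
  filter-filter-≤ : ∀ {A : Set} {P Q : A → Set} (P? : Decidable P) (Q? : Decidable Q) zs →
    length (filter P? (filter Q? zs)) ≤ length (filter P? zs)
  filter-filter-≤ P? Q? [] = z≤n
  filter-filter-≤ P? Q? (z ∷ zs) with Q? z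
  filter-filter-≤ P? Q? (z ∷ zs) | yes _ with P? z
  ... | yes _ = s≤s (filter-filter-≤ P? Q? zs)
  ... | no _ = filter-filter-≤ P? Q? zs
  filter-filter-≤ P? Q? (z ∷ zs) | no _ with P? z
  ... | yes _ = m≤n⇒m≤1+n (filter-filter-≤ P? Q? zs)
  ... | no _ = filter-filter-≤ P? Q? zs

-- Without a heap fewer than `d` tags are lost at the root; without a star, one of the components
-- that remain holds more than `tagNumber d l` of the others.
tagNumber : ℕ → ℕ → ℕ
tagNumber d zero = 0
tagNumber d (suc l) = d + d * tagNumber d l

module Growth {n : ℕ} (E : Fin n → Fin n → Set) (E? : ∀ u v → Dec (E u v)) (E-sym : ∀ {u v} → E u v → E v u) where
  open Graphs E E? E-sym

  private
    remove : Fin n → List (Fin n) → List (Fin n)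
    remove x = filter (¬? ∘ (_≟ x))

    remove-shorter : ∀ {x xs} → x ∈ xs → length (remove x xs) < length xs
    remove-shorter {x} {xs} x∈ = filter-notAll (¬? ∘ (_≟ x)) xs (Any.map (λ e ne → ne (sym e)) x∈)

    fillFrom : ∀ fuel (todo : List (Fin n)) → length todo ≤ fuel → ∀ {P D : Fin n → Set} (D? : ∀ u → Dec (D u)) (ψ : Fin n → ℕ) →
      (∀ {u} → ¬ D u → u ∈ todo) →
      (∀ i → Conn (λ u → D u × ψ u ≡ i)) → (∀ {u} → ¬ D u → P u × ∃[ w ] (D w × Reach (In P) u w)) →
      Σ (Fin n → ℕ) λ ψ′ → (∀ {u} → D u → ψ′ u ≡ ψ u) × (∀ i → Conn (λ u → ψ′ u ≡ i)) ×
        (∀ u → D u ⊎ ∃[ w ] (D w × P w × ψ′ u ≡ ψ w))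
    fillFrom fuel todo len D? ψ covered connected walk with any? (λ u → ¬? (D? u))
    ... | no full = ψ , (λ _ → refl) , (λ i → conn-cong proj₂ (λ e → all _ , e) (connected i)) , λ u → inj₁ (all u)
      where
      all : ∀ u → _
      all u with D? u
      ... | yes d = d
      ... | no ¬d = ⊥-elim (full (u , ¬d))
    fillFrom zero [] len D? ψ covered connected walk | yes (u , ¬d) with covered ¬d
    ... | ()
    fillFrom (suc fuel) todo len {P} {D} D? ψ covered connected walk | yes (u , ¬d) with walk ¬d
    ... | pu , w , dw , p with firstHit D? p pu dw ¬d
    ... | x , y , _ , px , ¬dx , py , dy , e =
      let (ψ₂ , keep , conn₂ , from) = rec in
      ψ₂ , (λ d → trans (keep (inj₁ d)) (ψ₁-old d)) , conn₂ , λ v → origin {ψ₂} (keep {x}) v (from v)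
      where
      D₁ : Fin n → Set
      D₁ v = D v ⊎ v ≡ x
      ψ₁ : Fin n → ℕ
      ψ₁ v = if does (v ≟ x) then ψ y else ψ v
      ψ₁-new : ψ₁ x ≡ ψ y
      ψ₁-new with x ≟ x
      ... | yes _ = refl
      ... | no ne = ⊥-elim (ne refl)
      ψ₁-old : ∀ {v} → D v → ψ₁ v ≡ ψ v
      ψ₁-old {v} d with v ≟ x
      ... | yes refl = ⊥-elim (¬dx d)
      ... | no _ = refl
      conn₁ : ∀ i → Conn (λ v → D₁ v × ψ₁ v ≡ i)
      conn₁ i with ψ y ℕₚ.≟ i
      ... | yes refl = conn-cong
        (λ { (inj₁ (d , e)) → inj₁ d , trans (ψ₁-old d) e ; (inj₂ refl) → inj₂ refl , ψ₁-new })
        (λ { (inj₁ d , e) → inj₁ (d , trans (sym (ψ₁-old d)) e) ; (inj₂ refl , _) → inj₂ refl })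
        (conn-∪ {Q = _≡ x} (connected (ψ y)) (λ { refl refl → here }) (y , x , (dy , refl) , refl , E-sym e))
      ... | no ne = conn-cong (λ (d , e) → inj₁ d , trans (ψ₁-old d) e)
        (λ { (inj₁ d , e) → d , trans (sym (ψ₁-old d)) e ; (inj₂ refl , e) → ⊥-elim (ne (trans (sym ψ₁-new) e)) })
        (connected i)
      rec = fillFrom fuel (remove x todo) (≤-pred (≤-trans (remove-shorter (covered ¬dx)) len)) {P} {D₁}
        (λ v → D? v ⊎-dec (v ≟ x)) ψ₁
        (λ ¬d → ∈-filter⁺ (¬? ∘ (_≟ x)) (covered (¬d ∘ inj₁)) (¬d ∘ inj₂)) conn₁
        (λ ¬d → let (p , w , d , r) = walk (¬d ∘ inj₁) in p , w , inj₁ d , r)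
      origin : ∀ {ψ₂ : Fin n → ℕ} → (D₁ x → ψ₂ x ≡ ψ₁ x) → ∀ v → D₁ v ⊎ ∃[ w ] (D₁ w × P w × ψ₂ v ≡ ψ₁ w) →
        D v ⊎ ∃[ w ] (D w × P w × ψ₂ v ≡ ψ w)
      origin k v _ with D? v
      origin k v _ | yes d = inj₁ d
      origin k v (inj₁ (inj₁ d)) | no ¬d = inj₁ d
      origin k v (inj₁ (inj₂ refl)) | no ¬d = inj₂ (y , dy , py , trans (k (inj₂ refl)) ψ₁-new)
      origin k v (inj₂ (w , inj₁ d , pw , e)) | no ¬d = inj₂ (w , d , pw , trans e (ψ₁-old d))
      origin k v (inj₂ (w , inj₂ refl , pw , e)) | no ¬d = inj₂ (y , dy , py , trans e ψ₁-new)

  -- Unlabelled vertices join, one at a time, the class of a labelled neighbour. That neighbour lies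
  -- on a walk inside `P`, so labels spread from vertices of `P` only; classes that avoid `P`, such
  -- as single hub vertices, do not grow.
  fill : ∀ {P D : Fin n → Set} (D? : ∀ u → Dec (D u)) (ψ : Fin n → ℕ) →
    (∀ i → Conn (λ u → D u × ψ u ≡ i)) → (∀ {u} → ¬ D u → P u × ∃[ w ] (D w × Reach (In P) u w)) →
    Σ (Fin n → ℕ) λ ψ′ → (∀ {u} → D u → ψ′ u ≡ ψ u) × (∀ i → Conn (λ u → ψ′ u ≡ i)) ×
      (∀ u → D u ⊎ ∃[ w ] (D w × P w × ψ′ u ≡ ψ w))
  fill D? ψ = fillFrom n (allFin n) (≤-reflexive (length-tabulate id)) D? ψ (λ _ → ∈-allFin _)

  record HubBags (A P : Fin n → Set) {l : ℕ} (B : Bags P l) : Set₁ where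
    field
      hub : Fin n → Set
      hub? : Decidable hub
      hub-conn : Conn hub
      rest : Bags (λ u → ¬ hub u) l
      A⊆hub : ∀ {u} → A u → hub u
      P⊆rest : ∀ {u} → P u → ¬ hub u
      same-index : ∀ {u} → P u → index rest u ≡ index B u

  -- The set `A` is class 0 and bag `i` is class `i + 1`; filling the whole connected graph turns
  -- class 0 into the hub and the other classes into a row on its complement.
  grow : Conn (λ _ → ⊤) → ∀ {A P : Fin n → Set} {l a} → (∀ u → Dec (A u)) → (∀ u → Dec (P u)) → Conn A → A a →
    (∀ {u} → A u → P u → ⊥) → (B : Bags P l) → HubBags A P B
  grow connected {A} {P} {l} {a} A? P? connA a∈ disjoint B with fill {λ _ → ⊤} D? ψ classes (λ _ → tt , a , inj₁ a∈ , connected tt tt)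
    where
    D : Fin n → Set
    D u = A u ⊎ P u
    D? : Decidable D
    D? u = A? u ⊎-dec P? u
    ψ : Fin n → ℕ
    ψ u = if does (A? u) then 0 else suc (index B u)
    classes : ∀ i → Conn (λ u → D u × ψ u ≡ i)
    classes zero = conn-cong to from connA
      where
      to : ∀ {u} → A u → D u × ψ u ≡ 0
      to {u} p with A? u
      ... | yes _ = inj₁ p , refl
      ... | no ¬p = ⊥-elim (¬p p)
      from : ∀ {u} → D u × ψ u ≡ 0 → A u
      from {u} _ with A? u
      from {u} _ | yes p = p
      from {u} (_ , ()) | no _
    classes (suc i) = conn-cong to from (conn B i)
      where
      to : ∀ {u} → P u × index B u ≡ i → D u × ψ u ≡ suc i
      to {u} (p , e) with A? u
      ... | yes q = ⊥-elim (disjoint q p)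
      ... | no _ = inj₂ p , cong suc e
      from : ∀ {u} → D u × ψ u ≡ suc i → P u × index B u ≡ i
      from {u} _ with A? u
      from {u} (_ , ()) | yes _
      from {u} (inj₁ q , e) | no ¬q = ⊥-elim (¬q q)
      from {u} (inj₂ p , e) | no _ = p , ℕₚ.suc-injective e
  ... | ψ′ , keep , classes′ , origin = record
    { hub = λ u → ψ′ u ≡ 0
    ; hub? = λ u → ψ′ u ℕₚ.≟ 0
    ; hub-conn = classes′ 0
    ; rest = record
      { index = λ u → ψ′ u ∸ 1
      ; index≤ = λ {u} _ → bound u (origin u)
      ; conn = λ i → conn-cong (λ { e → subst (_≢ 0) (sym e) (λ ()) , cong (_∸ 1) e })
          (λ { {u} (ne , e) → pred≡ u ne e }) (classes′ (suc i))
      ; touch = λ i lt → touch-mono old old (touch B i lt)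
      ; inhabited = λ i le → let (u , p , e) = inhabited B i le in u , old (p , e)
      }
    ; A⊆hub = in-A
    ; P⊆rest = λ p → proj₁ (old (p , refl))
    ; same-index = λ p → proj₂ (old (p , refl))
    }
    where
    ψ : Fin n → ℕ
    ψ u = if does (A? u) then 0 else suc (index B u)
    in-A : ∀ {u} → A u → ψ′ u ≡ 0
    in-A {u} p with keep (inj₁ p)
    ... | e with A? u
    ...   | yes _ = e
    ...   | no ¬p = ⊥-elim (¬p p)
    in-P : ∀ {u} → P u → ψ′ u ≡ suc (index B u)
    in-P {u} p with keep (inj₂ p)
    ... | e with A? u
    ...   | yes q = ⊥-elim (disjoint q p)
    ...   | no _ = e
    old : ∀ {u i} → P u × index B u ≡ i → ψ′ u ≢ 0 × ψ′ u ∸ 1 ≡ i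
    old (p , refl) = subst (_≢ 0) (sym (in-P p)) (λ ()) , cong (_∸ 1) (in-P p)
    pred≡ : ∀ u {i} → ψ′ u ≢ 0 → ψ′ u ∸ 1 ≡ i → ψ′ u ≡ suc i
    pred≡ u ne e with ψ′ u
    ... | zero = ⊥-elim (ne refl)
    ... | suc j = cong suc e
    bound₀ : ∀ u → A u ⊎ P u → ψ′ u ∸ 1 ≤ l
    bound₀ u (inj₁ p) = subst (λ j → j ∸ 1 ≤ l) (sym (in-A p)) z≤n
    bound₀ u (inj₂ p) = subst (λ j → j ∸ 1 ≤ l) (sym (in-P p)) (index≤ B p)
    bound : ∀ u → (A u ⊎ P u) ⊎ _ → ψ′ u ∸ 1 ≤ l
    bound u (inj₁ d) = bound₀ u d
    bound u (inj₂ (w , d , _ , e)) = subst (λ j → j ∸ 1 ≤ l) (trans (keep d) (sym e)) (bound₀ w d)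

  -- Tags are kept apart from their locations because several chords may share an end. `star` and
  -- `heap` both stand for much branching at one vertex `c`, the first towards components of a set
  -- that avoids `c`, the second through many tags placed at `c`.
  data Branching {Tag : Set} (loc : Tag → Fin n) (H : Fin n → Set) (d l : ℕ) (tags : List Tag) (r : Fin n) : Set₁ where
    star : ∀ c (P : Fin n → Set) → (∀ u → Dec (P u)) → H c → (∀ {u} → P u → H u × u ≢ c) →
      (∀ {u} → P u → ∃[ w ] (E w c × Reach (In P) u w)) →
      ∀ ts → d ≤ length ts → All (_∈ tags) ts → All (P ∘ loc) ts →
      AllPairs (λ s t → ¬ Reach (In P) (loc s) (loc t)) ts → Branching loc H d l tags r
    heap : ∀ c → H c → ∀ ts → d ≤ length ts → All (_∈ tags) ts → Unique ts → All (λ t → loc t ≡ c) ts →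
      Branching loc H d l tags r
    row : (B : Bags H l) → index B r ≡ 0 →
      (∀ i → i ≤ l → ∃[ t ] (t ∈ tags × H (loc t) × index B (loc t) ≡ i)) → Branching loc H d l tags r

  -- Walks from pairwise separated tags reach `c` through pairwise distinct neighbours, so a star
  -- forces a large degree at its centre.
  starNeighbours : ∀ {Tag : Set} {loc : Tag → Fin n} {P : Fin n → Set} {c} → (∀ {u} → P u → u ≢ c) →
    (∀ {u} → P u → ∃[ w ] (E w c × Reach (In P) u w)) →
    ∀ {ts} → AllPairs (λ s t → ¬ Reach (In P) (loc s) (loc t)) ts → All (P ∘ loc) ts →
    Σ (List (Fin n)) λ ws → length ws ≡ length ts × Unique ws × All (λ w → E w c × w ≢ c) ws ×
      All (λ w → ∃[ t ] (t ∈ ts × Reach (In P) (loc t) w)) ws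
  starNeighbours off exit {[]} [] [] = [] , refl , [] , [] , []
  starNeighbours off exit {t ∷ ts} (t∉ ∷ apart) (pt ∷ ps) with starNeighbours off exit apart ps | exit pt
  ... | ws , len , uniq , adjacent , from | w , e , walk = w ∷ ws , cong suc len ,
        All.map (λ { (s , s∈ , walk′) refl → All.lookup t∉ s∈ (reach-trans walk (reach-sym in-sym walk′)) }) from ∷ uniq ,
        (e , off (reach-end pt walk)) ∷ adjacent ,
        (t , here refl , walk) ∷ All.map (λ (s , s∈ , walk′) → s , there s∈ , walk′) from

  module _ {Tag : Set} (loc : Tag → Fin n) (d : ℕ) where

    private
      -- The root is removed from `H`. Unless `d` tags get separated, one component `Y` keeps enough
      -- of them, and the search continues in `Y` from a neighbour `r′` of the root. The remainder
      -- `Z` is connected through the root and touches the first bag of the row found in `Y`, since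
      -- that bag contains `r′`.
      branchFrom : ∀ fuel (todo : List (Fin n)) → length todo ≤ fuel → ∀ {H : Fin n → Set} → (∀ u → Dec (H u)) →
        Conn H → ∀ r → H r → (∀ {u} → H u → u ∈ todo) → ∀ l tags → Unique tags → All (H ∘ loc) tags →
        tagNumber d l < length tags → Branching loc H d l tags r
      branchFrom zero [] len H? connH r r∈ covered l tags uniq inH many with covered r∈
      ... | ()
      branchFrom (suc fuel) todo len H? connH r r∈ covered zero (t ∷ tags) uniq (h ∷ inH) many =
        row (oneBag connH r∈) refl λ { zero z≤n → t , here refl , h , refl }
      branchFrom (suc fuel) todo len {H} H? connH r r∈ covered (suc l) tags uniq inH many
        with d ≤? length (filter (λ t → loc t ≟ r) tags)
      ... | yes big = heap r r∈ (filter at-r tags) big (All.tabulate (proj₁ ∘ ∈-filter⁻ at-r {xs = tags}))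
              (Uniqueₚ.filter⁺ at-r uniq) (All.tabulate (proj₂ ∘ ∈-filter⁻ at-r {xs = tags}))
        where
        at-r = λ t → loc t ≟ r
      ... | no ¬big = outcome (inequivalent⊎class (λ s t → reach? (in? P?) (loc s) (loc t)) d (tagNumber d l) off many′)
        where
        at-r = λ t → loc t ≟ r
        off = filter (¬? ∘ at-r) tags
        off∈ : ∀ {t} → t ∈ off → t ∈ tags × loc t ≢ r
        off∈ = ∈-filter⁻ (¬? ∘ at-r) {xs = tags}
        many′ : d * tagNumber d l < length off
        many′ = +-cancelˡ-< d _ _ (<-≤-trans many (subst (_≤ d + length off) (filter-split at-r tags)
          (+-monoˡ-≤ (length off) (<⇒≤ (≰⇒> ¬big)))))
        P : Fin n → Set
        P u = H u × u ≢ r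
        P? : Decidable P
        P? u = H? u ×-dec ¬? (u ≟ r)
        off-P : ∀ {t} → t ∈ off → P (loc t)
        off-P t∈ = All.lookup inH (proj₁ (off∈ t∈)) , proj₂ (off∈ t∈)
        exit : ∀ {u} → P u → ∃[ w ] (E w r × Reach (In P) u w)
        exit (h , ne) with firstHit (_≟ r) (connH h r∈) h refl ne
        ... | x , _ , walk , _ , _ , _ , refl , e = x , e , walk
        outcome : _ → Branching loc H d (suc l) tags r
        outcome (inj₁ (ts , len′ , ts∈ , apart)) = star r P P? r∈ id exit ts len′
          (All.map (proj₁ ∘ off∈) ts∈) (All.map off-P ts∈) apart
        outcome (inj₂ (t , t∈ , big)) with exit (off-P t∈)
        ... | r′ , e , r′∈ = continue (Any.any? (λ s → ¬? (Y? (loc s))) tags)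
          where
          Y Z : Fin n → Set
          Y u = Reach (In P) (loc t) u
          Y? : Decidable Y
          Y? u = reach? (in? P?) (loc t) u
          Y⊆P : ∀ {u} → Y u → P u
          Y⊆P = reach-end (off-P t∈)
          Z u = H u × ¬ Y u
          Z? : Decidable Z
          Z? u = H? u ×-dec ¬? (Y? u)
          r∈Z : Z r
          r∈Z = r∈ , λ y → proj₂ (Y⊆P y) refl
          avoid : ∀ {u x} → ¬ Y u → H u → Reach (In P) u x → Z x × Reach (In Z) u x
          avoid ¬y h here = (h , ¬y) , here
          avoid ¬y h (step (e , p , q) walk) with avoid (λ y → ¬y (reach-trans y (step (E-sym e , q , p) here))) (proj₁ q) walk
          ... | zx , walk′ = zx , step (e , (h , ¬y) , (proj₁ q , λ y → ¬y (reach-trans y (step (E-sym e , q , p) here)))) walk′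
          connZ : Conn Z
          connZ = conn-root r toRoot
            where
            toRoot : ∀ {u} → Z u → Reach (In Z) u r
            toRoot {u} (h , ¬y) with u ≟ r
            ... | yes refl = here
            ... | no ne with exit (h , ne)
            ...   | x , e′ , walk with avoid ¬y h walk
            ...     | zx , walk′ = reach-trans walk′ (step (e′ , zx , r∈Z) here)
          Z⊎Y⇒H : ∀ {u} → Z u ⊎ Y u → H u
          Z⊎Y⇒H (inj₁ z) = proj₁ z
          Z⊎Y⇒H (inj₂ y) = proj₁ (Y⊆P y)
          H⇒Z⊎Y : ∀ {u} → H u → Z u ⊎ Y u
          H⇒Z⊎Y {u} h with Y? u
          ... | yes y = inj₂ y
          ... | no ¬y = inj₁ (h , ¬y)
          disjoint : ∀ {u} → Z u → Y u → ⊥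
          disjoint z y = proj₂ z y
          rec : ∀ l tags → Unique tags → All (Y ∘ loc) tags → tagNumber d l < length tags → Branching loc Y d l tags r′
          rec = branchFrom fuel (remove r todo) (≤-pred (≤-trans (remove-shorter (covered r∈)) len)) Y?
            (conn-component (loc t)) r′ r′∈
            (λ y → ∈-filter⁺ (¬? ∘ (_≟ r)) (covered (proj₁ (Y⊆P y))) (proj₂ (Y⊆P y)))
          continue : Dec (Any (λ s → ¬ Y (loc s)) tags) → Branching loc H d (suc l) tags r
          -- All tags lie in `Y`, so `Z` would be a bag without a tag. It is absorbed by the first
          -- bag, no tag is spent, and the recursion is on the size of `H` alone.
          continue (no none) with rec (suc l) tags uniq (All.map (λ {s} ¬¬y → dne (Y? (loc s)) ¬¬y) (Allₚ.¬Any⇒All¬ tags none)) many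
            where
            dne : ∀ {A : Set} → Dec A → ¬ ¬ A → A
            dne (yes a) _ = a
            dne (no ¬a) f = ⊥-elim (f ¬a)
          ... | star c P′ P′? c∈ sub nbr ts len′ ts∈ ts-P apart =
            star c P′ P′? (proj₁ (Y⊆P c∈)) (λ p → proj₁ (Y⊆P (proj₁ (sub p))) , proj₂ (sub p)) nbr ts len′ ts∈ ts-P apart
          ... | heap c c∈ ts len′ ts∈ uniq′ at-c = heap c (proj₁ (Y⊆P c∈)) ts len′ ts∈ uniq′ at-c
          ... | row B r′≡0 tagged = row (bags-cong Z⊎Y⇒H H⇒Z⊎Y (absorb B Z? connZ disjoint 0 z≤n tZ))
                (absorb-new B Z? connZ disjoint 0 z≤n tZ r∈Z)
                λ i i≤ → let (s , s∈ , y , e′) = tagged i i≤ in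
                  s , s∈ , proj₁ (Y⊆P y) , trans (absorb-old B Z? connZ disjoint 0 z≤n tZ y) e′
            where
            tZ : Touch Z (Bag B 0)
            tZ = r , r′ , r∈Z , (r′∈ , r′≡0) , E-sym e
          -- Some tag lies in `Z`, so `Z` becomes a new first bag and a row shorter by one suffices
          -- in `Y`.
          continue (yes some) with rec l (filter near off) (Uniqueₚ.filter⁺ near (Uniqueₚ.filter⁺ (¬? ∘ at-r) uniq))
              (All.tabulate (proj₂ ∘ ∈-filter⁻ near {xs = off})) big
            where
            near = λ s → Y? (loc s)
          ... | star c P′ P′? c∈ sub nbr ts len′ ts∈ ts-P apart =
            star c P′ P′? (proj₁ (Y⊆P c∈)) (λ p → proj₁ (Y⊆P (proj₁ (sub p))) , proj₂ (sub p)) nbr ts len′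
              (All.map (proj₁ ∘ off∈ ∘ proj₁ ∘ ∈-filter⁻ (λ s → Y? (loc s)) {xs = off}) ts∈) ts-P apart
          ... | heap c c∈ ts len′ ts∈ uniq′ at-c = heap c (proj₁ (Y⊆P c∈)) ts len′
              (All.map (proj₁ ∘ off∈ ∘ proj₁ ∘ ∈-filter⁻ (λ s → Y? (loc s)) {xs = off}) ts∈) uniq′ at-c
          ... | row B r′≡0 tagged = row (bags-cong Z⊎Y⇒H H⇒Z⊎Y (prepend B Z? connZ disjoint tZ))
                (prepend-zero B Z? connZ disjoint tZ r∈Z) tagged′
            where
            tZ : Touch Z (Bag B 0)
            tZ = r , r′ , r∈Z , (r′∈ , r′≡0) , E-sym e
            tagged′ : ∀ i → i ≤ suc l → ∃[ s ] (s ∈ tags × H (loc s) × index (prepend B Z? connZ disjoint tZ) (loc s) ≡ i)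
            tagged′ zero _ = let (s , s∈ , ¬y) = find some ; h = All.lookup inH s∈ in
              s , s∈ , h , prepend-zero B Z? connZ disjoint tZ (h , ¬y)
            tagged′ (suc i) (s≤s i≤) = let (s , s∈ , y , e′) = tagged i i≤ in
              s , proj₁ (off∈ (proj₁ (∈-filter⁻ (λ s → Y? (loc s)) {xs = off} s∈))) , proj₁ (Y⊆P y)
                , trans (prepend-suc B Z? connZ disjoint tZ y) (cong suc e′)

    branch : ∀ {H : Fin n → Set} → (∀ u → Dec (H u)) → Conn H → ∀ r → H r → ∀ l tags → Unique tags → All (H ∘ loc) tags →
      tagNumber d l < length tags → Branching loc H d l tags r
    branch H? connH r r∈ = branchFrom n (allFin n) (≤-reflexive (length-tabulate id)) H? connH r r∈ (λ _ → ∈-allFin _)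

-- The four target graphs

≡ᵇ-refl : ∀ i → (i ≡ᵇ i) ≡ true
≡ᵇ-refl zero = refl
≡ᵇ-refl (suc i) = ≡ᵇ-refl i

≡ᵇ-comm : ∀ i j → (i ≡ᵇ j) ≡ (j ≡ᵇ i)
≡ᵇ-comm zero zero = refl
≡ᵇ-comm zero (suc j) = refl
≡ᵇ-comm (suc i) zero = refl
≡ᵇ-comm (suc i) (suc j) = ≡ᵇ-comm i j

≢⇒≡ᵇ : ∀ {i j} → i ≢ j → (i ≡ᵇ j) ≡ false
≢⇒≡ᵇ {i} {j} ne with i ≡ᵇ j in eq
... | false = refl
... | true = ⊥-elim (ne (≡ᵇ⇒≡ i j (subst T (sym eq) tt)))

<⇒<ᵇ≡true : ∀ {i j} → i < j → (i <ᵇ j) ≡ true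
<⇒<ᵇ≡true {i} {j} lt with i <ᵇ j in eq
... | true = refl
... | false = ⊥-elim (subst T eq (<⇒<ᵇ lt))

≤⇒<ᵇ≡false : ∀ {i j} → j ≤ i → (i <ᵇ j) ≡ false
≤⇒<ᵇ≡false {i} {j} le with i <ᵇ j in eq
... | false = refl
... | true = ⊥-elim (≤⇒≯ le (<ᵇ⇒< i j (subst T (sym eq) tt)))

joinAdj-irrefl : ∀ r h i → joinAdj r h i i ≡ false
joinAdj-irrefl r h i rewrite ≡ᵇ-refl i = refl

joinAdj-comm : ∀ r h → (∀ i j → h i j ≡ h j i) → ∀ i j → joinAdj r h i j ≡ joinAdj r h j i
joinAdj-comm r h h-comm i j rewrite ≡ᵇ-comm i j | ∨-comm (i <ᵇ r) (j <ᵇ r) | h-comm (i ∸ r) (j ∸ r) = refl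

joinAdj-hub : ∀ r h {i j} → i < j → i < r → joinAdj r h i j ≡ true
joinAdj-hub r h i<j i<r rewrite ≢⇒≡ᵇ (<⇒≢ i<j) | <⇒<ᵇ≡true i<r = refl

joinAdj-rest : ∀ r h i j → i < j → joinAdj r h (r + i) (r + j) ≡ h i j
joinAdj-rest r h i j i<j
  rewrite ≢⇒≡ᵇ (<⇒≢ (+-monoʳ-< r i<j)) | ≤⇒<ᵇ≡false (m≤m+n r i) | ≤⇒<ᵇ≡false (m≤m+n r j) | m+n∸m≡n r i | m+n∸m≡n r j = refl

pathAdj-comm : ∀ i j → pathAdj i j ≡ pathAdj j i
pathAdj-comm i j = ∨-comm (j ≡ᵇ suc i) (i ≡ᵇ suc j)

pathAdj-suc : ∀ i → T (pathAdj i (suc i))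
pathAdj-suc i rewrite ≡ᵇ-refl i = tt

pathAdj⇒suc : ∀ {i j} → i < j → T (pathAdj i j) → j ≡ suc i
pathAdj⇒suc {i} {j} lt t with j ≡ᵇ suc i in eq | i ≡ᵇ suc j in eq′
... | true | _ = ≡ᵇ⇒≡ j (suc i) (subst T (sym eq) tt)
... | false | true = ⊥-elim (<⇒≯ lt (subst (j <_) (sym (≡ᵇ⇒≡ i (suc j) (subst T (sym eq′) tt))) (n<1+n j)))

cycleAdj-comm : ∀ k i j → cycleAdj k i j ≡ cycleAdj k j i
cycleAdj-comm k i j rewrite pathAdj-comm i j = cong (pathAdj j i ∨_) (∨-comm ((i ≡ᵇ 0) ∧ (j ≡ᵇ k ∸ 1)) ((j ≡ᵇ 0) ∧ (i ≡ᵇ k ∸ 1)))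

cycleAdj-suc : ∀ k i → T (cycleAdj k i (suc i))
cycleAdj-suc k i rewrite ≡ᵇ-refl i = tt

cycleAdj-closing : ∀ k → T (cycleAdj (suc k) 0 k)
cycleAdj-closing k rewrite ≡ᵇ-refl k with pathAdj 0 k
... | true = tt
... | false = tt

cycleAdj-inv : ∀ k {i j} → i < j → T (cycleAdj (suc k) i j) → j ≡ suc i ⊎ (i ≡ 0 × j ≡ k)
cycleAdj-inv k {i} {j} lt t with pathAdj i j in eq
... | true = inj₁ (pathAdj⇒suc lt (subst T (sym eq) tt))
cycleAdj-inv k {zero} {suc j} lt t | false with suc j ≡ᵇ k in eq′
... | true = inj₂ (refl , ≡ᵇ⇒≡ (suc j) k (subst T (sym eq′) tt))
... | false = ⊥-elim t
cycleAdj-inv k {suc i} {suc j} lt () | false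

-- A value missing from the list gets the position `length ys`. Where only the first `k` entries are
-- chosen, this counts as not chosen.
position : List ℕ → ℕ → ℕ
position [] i = 0
position (y ∷ ys) i = if i ≡ᵇ y then 0 else suc (position ys i)

nth-position : ∀ ys {i} → position ys i < length ys → nth ys (position ys i) ≡ i
nth-position (y ∷ ys) {i} lt with i ≡ᵇ y in eq
... | true = sym (≡ᵇ⇒≡ i y (subst T (sym eq) tt))
... | false = nth-position ys (≤-pred lt)

position-nth : ∀ {ys} → Sorted ys → ∀ {j} → j < length ys → position ys (nth ys j) ≡ j
position-nth {y ∷ ys} _ {zero} lt rewrite ≡ᵇ-refl y = refl
position-nth {y ∷ ys} (a ∷ s) {suc j} (s≤s lt) rewrite ≢⇒≡ᵇ (>⇒≢ (nth-All a lt)) = cong suc (position-nth s lt)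

-- The hubs are not assumed to touch each other; the two additional pieces are there to make them
-- adjacent.
tripleNumber : ℕ → ℕ
tripleNumber k = ramseyNumber 2 (2 + k)

module Targets (G : Graph) (simple : IsSimple G) where

  E : Fin (order G) → Fin (order G) → Set
  E = Adj G

  E? : ∀ u v → Dec (E u v)
  E? u v = T? (adj G u v)

  E-sym : ∀ {u v} → E u v → E v u
  E-sym {u} {v} = subst T (proj₁ simple u v)

  open Graphs E E? E-sym public

  private
    V : Set
    V = Fin (order G)

  -- The contracted edges are those inside a class. As classes are connected, they are exactly the
  -- components of the contracted edge set; by symmetry, adjacencies need checking only for `i < j`.
  parallelMinor : ∀ m (f : ℕ → ℕ → Bool) → (∀ i j → f i j ≡ f j i) → (∀ i → f i i ≡ false) →
    (ψ : V → ℕ) → (∀ u → ψ u < m) → (∀ i → i < m → ∃[ u ] ψ u ≡ i) → (∀ i → Conn (λ u → ψ u ≡ i)) →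
    (∀ i j → i < j → j < m → T (f i j) → Touch (λ u → ψ u ≡ i) (λ u → ψ u ≡ j)) →
    (∀ i j → i < j → j < m → Touch (λ u → ψ u ≡ i) (λ u → ψ u ≡ j) → T (f i j)) →
    IsParallelMinor (record { order = m ; adj = onFin f }) G
  parallelMinor m f f-comm f-irrefl ψ ψ< inh connected touches adjacent =
    S , (λ u v s → proj₁ (Equivalence.to T-∧ s)) , φ , onto , fibres , λ a b → mk⇔ (to a b) (from a b)
    where
    S : V → V → Bool
    S u v = adj G u v ∧ ⌊ ψ u ℕₚ.≟ ψ v ⌋
    φ : V → Fin m
    φ u = fromℕ< (ψ< u)
    toℕ-φ : ∀ u → toℕ (φ u) ≡ ψ u
    toℕ-φ u = toℕ-fromℕ< (ψ< u)
    onto : ∀ a → ∃[ u ] φ u ≡ a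
    onto a with inh (toℕ a) (toℕ<n a)
    ... | u , e = u , toℕ-injective (trans (toℕ-φ u) e)
    S-ψ : ∀ {u v} → T (S u v) → ψ u ≡ ψ v
    S-ψ {u} {v} s = toWitness {a? = ψ u ℕₚ.≟ ψ v} (proj₂ (Equivalence.to (T-∧ {adj G u v}) s))
    reach-ψ : ∀ {u v} → Reach (λ a b → T (S a b) ⊎ T (S b a)) u v → ψ u ≡ ψ v
    reach-ψ here = refl
    reach-ψ (step (inj₁ s) r) = trans (S-ψ s) (reach-ψ r)
    reach-ψ (step (inj₂ s) r) = trans (sym (S-ψ s)) (reach-ψ r)
    fibres : ∀ u v → (φ u ≡ φ v) ⇔ Reach (λ a b → T (S a b) ⊎ T (S b a)) u v
    fibres u v = mk⇔
      (λ e → reach-map (λ {a} {b} (ab , p , q) → inj₁ (Equivalence.from T-∧ (ab , fromWitness (trans p (sym q)))))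
        (connected (ψ u) refl (trans (sym (toℕ-φ v)) (trans (cong toℕ (sym e)) (toℕ-φ u)))))
      (λ r → toℕ-injective (trans (toℕ-φ u) (trans (reach-ψ r) (sym (toℕ-φ v)))))
    f≢ : ∀ {i j} → T (f i j) → i ≢ j
    f≢ {i} t refl = subst T (f-irrefl i) t
    touch-φ : ∀ {a b} → Touch (λ u → ψ u ≡ toℕ a) (λ u → ψ u ≡ toℕ b) → ∃[ u ] ∃[ v ] (φ u ≡ a × φ v ≡ b × E u v)
    touch-φ (u , v , p , q , e) = u , v , toℕ-injective (trans (toℕ-φ u) p) , toℕ-injective (trans (toℕ-φ v) q) , e
    to : ∀ a b → T (f (toℕ a) (toℕ b)) → a ≢ b × ∃[ u ] ∃[ v ] (φ u ≡ a × φ v ≡ b × E u v)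
    to a b t with <-cmp (toℕ a) (toℕ b)
    ... | tri< lt _ _ = (λ e → f≢ t (cong toℕ e)) , touch-φ (touches _ _ lt (toℕ<n b) t)
    ... | tri≈ _ e _ = ⊥-elim (f≢ t e)
    ... | tri> _ _ gt = (λ e → f≢ t (cong toℕ e)) ,
          touch-φ (touch-sym (touches _ _ gt (toℕ<n a) (subst T (f-comm (toℕ a) (toℕ b)) t)))
    from : ∀ a b → a ≢ b × ∃[ u ] ∃[ v ] (φ u ≡ a × φ v ≡ b × E u v) → T (f (toℕ a) (toℕ b))
    from a b (ne , u , v , p , q , e) with <-cmp (toℕ a) (toℕ b)
    ... | tri< lt _ _ = adjacent _ _ lt (toℕ<n b) (u , v , trans (sym (toℕ-φ u)) (cong toℕ p) , trans (sym (toℕ-φ v)) (cong toℕ q) , e)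
    ... | tri≈ _ eq _ = ⊥-elim (ne (toℕ-injective eq))
    ... | tri> _ _ gt = subst T (f-comm (toℕ b) (toℕ a))
          (adjacent _ _ gt (toℕ<n a) (v , u , trans (sym (toℕ-φ v)) (cong toℕ q) , trans (sym (toℕ-φ u)) (cong toℕ p) , E-sym e))

  Outcome : ℕ → Set
  Outcome k = IsParallelMinor (K3kPrime k) G ⊎ IsParallelMinor (Wheel k) G ⊎
    IsParallelMinor (DoubleFan k) G ⊎ IsParallelMinor (Kcomplete k) G

  completeMinor : ∀ k (ψ : V → ℕ) → (∀ u → ψ u < k) → (∀ i → i < k → ∃[ u ] ψ u ≡ i) → (∀ i → Conn (λ u → ψ u ≡ i)) →
    (∀ i j → i < j → j < k → Touch (λ u → ψ u ≡ i) (λ u → ψ u ≡ j)) → Outcome k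
  completeMinor k ψ ψ< inh connected touches = inj₂ (inj₂ (inj₂ (parallelMinor k _
    (λ i j → cong not (≡ᵇ-comm i j)) (λ i → cong not (≡ᵇ-refl i)) ψ ψ< inh connected
    (λ i j lt j< _ → touches i j lt j<)
    λ i j lt _ _ → subst (T ∘ not) (sym (≢⇒≡ᵇ (<⇒≢ lt))) tt)))

  hop : ∀ {P Q R : V → Set} → Conn P → Conn Q → Touch P Q → (∀ {u} → P u → R u) → (∀ {u} → Q u → R u) →
    ∀ {u v} → P u → Q v → Reach (In R) u v
  hop cP cQ t f g p q = in-mono [ f , g ]′ (conn-∪ cP cQ t (inj₁ p) (inj₂ q))

  module _ (k N : ℕ) (large : tripleNumber k ≤ N) (ψ : V → ℕ) (ψ< : ∀ u → ψ u < 3 + N)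
    (inh : ∀ i → i < 3 + N → ∃[ u ] ψ u ≡ i) (connected : ∀ i → Conn (λ u → ψ u ≡ i))
    (hubs : ∀ h i → h < 3 → i < N → Touch (λ u → ψ u ≡ h) (λ u → ψ u ≡ 3 + i)) where

    private
      piecesTouch? : ∀ i j → Dec (Touch (λ u → ψ u ≡ 3 + i) (λ u → ψ u ≡ 3 + j))
      piecesTouch? i j = touch? (λ u → ψ u ℕₚ.≟ 3 + i) (λ u → ψ u ℕₚ.≟ 3 + j)

      colour : List ℕ → Bool
      colour (i ∷ j ∷ []) = ⌊ piecesTouch? i j ⌋
      colour _ = false

      module _ {ys : List ℕ} (sorted : Sorted ys) (bounded : All (_< N) ys) (long : 2 + k ≤ length ys) where

        short : ∀ {j} → j < k → j < length ys
        short j< = <-≤-trans j< (≤-trans (m≤n+m k 2) long)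

        piece : ℕ → V → Set
        piece j u = ψ u ≡ 3 + nth ys j

        hub-piece : ∀ h {j} → h < 3 → j < length ys → Touch (λ u → ψ u ≡ h) (piece j)
        hub-piece h h< j< = hubs h _ h< (nth-All bounded j<)

        -- Everything except the chosen pieces is merged into piece 0. The result is connected: all
        -- hubs touch piece 0, and every unchosen piece touches hub 0.
        clique : 0 < k → (∀ i j → i < j → j < k → Touch (piece i) (piece j)) → Outcome k
        clique 0<k all = completeMinor k χ χ< χ-inh χ-conn
          λ i j i<j j< → touch-mono (from-piece (<-trans i<j j<)) (from-piece j<) (all i j i<j j<)
          where
          relabel : ℕ → ℕ
          relabel (suc (suc (suc i))) = if position ys i <ᵇ k then position ys i else 0
          relabel _ = 0
          χ : V → ℕ
          χ u = relabel (ψ u)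
          relabel< : ∀ i → relabel i < k
          relabel< zero = 0<k
          relabel< (suc zero) = 0<k
          relabel< (suc (suc zero)) = 0<k
          relabel< (suc (suc (suc i))) with position ys i <ᵇ k in eq
          ... | true = <ᵇ⇒< _ k (subst T (sym eq) tt)
          ... | false = 0<k
          χ< : ∀ u → χ u < k
          χ< u = relabel< (ψ u)
          relabel-nth : ∀ {j} → j < k → relabel (3 + nth ys j) ≡ j
          relabel-nth j< rewrite position-nth sorted (short j<) | <⇒<ᵇ≡true j< = refl
          from-piece : ∀ {j} → j < k → ∀ {u} → piece j u → χ u ≡ j
          from-piece j< e = trans (cong relabel e) (relabel-nth j<)
          relabel-inv : ∀ i {j} → relabel i ≡ suc j → i ≡ 3 + nth ys (suc j)
          relabel-inv (suc (suc (suc i))) e with position ys i <ᵇ k in eq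
          ... | true = cong (3 +_) (trans (sym (nth-position ys (short (<ᵇ⇒< _ k (subst T (sym eq) tt))))) (cong (nth ys) e))
          relabel-inv (suc (suc (suc i))) () | false
          χ-inh : ∀ i → i < k → ∃[ u ] χ u ≡ i
          χ-inh i i< = let (u , e) = inh (3 + nth ys i) (+-monoʳ-< 3 (nth-All bounded (short i<))) in u , from-piece i< e
          root : ∃[ u ] ψ u ≡ 0
          root = inh 0 (s≤s z≤n)
          toRoot : ∀ i {u} → ψ u ≡ i → relabel i ≡ 0 → Reach (In (λ v → χ v ≡ 0)) u (proj₁ root)
          viaPiece : ∀ h → h < 3 → relabel h ≡ 0 → ∀ {u} → ψ u ≡ h → Reach (In (λ v → χ v ≡ 0)) u (proj₁ root)
          viaPiece h h< e p = let (w , q) = inh (3 + nth ys 0) (+-monoʳ-< 3 (nth-All bounded (short 0<k))) in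
            reach-trans
              (hop (connected h) (connected _) (hub-piece h h< (short 0<k)) (λ { refl → e }) (from-piece 0<k) p q)
              (hop (connected _) (connected 0) (touch-sym (hub-piece 0 (s≤s z≤n) (short 0<k))) (from-piece 0<k)
                (λ z → cong relabel z) q (proj₂ root))
          toRoot zero p _ = in-mono (cong relabel) (connected 0 p (proj₂ root))
          toRoot (suc zero) p e = viaPiece 1 (s≤s (s≤s z≤n)) refl p
          toRoot (suc (suc zero)) p e = viaPiece 2 (s≤s (s≤s (s≤s z≤n))) refl p
          toRoot (suc (suc (suc i))) {u} p e = hop (connected _) (connected 0)
            (touch-sym (hubs 0 i (s≤s z≤n) (+-cancelˡ-< 3 i N (subst (_< 3 + N) p (ψ< u)))))
            (λ q → trans (cong relabel q) e) (cong relabel) p (proj₂ root)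
          χ-conn : ∀ i → Conn (λ u → χ u ≡ i)
          χ-conn zero = conn-root (proj₁ root) λ {u} e → toRoot (ψ u) refl e
          χ-conn (suc j) {u} {v} e e′ = in-mono
            (λ {w} q → trans (cong relabel q) (trans (cong relabel (sym (relabel-inv (ψ u) e))) e))
            (connected _ (relabel-inv (ψ u) e) (relabel-inv (ψ v) e′))

        independent : (∀ i j → i < j → j < k → ¬ Touch (piece i) (piece j)) → Outcome k
        independent none = inj₁ (parallelMinor (3 + k) (joinAdj 3 (λ _ _ → false)) (joinAdj-comm 3 _ (λ _ _ → refl))
          (joinAdj-irrefl 3 (λ _ _ → false)) χ (λ u → relabel< (ψ u)) χ-inh χ-conn touches adjacent)
          where
          -- Two spare pieces are merged into the hubs 1 and 2 to make the hubs mutually adjacent.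
          spare : ℕ → ℕ
          spare zero = 1
          spare (suc zero) = 2
          -- All further unchosen pieces, including those missing from `ys`, go to hub 0, which they
          -- touch.
          spare _ = 0
          place : ℕ → ℕ
          place j = if j <ᵇ k then 3 + j else spare (j ∸ k)
          relabel : ℕ → ℕ
          relabel (suc (suc (suc i))) = place (position ys i)
          relabel i = i
          χ : V → ℕ
          χ u = relabel (ψ u)
          spare<3 : ∀ i → spare i < 3
          spare<3 zero = s≤s (s≤s z≤n)
          spare<3 (suc zero) = s≤s (s≤s (s≤s z≤n))
          spare<3 (suc (suc i)) = s≤s z≤n
          relabel< : ∀ i → relabel i < 3 + k
          relabel< zero = s≤s z≤n
          relabel< (suc zero) = s≤s (s≤s z≤n)
          relabel< (suc (suc zero)) = s≤s (s≤s (s≤s z≤n))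
          relabel< (suc (suc (suc i))) with position ys i <ᵇ k in eq
          ... | true = +-monoʳ-< 3 (<ᵇ⇒< _ k (subst T (sym eq) tt))
          ... | false = <-≤-trans (spare<3 _) (m≤m+n 3 k)
          place-piece : ∀ {j} → j < k → place j ≡ 3 + j
          place-piece j< rewrite <⇒<ᵇ≡true j< = refl
          place-spare : ∀ i → place (k + i) ≡ spare i
          place-spare i rewrite ≤⇒<ᵇ≡false (m≤m+n k i) | m+n∸m≡n k i = refl
          from-piece : ∀ {j} → j < length ys → ∀ {u} → piece j u → χ u ≡ place j
          from-piece j< e = trans (cong relabel e) (cong place (position-nth sorted j<))
          relabel-inv : ∀ i {j} → relabel i ≡ 3 + j → i ≡ 3 + nth ys j
          relabel-inv (suc (suc (suc i))) e with position ys i <ᵇ k in eq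
          ... | true = cong (3 +_) (trans (sym (nth-position ys (short (<ᵇ⇒< _ k (subst T (sym eq) tt)))))
                 (cong (nth ys) (+-cancelˡ-≡ 3 _ _ e)))
          ... | false = ⊥-elim (<⇒≱ (spare<3 (position ys i ∸ k)) (≤-trans (m≤m+n 3 _) (≤-reflexive (sym e))))
          χ-inh : ∀ i → i < 3 + k → ∃[ u ] χ u ≡ i
          χ-inh zero _ = let (u , e) = inh 0 (s≤s z≤n) in u , cong relabel e
          χ-inh (suc zero) _ = let (u , e) = inh 1 (s≤s (s≤s z≤n)) in u , cong relabel e
          χ-inh (suc (suc zero)) _ = let (u , e) = inh 2 (s≤s (s≤s (s≤s z≤n))) in u , cong relabel e
          χ-inh (suc (suc (suc i))) (s≤s (s≤s (s≤s i<))) =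
            let (u , e) = inh (3 + nth ys i) (+-monoʳ-< 3 (nth-All bounded (short i<))) in
            u , trans (from-piece (short i<) e) (place-piece i<)
          hubClass : ∀ h → h < 3 → relabel h ≡ h → Conn (λ u → χ u ≡ h)
          hubClass h h< fix = conn-root (proj₁ r) λ {u} e → go (ψ u) refl e
            where
            r = inh h (≤-trans h< (m≤m+n 3 N))
            centre : ∀ {u} → ψ u ≡ h → Reach (In (λ v → χ v ≡ h)) u (proj₁ r)
            centre p = in-mono (λ q → trans (cong relabel q) fix) (connected h p (proj₂ r))
            go : ∀ i {u} → ψ u ≡ i → relabel i ≡ h → Reach (In (λ v → χ v ≡ h)) u (proj₁ r)
            go zero p refl = centre p
            go (suc zero) p refl = centre p
            go (suc (suc zero)) p refl = centre p
            go (suc (suc (suc i))) {u} p e = hop (connected _) (connected h)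
              (touch-sym (hubs h i h< (+-cancelˡ-< 3 i N (subst (_< 3 + N) p (ψ< u)))))
              (λ q → trans (cong relabel q) e) (λ q → trans (cong relabel q) fix) p (proj₂ r)
          χ-conn : ∀ i → Conn (λ u → χ u ≡ i)
          χ-conn (suc (suc (suc j))) {u} {v} e e′ = in-mono
            (λ {w} q → trans (cong relabel q) (trans (cong relabel (sym (relabel-inv (ψ u) e))) e))
            (connected _ (relabel-inv (ψ u) e) (relabel-inv (ψ v) e′))
          χ-conn zero = hubClass 0 (s≤s z≤n) refl
          χ-conn (suc zero) = hubClass 1 (s≤s (s≤s z≤n)) refl
          χ-conn (suc (suc zero)) = hubClass 2 (s≤s (s≤s (s≤s z≤n))) refl
          spare< : ∀ i → i < 2 → k + i < length ys
          spare< i i< = <-≤-trans (+-monoʳ-< k i<) (subst (_≤ length ys) (+-comm 2 k) long)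
          touchSpare : ∀ h i → h < 3 → relabel h ≡ h → i < 2 → spare i ≡ suc i → Touch (λ u → χ u ≡ h) (λ u → χ u ≡ suc i)
          touchSpare h i h< fix i< e = touch-mono (λ q → trans (cong relabel q) fix)
            (λ q → trans (from-piece (spare< i i<) q) (trans (place-spare i) e)) (hub-piece h h< (spare< i i<))
          touchPiece : ∀ h j → h < 3 → relabel h ≡ h → j < k → Touch (λ u → χ u ≡ h) (λ u → χ u ≡ 3 + j)
          touchPiece h j h< fix j< = touch-mono (λ q → trans (cong relabel q) fix)
            (λ q → trans (from-piece (short j<) q) (place-piece j<)) (hub-piece h h< (short j<))
          touches : ∀ i j → i < j → j < 3 + k → T (joinAdj 3 (λ _ _ → false) i j) → Touch (λ u → χ u ≡ i) (λ u → χ u ≡ j)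
          touches zero (suc zero) _ _ _ = touchSpare 0 0 (s≤s z≤n) refl (s≤s z≤n) refl
          touches zero (suc (suc zero)) _ _ _ = touchSpare 0 1 (s≤s z≤n) refl (s≤s (s≤s z≤n)) refl
          touches (suc zero) (suc (suc zero)) _ _ _ = touchSpare 1 1 (s≤s (s≤s z≤n)) refl (s≤s (s≤s z≤n)) refl
          touches zero (suc (suc (suc j))) _ (s≤s (s≤s (s≤s j<))) _ = touchPiece 0 j (s≤s z≤n) refl j<
          touches (suc zero) (suc (suc (suc j))) _ (s≤s (s≤s (s≤s j<))) _ = touchPiece 1 j (s≤s (s≤s z≤n)) refl j<
          touches (suc (suc zero)) (suc (suc (suc j))) _ (s≤s (s≤s (s≤s j<))) _ =
            touchPiece 2 j (s≤s (s≤s (s≤s z≤n))) refl j<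
          touches (suc (suc (suc i))) (suc (suc (suc j))) (s≤s (s≤s (s≤s i<j))) _ t =
            ⊥-elim (subst T (joinAdj-rest 3 (λ _ _ → false) i j i<j) t)
          touches (suc zero) (suc zero) (s≤s ()) _ _
          touches (suc (suc i)) (suc zero) (s≤s ()) _ _
          touches (suc (suc zero)) (suc (suc zero)) (s≤s (s≤s ())) _ _
          touches (suc (suc (suc i))) (suc (suc zero)) (s≤s (s≤s ())) _ _
          adjacent : ∀ i j → i < j → j < 3 + k → Touch (λ u → χ u ≡ i) (λ u → χ u ≡ j) → T (joinAdj 3 (λ _ _ → false) i j)
          adjacent zero j lt _ _ = subst T (sym (joinAdj-hub 3 (λ _ _ → false) lt (s≤s z≤n))) tt
          adjacent (suc zero) j lt _ _ = subst T (sym (joinAdj-hub 3 (λ _ _ → false) lt (s≤s (s≤s z≤n)))) tt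
          adjacent (suc (suc zero)) j lt _ _ = subst T (sym (joinAdj-hub 3 (λ _ _ → false) lt (s≤s (s≤s (s≤s z≤n))))) tt
          adjacent (suc (suc (suc i))) (suc (suc (suc j))) (s≤s (s≤s (s≤s i<j))) (s≤s (s≤s (s≤s j<))) t = ⊥-elim
            (none i j i<j j< (touch-mono (λ {u} → relabel-inv (ψ u)) (λ {u} → relabel-inv (ψ u)) t))
          adjacent (suc (suc (suc i))) (suc (suc zero)) (s≤s (s≤s ())) _ _
          adjacent (suc (suc (suc i))) (suc zero) (s≤s ()) _ _

    tripleHub : 0 < k → Outcome k
    tripleHub 0<k with ramsey 2 (2 + k) colour (upTo N) (subst (tripleNumber k ≤_) (sym (length-upTo N)) large)
    ... | ys , s , long , b , h = finish b h
      where
      sorted : Sorted ys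
      sorted = allPairs-⊆ s (sorted-upTo N)
      bounded : All (_< N) ys
      bounded = All-resp-⊆ s (All.tabulate ∈-upTo⁻)
      pair : ∀ {i j} → i < j → j < k → nth ys i ∷ nth ys j ∷ [] ⊆ ys
      pair {i} i<j j< = nth₂-⊆ {i} ys i<j (short sorted bounded long j<)
      finish : ∀ b → Homogeneous 2 colour ys b → Outcome k
      finish true h = clique sorted bounded long 0<k λ i j i<j j< →
        ⌊⌋-true (piecesTouch? _ _) (h _ (pair i<j j<) refl)
      finish false h = independent sorted bounded long λ i j i<j j< →
        ⌊⌋-false (piecesTouch? _ _) (h _ (pair i<j j<) refl)

-- Ramsey outcomes for rows

module Rows {n : ℕ} (E : Fin n → Fin n → Set) (E? : ∀ u v → Dec (E u v)) (E-sym : ∀ {u v} → E u v → E v u) where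
  open Graphs E E? E-sym

  module _ {P : Fin n → Set} {l m : ℕ} (B : Bags P l) {b : ℕ → ℕ} (C : Cuts b m l) where

    coarse-bag : ∀ {i x u} → i ≤ m → b i ≤ x → x < b (suc i) → Bag B x u → Bag (coarsen B C) i u
    coarse-bag i≤ lo hi (p , refl) = p , coarsen-index B C i≤ lo hi

    coarse-bounds : ∀ {i u} → Bag (coarsen B C) i u → b i ≤ index B u × index B u < b (suc i)
    coarse-bounds {u = u} (p , refl) = locate-lower {b} (begins C) m (index B u) ,
      locate-upper b m (index B u) (subst (index B u <_) (sym (ends C)) (s≤s (index≤ B p)))

    cutTouch⇒touch : ∀ {i j} → i ≤ m → j ≤ m → CutTouch (λ x y → Touch (Bag B x) (Bag B y)) b i j →
      Touch (Bag (coarsen B C) i) (Bag (coarsen B C) j)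
    cutTouch⇒touch i≤ j≤ (x , x< , y , y< , bx , by , t) = touch-mono (coarse-bag i≤ bx x<) (coarse-bag j≤ by y<) t

    touch⇒cutTouch : ∀ {i j} → Touch (Bag (coarsen B C) i) (Bag (coarsen B C) j) →
      CutTouch (λ x y → Touch (Bag B x) (Bag B y)) b i j
    touch⇒cutTouch (u , v , p , q , e) = let (lo , hi) = coarse-bounds p ; (lo′ , hi′) = coarse-bounds q in
      _ , hi , _ , hi′ , lo , lo′ , (u , v , (proj₁ p , refl) , (proj₁ q , refl) , e)

  -- What persists through merging and reversing: hubs that touch every bag (by `contains`) and the
  -- closing of a row to a cycle. Stated this way, the direction of the row can be forgotten.
  record Coarser {P : Fin n → Set} {l m : ℕ} (B : Bags P l) (B′ : Bags P m) : Set where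
    field
      contains : ∀ i → i ≤ m → ∃[ x ] (x ≤ l × ∀ {u} → Bag B x u → Bag B′ i u)
      closing : Touch (Bag B l) (Bag B 0) → Touch (Bag B′ m) (Bag B′ 0)
  open Coarser public

  coarse-hub : ∀ {A P l m} {B : Bags P l} {B′ : Bags P m} → Coarser B B′ → (∀ i → i ≤ l → Touch A (Bag B i)) →
    ∀ i → i ≤ m → Touch A (Bag B′ i)
  coarse-hub C t i i≤ = let (x , x≤ , f) = contains C i i≤ in touch-mono id f (t x x≤)

  coarsen-coarser : ∀ {P l m b} (B : Bags P l) (C : Cuts b m l) → Coarser B (coarsen B C)
  coarsen-coarser {l = l} {m} {b} B C = record
    { contains = λ i i≤ → b i , ≤-pred (subst (b i <_) (ends C) (<-≤-trans (increasing C i i≤) (cuts-mono C (s≤s i≤) ≤-refl))) ,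
        coarse-bag B C i≤ ≤-refl (increasing C i i≤)
    ; closing = touch-mono (coarse-bag B C ≤-refl (≤-pred (subst (b m <_) (ends C) (increasing C m ≤-refl))) (≤-reflexive (sym (ends C))))
        (coarse-bag B C z≤n (≤-reflexive (begins C)) (subst (_< b 1) (begins C) (increasing C 0 z≤n)))
    }

  reverse-bag : ∀ {P l} (B : Bags P l) {i} → i ≤ l → ∀ {u} → Bag B i u → Bag (reverse B) (l ∸ i) u
  reverse-bag {l = l} B i≤ (p , e) = p , cong (l ∸_) e

  reverse-bag′ : ∀ {P l} (B : Bags P l) {i} → i ≤ l → ∀ {u} → Bag B (l ∸ i) u → Bag (reverse B) i u
  reverse-bag′ {l = l} B i≤ (p , e) = p , trans (cong (l ∸_) e) (m∸[m∸n]≡n i≤)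

  reverse-coarser : ∀ {P l m} {B : Bags P l} (B′ : Bags P m) → Coarser B B′ → Coarser B (reverse B′)
  reverse-coarser {m = m} B′ C = record
    { contains = λ i i≤ → let (x , x≤ , f) = contains C (m ∸ i) (m∸n≤m m i) in x , x≤ , reverse-bag′ B′ i≤ ∘ f
    ; closing = λ t → touch-sym (touch-mono (λ (p , e) → p , trans (cong (m ∸_) e) (n∸n≡0 m)) (λ (p , e) → p , cong (m ∸_) e) (closing C t))
    }

  data RowOutcome {P : Fin n → Set} {l : ℕ} (B : Bags P l) (mK mH mN : ℕ) : Set where
    complete : (B′ : Bags P mK) → Coarser B B′ → (∀ i j → i < j → j ≤ mK → Touch (Bag B′ i) (Bag B′ j)) →
      RowOutcome B mK mH mN
    hubbed : (B′ : Bags P mH) → Coarser B B′ → (∀ j → 1 ≤ j → j ≤ mH → Touch (Bag B′ 0) (Bag B′ j)) →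
      RowOutcome B mK mH mN
    cyclic : (B′ : Bags P mN) → Coarser B B′ →
      (∀ i j → suc (suc i) ≤ j → j ≤ mN → Touch (Bag B′ i) (Bag B′ j) → i ≡ 0 × j ≡ mN) → RowOutcome B mK mH mN

  nearOrFar : ∀ {P l} (B : Bags P l) {i j} → i < j → j ≤ l → (suc (suc i) ≤ j → Touch (Bag B i) (Bag B j)) →
    Touch (Bag B i) (Bag B j)
  nearOrFar B {i} lt j≤ far with m≤n⇒m<n∨m≡n lt
  ... | inj₁ lt′ = far lt′
  ... | inj₂ refl = touch B i j≤

  rowRamsey : ∀ {P l} → (∀ u → Dec (P u)) → (B : Bags P l) → ∀ mK mH mN → cutNumber mK mH mN ≤ suc l → RowOutcome B mK mH mN
  rowRamsey {P} {l} P? B mK mH mN le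
    with cutRamsey {λ x y → Touch (Bag B x) (Bag B y)} (λ x y → touch? (bag? B P? x) (bag? B P? y)) l mK mH mN le
  ... | complete b C t = complete (coarsen B C) (coarsen-coarser B C) λ i j lt j≤ →
        nearOrFar (coarsen B C) lt j≤ λ far → cutTouch⇒touch B C (≤-trans (<⇒≤ lt) j≤) j≤ (t i j far j≤)
  ... | firstHub b C t = hubbed (coarsen B C) (coarsen-coarser B C) λ j lt j≤ →
        nearOrFar (coarsen B C) lt j≤ λ far → cutTouch⇒touch B C z≤n j≤ (t j far j≤)
  ... | lastHub b C t = hubbed (reverse (coarsen B C)) (reverse-coarser (coarsen B C) (coarsen-coarser B C)) λ j lt j≤ →
        touch-sym (touch-mono (reverse-bag′ (coarsen B C) j≤) (reverse-bag′ (coarsen B C) z≤n)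
          (nearOrFar (coarsen B C) {mH ∸ j} (∸-monoʳ-< {o = 0} lt j≤) ≤-refl λ far →
            cutTouch⇒touch B C (m∸n≤m mH j) ≤-refl (t (mH ∸ j) far)))
  ... | cyclic b C f = cyclic (coarsen B C) (coarsen-coarser B C) λ i j far j≤ t → f i j far j≤ (touch⇒cutTouch B C t)

-- Rows below one, two or three hubs

fanNumber wheelNumber : ℕ → ℕ
-- The lengths give `k + 1` bags of a complete graph, a third hub followed by `tripleNumber (suc k)`
-- pieces, or `k + 3` cyclic bags, whose two end bags go to a hub and leave a path of `k + 1`.
fanNumber k = cutNumber k (tripleNumber (suc k)) (suc (suc k))
-- In the hub outcome bag 0 becomes the second hub and is split off; the cyclic outcome has the
-- `k + 1` bags of the rim.
wheelNumber k = cutNumber k (suc (fanNumber k)) k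

-- Below, k + 1 is the size of the target graphs.
module Wheels (G : Graph) (simple : IsSimple G) where
  open Targets G simple
  open Rows E E? E-sym

  private
    V : Set
    V = Fin (order G)

  completeRow : ∀ {k} {P : V → Set} (B : Bags P k) → (∀ u → P u) →
    (∀ i j → i < j → j ≤ k → Touch (Bag B i) (Bag B j)) → Outcome (suc k)
  completeRow B all t = completeMinor _ (index B) (λ u → s≤s (index≤ B (all u)))
    (λ i i< → let (u , _ , e) = inhabited B i (≤-pred i<) in u , e)
    (λ i → conn-cong proj₂ (λ e → all _ , e) (conn B i))
    λ i j lt j< → touch-mono proj₂ proj₂ (t i j lt (≤-pred j<))

  completeHub : ∀ {k} {A P : V → Set} (A? : Decidable A) → Conn A → (∀ u → A u ⊎ P u) → (∀ {u} → A u → P u → ⊥) →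
    (B : Bags P k) → Touch A (Bag B 0) → (∀ i j → i < j → j ≤ k → Touch (Bag B i) (Bag B j)) → Outcome (suc k)
  completeHub {k} {A} {P} A? connA cover A-P B tA t = completeRow full cover λ i j lt j≤ → touch-mono keep keep (t i j lt j≤)
    where
    full : Bags (λ u → A u ⊎ P u) k
    full = absorb B A? connA A-P 0 z≤n tA
    keep : ∀ {i u} → Bag B i u → Bag full i u
    keep (p , e) = inj₂ p , trans (absorb-old B A? connA A-P 0 z≤n tA p) e

  module TwoHubs {A C P : V → Set} (A? : ∀ u → Dec (A u)) (C? : ∀ u → Dec (C u))
    (connA : Conn A) (connC : Conn C) (AC : Touch A C) (cover : ∀ u → A u ⊎ C u ⊎ P u)
    (A-C : ∀ {u} → A u → C u → ⊥) (A-P : ∀ {u} → A u → P u → ⊥) (C-P : ∀ {u} → C u → P u → ⊥) where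

    A-CP : ∀ {u} → A u → C u ⊎ P u → ⊥
    A-CP a = [ A-C a , A-P a ]′

    module Fan {l : ℕ} (B : Bags P l) (tA : ∀ i → i ≤ l → Touch A (Bag B i)) (tC : ∀ i → i ≤ l → Touch C (Bag B i)) where

      withC : Bags (λ u → C u ⊎ P u) (suc l)
      withC = prepend B C? connC C-P (tC 0 z≤n)

      AC′ : Touch A (Bag withC 0)
      AC′ = touch-mono id (λ c → inj₁ c , prepend-zero B C? connC C-P (tC 0 z≤n) c) AC

      fan : Bags (λ u → A u ⊎ C u ⊎ P u) (suc (suc l))
      fan = prepend withC A? connA A-CP AC′

      ψ : V → ℕ
      ψ = index fan

      ψ-A : ∀ {u} → A u → ψ u ≡ 0
      ψ-A = prepend-zero withC A? connA A-CP AC′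

      ψ-C : ∀ {u} → C u → ψ u ≡ 1
      ψ-C c = trans (prepend-suc withC A? connA A-CP AC′ (inj₁ c)) (cong suc (prepend-zero B C? connC C-P (tC 0 z≤n) c))

      ψ-P : ∀ {i u} → Bag B i u → ψ u ≡ suc (suc i)
      ψ-P (p , e) = trans (prepend-suc withC A? connA A-CP AC′ (inj₂ p))
        (cong suc (trans (prepend-suc B C? connC C-P (tC 0 z≤n) p) (cong suc e)))

      ψ⇒P : ∀ {i u} → ψ u ≡ suc (suc i) → Bag B i u
      ψ⇒P {u = u} e with cover u
      ... | inj₁ a = case trans (sym (ψ-A a)) e of λ ()
      ... | inj₂ (inj₁ c) = case trans (sym (ψ-C c)) e of λ ()
      ... | inj₂ (inj₂ p) = p , ℕₚ.suc-injective (ℕₚ.suc-injective (trans (sym (ψ-P (p , refl))) e))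

      ψ< : ∀ u → ψ u < 3 + l
      ψ< u = s≤s (index≤ fan (cover u))

      ψ-inh : ∀ i → i < 3 + l → ∃[ u ] ψ u ≡ i
      ψ-inh i i< = let (u , _ , e) = inhabited fan i (≤-pred i<) in u , e

      ψ-conn : ∀ i → Conn (λ u → ψ u ≡ i)
      ψ-conn i = conn-cong proj₂ (λ e → cover _ , e) (conn fan i)

      doubleFan : (∀ i j → suc (suc i) ≤ j → j ≤ l → ¬ Touch (Bag B i) (Bag B j)) → Outcome (suc l)
      doubleFan apart = inj₂ (inj₂ (inj₁ (parallelMinor (3 + l) (joinAdj 2 pathAdj) (joinAdj-comm 2 _ pathAdj-comm)
        (joinAdj-irrefl 2 pathAdj) ψ ψ< ψ-inh ψ-conn touches adjacent)))
        where
        touches : ∀ i j → i < j → j < 3 + l → T (joinAdj 2 pathAdj i j) → Touch (λ u → ψ u ≡ i) (λ u → ψ u ≡ j)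
        touches zero (suc zero) _ _ _ = touch-mono ψ-A ψ-C AC
        touches zero (suc (suc j)) _ j< _ = touch-mono ψ-A ψ-P (tA j (≤-pred (≤-pred (≤-pred j<))))
        touches (suc zero) (suc (suc j)) _ j< _ = touch-mono ψ-C ψ-P (tC j (≤-pred (≤-pred (≤-pred j<))))
        touches (suc (suc i)) (suc (suc j)) (s≤s (s≤s i<j)) j< t
          with pathAdj⇒suc i<j (subst T (joinAdj-rest 2 pathAdj i j i<j) t)
        ... | refl = touch-mono ψ-P ψ-P (touch B i (≤-pred (≤-pred (≤-pred j<))))
        touches (suc zero) (suc zero) (s≤s ()) _ _
        touches (suc (suc i)) (suc zero) (s≤s ()) _ _
        adjacent : ∀ i j → i < j → j < 3 + l → Touch (λ u → ψ u ≡ i) (λ u → ψ u ≡ j) → T (joinAdj 2 pathAdj i j)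
        adjacent zero j lt _ _ = subst T (sym (joinAdj-hub 2 pathAdj lt (s≤s z≤n))) tt
        adjacent (suc zero) j lt _ _ = subst T (sym (joinAdj-hub 2 pathAdj lt (s≤s (s≤s z≤n)))) tt
        adjacent (suc (suc i)) (suc (suc j)) (s≤s (s≤s i<j)) j< t with m≤n⇒m<n∨m≡n i<j
        ... | inj₁ far = ⊥-elim (apart i j far (≤-pred (≤-pred (≤-pred j<))) (touch-mono ψ⇒P ψ⇒P t))
        ... | inj₂ refl = subst T (sym (joinAdj-rest 2 pathAdj i j i<j)) (pathAdj-suc i)
        adjacent (suc (suc i)) (suc zero) (s≤s ()) _ _

      completeFan : (∀ i j → i < j → j ≤ l → Touch (Bag B i) (Bag B j)) → Outcome (suc l)
      completeFan = completeHub (λ u → A? u ⊎-dec C? u) (conn-∪ connA connC AC) (assoc ∘ cover)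
        [ A-P , C-P ]′ B (touch-mono inj₁ id (tA 0 z≤n))
        where
        assoc : ∀ {u} → A u ⊎ C u ⊎ P u → (A u ⊎ C u) ⊎ P u
        assoc (inj₁ a) = inj₁ (inj₁ a)
        assoc (inj₂ (inj₁ c)) = inj₁ (inj₂ c)
        assoc (inj₂ (inj₂ p)) = inj₂ p

      -- Bag 0 is the third hub: `fan` numbers the two hubs and this bag by 0, 1 and 2, just as
      -- `tripleHub` expects.
      tripleFan : ∀ {k} → tripleNumber (suc k) ≤ l → (∀ j → 1 ≤ j → j ≤ l → Touch (Bag B 0) (Bag B j)) → Outcome (suc k)
      tripleFan {k} large t = tripleHub (suc k) l large ψ ψ< ψ-inh ψ-conn
        (λ { zero i _ i< → touch-mono ψ-A ψ-P (tA (suc i) i<)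
           ; (suc zero) i _ i< → touch-mono ψ-C ψ-P (tC (suc i) i<)
           ; (suc (suc zero)) i _ i< → touch-mono ψ-P ψ-P (t (suc i) (s≤s z≤n) i<)
           ; (suc (suc (suc _))) i (s≤s (s≤s (s≤s ()))) i< })
        (s≤s z≤n)

    twoHubs : ∀ {k l} → (∀ u → Dec (P u)) → fanNumber k ≤ suc l → (B : Bags P l) →
      (∀ i → i ≤ l → Touch A (Bag B i)) → (∀ i → i ≤ l → Touch C (Bag B i)) → Outcome (suc k) ⊎
      Σ (Bags P (suc (suc k))) λ B′ → (∀ i → i ≤ suc (suc k) → Touch A (Bag B′ i)) × (∀ i → i ≤ suc (suc k) → Touch C (Bag B′ i)) ×
        (∀ i j → suc (suc i) ≤ j → j ≤ suc (suc k) → Touch (Bag B′ i) (Bag B′ j) → i ≡ 0 × j ≡ suc (suc k))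
    twoHubs {k} P? large B tA tC with rowRamsey P? B k (tripleNumber (suc k)) (suc (suc k)) large
    ... | complete B′ c t = inj₁ (Fan.completeFan B′ (coarse-hub c tA) (coarse-hub c tC) t)
    ... | hubbed B′ c t = inj₁ (Fan.tripleFan B′ (coarse-hub c tA) (coarse-hub c tC) ≤-refl t)
    ... | cyclic B′ c f = inj₂ (B′ , coarse-hub c tA , coarse-hub c tC , f)

  module _ {A C P : V → Set} (A? : ∀ u → Dec (A u)) (C? : ∀ u → Dec (C u)) (P? : ∀ u → Dec (P u))
    (connA : Conn A) (connC : Conn C) (AC : Touch A C) (cover : ∀ u → A u ⊎ C u ⊎ P u)
    (A-C : ∀ {u} → A u → C u → ⊥) (A-P : ∀ {u} → A u → P u → ⊥) (C-P : ∀ {u} → C u → P u → ⊥)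
    {k l : ℕ} (large : fanNumber k ≤ suc l) (B : Bags P l)
    (tA : ∀ i → i ≤ l → Touch A (Bag B i)) (tC : ∀ i → i ≤ l → Touch C (Bag B i)) where

    -- When the row is a cycle of bags, its first and last bags are merged into the hub A.
    doubleHub : Outcome (suc k)
    doubleHub with TwoHubs.twoHubs A? C? connA connC AC cover A-C A-P C-P P? large B tA tC
    ... | inj₁ o = o
    ... | inj₂ (B′ , tA′ , tC′ , f) = TwoHubs.Fan.doubleFan A⁺? C? connA⁺ connC (touch-mono (inj₁ ∘ inj₁) id AC) cover⁺
          (λ { (inj₁ (inj₁ a)) c → A-C a c ; (inj₁ (inj₂ (p , _))) c → C-P c p ; (inj₂ (p , _)) c → C-P c p })
          (λ { (inj₁ (inj₁ a)) (p , _) → A-P a p ; (inj₁ (inj₂ (_ , e))) (_ , lo , _) → <⇒≢ lo (sym e)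
             ; (inj₂ (_ , e)) (_ , _ , hi) → <⇒≢ (s≤s hi) e })
          (λ c (p , _) → C-P c p)
          inner (λ i i≤ → touch-mono (inj₁ ∘ inj₁) (toInner i≤) (tA′ (suc i) (s≤s (m≤n⇒m≤1+n i≤))))
          (λ i i≤ → touch-mono id (toInner i≤) (tC′ (suc i) (s≤s (m≤n⇒m≤1+n i≤))))
          λ i j far j≤ t → case f (suc i) (suc j) (s≤s far) (s≤s (m≤n⇒m≤1+n j≤)) (touch-mono fromInner fromInner t) of λ { () }
      where
      A⁺ P⁺ : V → Set
      A⁺ u = (A u ⊎ Bag B′ 0 u) ⊎ Bag B′ (suc (suc k)) u
      P⁺ u = P u × 1 ≤ index B′ u × index B′ u ≤ 1 + k
      A⁺? : Decidable A⁺
      A⁺? u = (A? u ⊎-dec bag? B′ P? 0 u) ⊎-dec bag? B′ P? (suc (suc k)) u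
      connA⁺ : Conn A⁺
      connA⁺ = conn-∪ (conn-∪ connA (conn B′ 0) (tA′ 0 z≤n)) (conn B′ _) (touch-mono inj₁ id (tA′ _ ≤-refl))
      inner : Bags P⁺ k
      inner = range B′ 1 k (n≤1+n _)
      cover⁺ : ∀ u → A⁺ u ⊎ C u ⊎ P⁺ u
      cover⁺ u with cover u
      ... | inj₁ a = inj₁ (inj₁ (inj₁ a))
      ... | inj₂ (inj₁ c) = inj₂ (inj₁ c)
      ... | inj₂ (inj₂ p) with index B′ u in eq
      ...   | zero = inj₁ (inj₁ (inj₂ (p , refl)))
      ...   | suc i with m≤n⇒m<n∨m≡n (subst (_≤ suc (suc k)) eq (index≤ B′ p))
      ...     | inj₁ lt = inj₂ (inj₂ (p , s≤s z≤n , ≤-pred lt))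
      ...     | inj₂ refl = inj₁ (inj₂ (p , refl))
      toInner : ∀ {i u} → i ≤ k → Bag B′ (suc i) u → Bag inner i u
      toInner {i} i≤ (p , e) = (p , subst (1 ≤_) (sym e) (s≤s z≤n) , subst (_≤ suc k) (sym e) (s≤s i≤)) , cong (_∸ 1) e
      fromInner : ∀ {i u} → Bag inner i u → Bag B′ (suc i) u
      fromInner ((p , lo , _) , e) = p , trans (sym (m+[n∸m]≡n lo)) (cong suc e)

  module _ {A P : V → Set} (A? : ∀ u → Dec (A u)) (P? : ∀ u → Dec (P u)) (connA : Conn A)
    (cover : ∀ u → A u ⊎ P u) (A-P : ∀ {u} → A u → P u → ⊥)
    {k l : ℕ} (large : wheelNumber k ≤ suc l) (B : Bags P l)
    (tA : ∀ i → i ≤ l → Touch A (Bag B i)) (closed : Touch (Bag B l) (Bag B 0)) where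

    wheel : Outcome (suc k)
    wheel with rowRamsey P? B k (suc (fanNumber k)) k large
    ... | complete B′ c t = completeHub A? connA cover A-P B′ (coarse-hub c tA 0 z≤n) t
    ... | hubbed B′ c t = doubleHub A? (bag? B′ P? 0) (λ u → P? u ×-dec (1 ≤? index B′ u)) connA (conn B′ 0)
          (coarse-hub c tA 0 z≤n) cover′ (λ a (p , _) → A-P a p) (λ a (p , _) → A-P a p)
          (λ (_ , e) (_ , lo) → <⇒≢ lo (sym e)) {k} (n≤1+n _) (suffix 1 B′)
          (λ i i≤ → touch-mono id toSuffix (coarse-hub c tA (suc i) (s≤s i≤)))
          (λ i i≤ → touch-mono id toSuffix (t (suc i) (s≤s z≤n) (s≤s i≤)))
      where
      cover′ : ∀ u → A u ⊎ Bag B′ 0 u ⊎ (P u × 1 ≤ index B′ u)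
      cover′ u with cover u
      ... | inj₁ a = inj₁ a
      ... | inj₂ p with index B′ u
      ...   | zero = inj₂ (inj₁ (p , refl))
      ...   | suc i = inj₂ (inj₂ (p , s≤s z≤n))
      toSuffix : ∀ {i u} → Bag B′ (suc i) u → Bag (suffix 1 B′) i u
      toSuffix (p , e) = (p , subst (1 ≤_) (sym e) (s≤s z≤n)) , cong (_∸ 1) e
    ... | cyclic B′ c f = inj₂ (inj₁ (parallelMinor (2 + k) (joinAdj 1 (cycleAdj (suc k))) (joinAdj-comm 1 _ (cycleAdj-comm (suc k)))
          (joinAdj-irrefl 1 (cycleAdj (suc k))) (index full) (λ u → s≤s (index≤ full (cover u)))
          (λ i i< → let (u , _ , e) = inhabited full i (≤-pred i<) in u , e)
          (λ i → conn-cong proj₂ (λ e → cover _ , e) (conn full i)) touches adjacent))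
      where
      tA₀ : Touch A (Bag B′ 0)
      tA₀ = coarse-hub c tA 0 z≤n
      full : Bags (λ u → A u ⊎ P u) (suc k)
      full = prepend B′ A? connA A-P tA₀
      index-A : ∀ {u} → A u → index full u ≡ 0
      index-A = prepend-zero B′ A? connA A-P tA₀
      index-P : ∀ {i u} → Bag B′ i u → index full u ≡ suc i
      index-P (p , e) = trans (prepend-suc B′ A? connA A-P tA₀ p) (cong suc e)
      inP : ∀ {i u} → index full u ≡ suc i → Bag B′ i u
      inP {u = u} e with cover u
      ... | inj₁ a = case trans (sym (index-A a)) e of λ ()
      ... | inj₂ p = p , ℕₚ.suc-injective (trans (sym (index-P (p , refl))) e)
      touches : ∀ i j → i < j → j < 2 + k → T (joinAdj 1 (cycleAdj (suc k)) i j) → Touch (λ u → index full u ≡ i) (λ u → index full u ≡ j)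
      touches zero (suc j) _ j< _ = touch-mono index-A index-P (coarse-hub c tA j (≤-pred (≤-pred j<)))
      touches (suc i) (suc j) (s≤s i<j) j< t with cycleAdj-inv k i<j (subst T (joinAdj-rest 1 (cycleAdj (suc k)) i j i<j) t)
      ... | inj₁ refl = touch-mono index-P index-P (touch B′ i (≤-pred (≤-pred j<)))
      ... | inj₂ (refl , refl) = touch-mono index-P index-P (touch-sym (closing c closed))
      adjacent : ∀ i j → i < j → j < 2 + k → Touch (λ u → index full u ≡ i) (λ u → index full u ≡ j) → T (joinAdj 1 (cycleAdj (suc k)) i j)
      adjacent zero j lt _ _ = subst T (sym (joinAdj-hub 1 (cycleAdj (suc k)) lt (s≤s z≤n))) tt
      adjacent (suc i) (suc j) (s≤s i<j) j< t = subst T (sym (joinAdj-rest 1 (cycleAdj (suc k)) i j i<j)) (near (m≤n⇒m<n∨m≡n i<j))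
        where
        near : suc (suc i) ≤ j ⊎ suc i ≡ j → T (cycleAdj (suc k) i j)
        near (inj₂ refl) = cycleAdj-suc (suc k) i
        near (inj₁ far) with f i j far (≤-pred (≤-pred j<)) (touch-mono inP inP t)
        ... | refl , refl = cycleAdj-closing k

-- Rims formed by paths

module Rims (G : Graph) (simple : IsSimple G)
  (connected : Graphs.Conn (Adj G) (Targets.E? G simple) (Targets.E-sym G simple) (λ _ → ⊤)) where
  open Targets G simple
  open Rows E E? E-sym
  open Growth E E? E-sym
  open Wheels G simple

  private
    V : Set
    V = Fin (order G)

  -- A path from S to T, as a row of singletons; S and T themselves are left out.
  record Path (S T Q : V → Set) : Set₁ where
    field
      On : V → Set
      on? : Decidable On
      len : ℕ
      bags : Bags On len
      single : ∀ {u v} → On u → On v → index bags u ≡ index bags v → u ≡ v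
      inside : ∀ {u} → On u → Q u × ¬ S u × ¬ T u
      from-S : Touch S (Bag bags 0)
      to-T : Touch (Bag bags len) T

  module _ {S T Q : V → Set} (S? : ∀ u → Dec (S u)) (T? : ∀ u → Dec (T u)) (S-T : ∀ {u} → S u → T u → ⊥) (S≁T : ¬ Touch S T) where

    private
      record Tail (u : V) : Set₁ where
        field
          On : V → Set
          on? : ∀ v → Dec (On v)
          len : ℕ
          bags : Bags On len
          single : ∀ {v w} → On v → On w → index bags v ≡ index bags w → v ≡ w
          inside : ∀ {v} → On v → Q v × ¬ S v × ¬ T v
          start : Bag bags 0 u
          to-T : Touch (Bag bags len) T

      lastStep : ∀ {u t} → Q u → ¬ S u → ¬ T u → T t → E u t → Tail u
      lastStep {u} qu ¬su ¬tu t∈ e = record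
        { On = _≡ u ; on? = _≟ u ; len = 0 ; bags = oneBag {_≡ u} (λ { refl refl → here }) refl
        ; single = λ { refl refl _ → refl } ; inside = λ { refl → qu , ¬su , ¬tu }
        ; start = refl , refl ; to-T = u , _ , (refl , refl) , t∈ , e }

      -- Prepending a vertex that is already on the path erases the loop.
      extend : ∀ {u v} → Q u → ¬ S u → ¬ T u → E u v → Tail v → Tail u
      extend {u} {v} qu ¬su ¬tu e p with Tail.on? p u
      ... | yes on = record
        { On = λ w → p.On w × a ≤ index p.bags w × index p.bags w ≤ a + (p.len ∸ a)
        ; on? = λ w → p.on? w ×-dec (a ≤? index p.bags w) ×-dec (index p.bags w ≤? a + (p.len ∸ a))
        ; len = p.len ∸ a
        ; bags = range p.bags a (p.len ∸ a) (≤-reflexive (m+[n∸m]≡n a≤))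
        ; single = λ (x , lo , _) (y , lo′ , _) eq → p.single x y (∸-cancelʳ-≡ lo lo′ eq)
        ; inside = λ (x , _) → p.inside x
        ; start = (on , ≤-refl , m≤m+n a _) , n∸n≡0 a
        ; to-T = touch-mono (λ { (x , eq) → (x , subst (a ≤_) (sym eq) a≤ ,
            ≤-reflexive (trans eq (sym (m+[n∸m]≡n a≤)))) , cong (_∸ a) eq }) id p.to-T
        }
        where
        module p = Tail p
        a = index p.bags u
        a≤ : a ≤ p.len
        a≤ = index≤ p.bags on
      ... | no off = record
        { On = λ w → w ≡ u ⊎ p.On w
        ; on? = λ w → (w ≟ u) ⊎-dec p.on? w
        ; len = suc p.len
        ; bags = longer
        ; single = λ { (inj₁ refl) (inj₁ refl) _ → refl
                     ; (inj₁ refl) (inj₂ y) eq → case trans (sym at-u) (trans eq (at-old y)) of λ ()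
                     ; (inj₂ x) (inj₁ refl) eq → case trans (sym at-u) (trans (sym eq) (at-old x)) of λ ()
                     ; (inj₂ x) (inj₂ y) eq → p.single x y (ℕₚ.suc-injective (trans (sym (at-old x)) (trans eq (at-old y)))) }
        ; inside = λ { (inj₁ refl) → qu , ¬su , ¬tu ; (inj₂ x) → p.inside x }
        ; start = inj₁ refl , at-u
        ; to-T = touch-mono (λ (x , eq) → inj₂ x , trans (at-old x) (cong suc eq)) id p.to-T
        }
        where
        module p = Tail p
        connU : Conn (_≡ u)
        connU refl refl = here
        fresh : ∀ {w} → w ≡ u → p.On w → ⊥
        fresh refl = off
        tU : Touch (_≡ u) (Bag p.bags 0)
        tU = u , v , refl , p.start , e
        longer : Bags (λ w → w ≡ u ⊎ p.On w) (suc p.len)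
        longer = prepend p.bags (_≟ u) connU fresh tU
        at-u : index longer u ≡ 0
        at-u = prepend-zero p.bags (_≟ u) connU fresh tU refl
        at-old : ∀ {w} → p.On w → index longer w ≡ suc (index p.bags w)
        at-old = prepend-suc p.bags (_≟ u) connU fresh tU

      data Progress (u : V) : Set₁ where
        arrived : T u → Progress u
        tail : ¬ S u → Tail u → Progress u
        done : Path S T Q → Progress u

      progress : ∀ {u t} → Q u → T t → Reach (In Q) u t → Progress u
      progress qu t∈ here = arrived t∈
      progress {u} qu t∈ (step {v = v} (e , _ , qv) r) with progress qv t∈ r | T? u | S? u
      ... | done p | _ | _ = done p
      ... | _ | yes tu | _ = arrived tu
      ... | arrived tv | no _ | yes su = ⊥-elim (S≁T (u , v , su , tv , e))
      ... | arrived tv | no ¬tu | no ¬su = tail ¬su (lastStep qu ¬su ¬tu tv e)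
      ... | tail _ p | no ¬tu | no ¬su = tail ¬su (extend qu ¬su ¬tu e p)
      ... | tail _ p | no _ | yes su = done record
        { On = p.On ; on? = p.on? ; len = p.len ; bags = p.bags ; single = p.single ; inside = p.inside
        ; from-S = u , v , su , p.start , e ; to-T = p.to-T }
        where module p = Tail p

    -- The walk is read from its end: a vertex of `T` discards what was collected, a vertex outside
    -- both sets is added with loops erased, and a vertex of `S` completes the path. Since `S` and
    -- `T` do not touch, something has been collected by then.
    simplePath : ∀ {s t} → Q s → S s → T t → Reach (In Q) s t → Path S T Q
    simplePath qs ss t∈ r with progress qs t∈ r
    ... | arrived ts = ⊥-elim (S-T ss ts)
    ... | tail ¬ss _ = ⊥-elim (¬ss ss)
    ... | done p = p

  collect : ∀ {I : Set} {U : I → V → Set} {L : V → Set} → (∀ {i j u} → U i u → U j u → i ≡ j) →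
    ∀ {is} → Unique is → All (λ i → ∃[ y ] (U i y × L y)) is →
    Σ (List V) λ ys → length ys ≡ length is × Unique ys × All L ys × All (λ y → ∃[ i ] (i ∈ is × U i y)) ys
  collect U-disjoint {[]} [] [] = [] , refl , [] , [] , []
  collect U-disjoint {i ∷ is} (i∉ ∷ uniq) ((y , Uy , Ly) ∷ ps) with collect U-disjoint uniq ps
  ... | ys , len , uniq′ , Lys , Uys = y ∷ ys , cong suc len ,
        All.map (λ { (j , j∈ , Uj) refl → All.lookup i∉ j∈ (U-disjoint Uy Uj) }) Uys ∷ uniq′ ,
        Ly ∷ Lys , (i , here refl , Uy) ∷ All.map (λ (j , j∈ , Uj) → j , there j∈ , Uj) Uys

  -- The rim consists of the bag Z and the path X; the vertices ys of the path are the ends of the spokes.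
  module _ {k : ℕ} {A Z X : V → Set} (A? : ∀ u → Dec (A u)) (Z? : ∀ u → Dec (Z u)) (X? : ∀ u → Dec (X u))
    (connA : Conn A) (connZ : Conn Z) {a : V} (a∈ : A a)
    (A-Z : ∀ {u} → A u → Z u → ⊥) (A-X : ∀ {u} → A u → X u → ⊥) (Z-X : ∀ {u} → Z u → X u → ⊥)
    {l : ℕ} (B : Bags X l) (single : ∀ {u v} → X u → X v → index B u ≡ index B v → u ≡ v)
    (ZX : Touch Z (Bag B 0)) (XZ : Touch (Bag B l) Z)
    (ys : List V) (uniq : Unique ys) (spokes : All (λ y → X y × ∃[ w ] (A w × E w y)) ys) (many : wheelNumber k < length ys) where

    rimWheel : Outcome (suc k)
    rimWheel with grow connected A? (λ u → Z? u ⊎-dec X? u) connA a∈ (λ a → [ A-Z a , A-X a ]′) (prepend B Z? connZ Z-X ZX)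
    ... | h = finish (labelledCuts (λ j → touch? hub? (bag? rest (¬? ∘ hub?) j)) (suc l) (wheelNumber k) (map (index rest) ys)
            (indices-unique uniq spokes) (Allₚ.map⁺ (All.map label spokes))
            (subst (wheelNumber k <_) (sym (length-map (index rest) ys)) many))
      where
      open HubBags h
      index-X : ∀ {u} → X u → index rest u ≡ suc (index B u)
      index-X x = trans (same-index (inj₂ x)) (prepend-suc B Z? connZ Z-X ZX x)
      index-Z : ∀ {u} → Z u → index rest u ≡ 0
      index-Z z = trans (same-index (inj₁ z)) (prepend-zero B Z? connZ Z-X ZX z)
      label : ∀ {y} → X y × ∃[ w ] (A w × E w y) → index rest y ≤ suc l × Touch hub (Bag rest (index rest y))
      label {y} (x , w , aw , e) = index≤ rest (P⊆rest (inj₂ x)) , w , y , A⊆hub aw , (P⊆rest (inj₂ x) , refl) , e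
      -- Path bags are singletons and `grow` preserves their indices, so distinct spoke ends have
      -- distinct labels for `labelledCuts`.
      indices-unique : ∀ {ys} → Unique ys → All (λ y → X y × ∃[ w ] (A w × E w y)) ys → Unique (map (index rest) ys)
      indices-unique [] [] = []
      indices-unique (y∉ ∷ u) ((x , _) ∷ sp) = Allₚ.map⁺ (All.zipWith (λ (ne , (x′ , _)) eq →
        ne (single x x′ (ℕₚ.suc-injective (trans (sym (index-X x)) (trans eq (index-X x′)))))) (y∉ , sp)) ∷ indices-unique u sp
      finish : (Σ (ℕ → ℕ) λ b → Cuts b (wheelNumber k) (suc l) ×
        (∀ j → j ≤ wheelNumber k → ∃[ x ] (b j ≤ x × x < b (suc j) × Touch hub (Bag rest x)))) → Outcome (suc k)
      finish (b , C , labels) = wheel hub? (¬? ∘ hub?) hub-conn (λ u → dec-⊎ (hub? u)) (λ p ¬p → ¬p p) {k} (n≤1+n _) (coarsen rest C)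
        (λ i i≤ → let (x , lo , hi , t) = labels i i≤ in touch-mono id (coarse-bag rest C i≤ lo hi) t)
        (closing (coarsen-coarser rest C) (touch-mono
          (λ (x , e) → P⊆rest (inj₂ x) , trans (index-X x) (cong suc e)) (λ z → P⊆rest (inj₁ z) , index-Z z) XZ))
        where
        dec-⊎ : ∀ {A : Set} → Dec A → A ⊎ ¬ A
        dec-⊎ (yes a) = inj₁ a
        dec-⊎ (no ¬a) = inj₂ ¬a

  module _ {k q : ℕ} (large : suc (wheelNumber k) + suc (wheelNumber k) ≤ q)
    {A S T Q₁ Q₂ : V → Set} (A? : ∀ u → Dec (A u)) (S? : ∀ u → Dec (S u)) (T? : ∀ u → Dec (T u))
    (connA : Conn A) (connS : Conn S) (connT : Conn T) {a : V} (a∈ : A a) (S-T : ∀ {u} → S u → T u → ⊥)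
    (p₁ : Path S T Q₁) (p₂ : Path S T Q₂) where
    private
      module p₁ = Path p₁
      module p₂ = Path p₂

    module _ (p₁-p₂ : ∀ {u} → p₁.On u → p₂.On u → ⊥)
      (A-rim : ∀ {u} → A u → ¬ ((S u ⊎ T u) ⊎ (p₁.On u ⊎ p₂.On u)))
      (U : Fin q → V → Set) (connU : ∀ i → Conn (U i)) (U-disjoint : ∀ {i j u} → U i u → U j u → i ≡ j)
      (U-S : ∀ {i u} → U i u → S u → ⊥) (U-T : ∀ {i u} → U i u → T u → ⊥)
      (U-A : ∀ i → ∃[ u ] (U i u × (A u ⊎ ∃[ w ] (A w × E w u)))) (U-p₁ : ∀ i → ∃[ u ] (U i u × p₁.On u)) where

      private
        Rim A⁺ : V → Set
        Rim u = (S u ⊎ T u) ⊎ (p₁.On u ⊎ p₂.On u)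
        rim? : Decidable Rim
        rim? u = (S? u ⊎-dec T? u) ⊎-dec (p₁.on? u ⊎-dec p₂.on? u)
        A⁺ u = Reach (In (λ w → ¬ Rim w)) a u
        A⁺? : Decidable A⁺
        A⁺? u = reach? (in? (¬? ∘ rim?)) a u
        A⁺-rim : ∀ {u} → A⁺ u → ¬ Rim u
        A⁺-rim = reach-end (A-rim a∈)
        A⊆A⁺ : ∀ {u} → A u → A⁺ u
        A⊆A⁺ p = in-mono A-rim (connA a∈ p)

        Spoke₁ Spoke₂ : Fin q → Set
        Spoke₁ i = ∃[ y ] (U i y × p₁.On y × ∃[ w ] (A⁺ w × E w y))
        Spoke₂ i = ∃[ y ] (U i y × p₂.On y × ∃[ w ] (A⁺ w × E w y))

        -- A walk inside the column leads to the first path. Columns avoid `S` and `T`, so until it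
        -- hits one of the two paths the walk is off the rim and stays in the component `A⁺`; the
        -- edge of the first hit is the spoke.
        toRim : ∀ {i u} → U i u → A⁺ u → Spoke₁ i ⊎ Spoke₂ i
        toRim {i} Uu au with U-p₁ i
        ... | y , Uy , on with firstHit (λ u → p₁.on? u ⊎-dec p₂.on? u) (connU i Uu Uy) Uu (inj₁ on) (A⁺-rim au ∘ inj₂)
        ...   | x , z , walk , _ , _ , Uz , on′ , e = split on′
          where
          x∈ : A⁺ x
          x∈ = reach-trans au (in-mono (λ { (Uw , ¬on) (inj₁ (inj₁ s)) → U-S Uw s ; (Uw , ¬on) (inj₁ (inj₂ t)) → U-T Uw t
                                            ; (Uw , ¬on) (inj₂ o) → ¬on o }) walk)
          split : p₁.On z ⊎ p₂.On z → Spoke₁ i ⊎ Spoke₂ i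
          split (inj₁ o) = inj₁ (z , Uz , o , x , x∈ , e)
          split (inj₂ o) = inj₂ (z , Uz , o , x , x∈ , e)

        spoke : ∀ i → Spoke₁ i ⊎ Spoke₂ i
        spoke i with U-A i
        ... | u , Uu , inj₁ au = toRim Uu (A⊆A⁺ au)
        ... | u , Uu , inj₂ (w , aw , e) with p₁.on? u | p₂.on? u
        ...   | yes o | _ = inj₁ (u , Uu , o , w , A⊆A⁺ aw , e)
        ...   | no _ | yes o = inj₂ (u , Uu , o , w , A⊆A⁺ aw , e)
        ...   | no ¬o₁ | no ¬o₂ = toRim Uu (reach-trans (A⊆A⁺ aw) (step (e , A⁺-rim (A⊆A⁺ aw) , off) here))
          where
          off : ¬ Rim u
          off (inj₁ (inj₁ s)) = U-S Uu s
          off (inj₁ (inj₂ t)) = U-T Uu t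
          off (inj₂ (inj₁ o)) = ¬o₁ o
          off (inj₂ (inj₂ o)) = ¬o₂ o

        module _ {Q Q′ : V → Set} (p : Path S T Q) (p′ : Path S T Q′)
          (p-p′ : ∀ {u} → Path.On p u → Path.On p′ u → ⊥)
          (onRim : ∀ {u} → Path.On p u → Rim u) (onRim′ : ∀ {u} → Path.On p′ u → Rim u) where
          private
            module p = Path p
            module p′ = Path p′

          alongPath : ∀ {is} → Unique is → All (λ i → ∃[ y ] (U i y × p.On y × ∃[ w ] (A⁺ w × E w y))) is →
            suc (wheelNumber k) ≤ length is → Outcome (suc k)
          alongPath uniq spokes long with collect U-disjoint uniq spokes
          ... | ys , len , uniq′ , spokes′ , _ = rimWheel {k} {A⁺} {λ u → (S u ⊎ p′.On u) ⊎ T u} {p.On}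
            A⁺? (λ u → (S? u ⊎-dec p′.on? u) ⊎-dec T? u) p.on?
            (conn-component a)
            (conn-∪ (conn-∪ connS (conn-bags p′.bags) (touch-mono id proj₁ p′.from-S)) connT (touch-mono (inj₂ ∘ proj₁) id p′.to-T))
            here
            (λ { x (inj₁ (inj₁ s)) → A⁺-rim x (inj₁ (inj₁ s)) ; x (inj₁ (inj₂ o)) → A⁺-rim x (onRim′ o)
               ; x (inj₂ t) → A⁺-rim x (inj₁ (inj₂ t)) })
            (λ x o → A⁺-rim x (onRim o))
            (λ { (inj₁ (inj₁ s)) o → proj₁ (proj₂ (p.inside o)) s ; (inj₁ (inj₂ o′)) o → p-p′ o o′
               ; (inj₂ t) o → proj₂ (proj₂ (p.inside o)) t })
            p.bags p.single (touch-mono (inj₁ ∘ inj₁) id p.from-S) (touch-mono id inj₂ p.to-T)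
            ys uniq′ spokes′ (subst (suc (wheelNumber k) ≤_) (sym len) long)

      -- A grows to its component A⁺ off the rim; every column then contains a spoke from A⁺ to one of the paths,
      -- and the path receiving most spokes becomes the rim, the other one being merged into its closing bag.
      columnWheel : Outcome (suc k)
      columnWheel with majority spoke (suc (wheelNumber k)) (suc (wheelNumber k)) (allFin q)
        (subst (suc (wheelNumber k) + suc (wheelNumber k) ≤_) (sym (length-tabulate id)) large)
      ... | inj₁ (is , s , long , spokes) = alongPath p₁ p₂ p₁-p₂ (inj₂ ∘ inj₁) (inj₂ ∘ inj₂) (allPairs-⊆ s (Uniqueₚ.allFin⁺ q)) spokes long
      ... | inj₂ (is , s , long , spokes) = alongPath p₂ p₁ (λ x y → p₁-p₂ y x) (inj₂ ∘ inj₂) (inj₂ ∘ inj₁)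
            (allPairs-⊆ s (Uniqueₚ.allFin⁺ q)) spokes long

-- Disjoint paths through cyclic rows

rimNumber stripNumber : ℕ → ℕ
-- Every column gives a spoke to one of two paths, and one path has to receive more than
-- `wheelNumber k` of them.
rimNumber k = suc (wheelNumber k) + suc (wheelNumber k)
stripNumber k = 5 + (rimNumber k + rimNumber k)

allConn : (G : Graph) (simple : IsSimple G) → ThreeConnected G →
  Graphs.Conn (Adj G) (Targets.E? G simple) (Targets.E-sym G simple) (λ _ → ⊤)
allConn G simple (_ , three) {u} {v} _ _ = reach-map (λ (e , _) → e , tt , tt) (three [] z≤n u v (λ ()) (λ ()))

module Strips (G : Graph) (simple : IsSimple G) (three : ThreeConnected G) where
  open Targets G simple
  open Rims G simple (allConn G simple three)
  open Menger {order G}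

  private
    V : Set
    V = Fin (order G)

  -- A cyclic row of 6 + 2q bags. S and T′ consist of three consecutive bags each, so that no two vertices
  -- cover either of them, and q bags remain on each of the two sides between them.
  module Strip {P : V → Set} (P? : ∀ u → Dec (P u)) {q : ℕ} (q≥1 : 1 ≤ q) (B : Bags P (5 + (q + q)))
    (around : ∀ i j → suc (suc i) ≤ j → j ≤ 5 + (q + q) → Touch (Bag B i) (Bag B j) → i ≡ 0 × j ≡ 5 + (q + q))
    {r : ℕ} (r≤3 : r ≤ 3)
    (robust : ∀ X → length X < r → ∀ {u v} → P u → P v → u ∉ X → v ∉ X → Reach (In (λ w → P w × w ∉ X)) u v) where

    m : ℕ
    m = 5 + (q + q)

    γ : V → ℕ
    γ = index B

    S T′ : V → Set
    S u = P u × γ u ≤ 2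
    T′ u = P u × 3 + q ≤ γ u × γ u ≤ 5 + q

    S? : Decidable S
    S? u = P? u ×-dec (γ u ≤? 2)

    T′? : Decidable T′
    T′? u = P? u ×-dec (3 + q ≤? γ u) ×-dec (γ u ≤? 5 + q)

    connS : Conn S
    connS = conn-cong (λ { (p , _ , s≤s hi) → p , hi }) (λ (p , hi) → p , z≤n , s≤s hi) (conn-segment B 0 3)

    connT : Conn T′
    connT = conn-cong (λ { (p , lo , s≤s hi) → p , lo , hi }) (λ (p , lo , hi) → p , lo , s≤s hi) (conn-segment B (3 + q) (6 + q))

    S-T : ∀ {u} → S u → T′ u → ⊥
    S-T (_ , hi) (_ , lo , _) = <⇒≱ (≤-trans (m≤m+n 3 q) lo) hi

    near : ∀ {u v} → P u → P v → E u v → γ v ≤ suc (γ u) ⊎ (γ u ≡ 0 × γ v ≡ m)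
    near {u} {v} pu pv e with γ v ≤? suc (γ u)
    ... | yes le = inj₁ le
    ... | no ¬le = inj₂ (around (γ u) (γ v) (≰⇒> ¬le) (index≤ B pv) (u , v , (pu , refl) , (pv , refl) , e))

    5+q<m : 5 + q < m
    5+q<m = +-monoʳ-< 5 (m<m+n q q≥1)

    S≁T : ¬ Touch S T′
    S≁T (u , v , (pu , hi) , (pv , lo , hi′) , e) with near pu pv e
    ... | inj₁ le = <⇒≱ (≤-trans (+-monoʳ-≤ 3 q≥1) lo) (≤-trans le (s≤s hi))
    ... | inj₂ (_ , eq) = <⇒≢ (≤-<-trans hi′ 5+q<m) eq

    Sides : ℕ → (V → Set) → Set
    Sides off On = ∀ (i : Fin q) → ∃[ u ] (Bag B (off + toℕ i) u × On u)

    module _ {Q : V → Set} (Q⊆P : ∀ {u} → Q u → P u) (p : Path S T′ Q) where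
      private
        module p = Path p

        inP : ∀ {u} → p.On u → P u
        inP o = Q⊆P (proj₁ (p.inside o))

        off-S : ∀ {u} → p.On u → 3 ≤ γ u
        off-S o = ≰⇒> λ hi → proj₁ (proj₂ (p.inside o)) (inP o , hi)

        off-T : ∀ {u j} → p.On u → γ u ≡ j → 3 + q ≤ j → j ≤ 5 + q → ⊥
        off-T o refl lo hi = proj₂ (proj₂ (p.inside o)) (inP o , lo , hi)

        -- A discrete intermediate value theorem: along an edge the bag index rises by at most one,
        -- except from bag 0 to the last bag, and bag 0 belongs to `S`, which the path avoids.
        intermediate : ∀ {u w} j → p.On u → Reach (In p.On) u w → γ u ≤ j → j ≤ γ w → ∃[ x ] (p.On x × γ x ≡ j)
        intermediate {u} j o walk lo hi with m≤n⇒m<n∨m≡n lo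
        ... | inj₂ eq = u , o , eq
        intermediate j o here lo hi | inj₁ lt = ⊥-elim (<⇒≱ lt hi)
        intermediate j o (step (e , _ , o′) walk) lo hi | inj₁ lt with near (inP o) (inP o′) e
        ... | inj₁ le = intermediate j o′ walk (≤-trans le lt) hi
        ... | inj₂ (eq , _) = ⊥-elim (<⇒≢ (≤-trans (s≤s z≤n) (off-S o)) (sym eq))

        across : ∀ {u w} → p.On u → p.On w → γ u ≤ 3 + q → 3 + q ≤ γ w → ⊥
        across o o′ lo hi with intermediate (3 + q) o (conn-bags p.bags o o′) lo hi
        ... | x , ox , eq = off-T ox eq ≤-refl (m≤n+m (3 + q) 2)

        fills : ∀ {u w} off → p.On u → p.On w → γ u ≤ off → (∀ i → i < q → off + i ≤ γ w) → Sides off p.On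
        fills off o o′ lo hi i with intermediate (off + toℕ i) o (conn-bags p.bags o o′) (≤-trans lo (m≤m+n off _)) (hi (toℕ i) (toℕ<n i))
        ... | x , ox , eq = x , (inP ox , eq) , ox

      -- The path leaves `S` either into bag 3 or, around the back, into the last bag. It cannot
      -- jump over the middle group `T′`, next to which it ends, so it visits all bags between on
      -- the side where it started.
      sides : Sides 3 p.On ⊎ Sides (6 + q) p.On
      sides with p.from-S | p.to-T
      ... | s , x , (ps , s≤2) , (ox , _) , e | y , t , (oy , _) , (pt , lo , hi) , e′
        with near ps (inP ox) e | near pt (inP oy) (E-sym e′) | near (inP oy) pt e′
      ... | _ | inj₂ (eq , _) | _ = ⊥-elim (<⇒≢ (≤-trans (s≤s z≤n) lo) (sym eq))
      ... | _ | _ | inj₂ (eq , _) = ⊥-elim (<⇒≢ (≤-trans (s≤s z≤n) (off-S oy)) (sym eq))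
      ... | inj₁ x≤ | inj₁ y≤ | inj₁ t≤ with 3 + q ≤? γ y
      ...   | yes far = ⊥-elim (across ox oy (≤-trans x≤ (≤-trans (s≤s s≤2) (m≤m+n 3 q))) far)
      ...   | no _ = inj₁ (fills 3 ox oy (≤-trans x≤ (s≤s s≤2)) λ i i< → ≤-pred (≤-trans (+-monoʳ-≤ 3 i<) (≤-trans lo t≤)))
      sides | s , x , (ps , s≤2) , (ox , _) , e | y , t , (oy , _) , (pt , lo , hi) , e′
        | inj₂ (_ , eq) | inj₁ y≤ | inj₁ t≤ with γ y ≤? 3 + q
      ...   | yes low = ⊥-elim (across oy ox low (subst (3 + q ≤_) (sym eq) (≤-trans (m≤n+m (3 + q) 2) (<⇒≤ 5+q<m))))
      ...   | no _ = inj₂ (fills (6 + q) oy ox (≤-trans y≤ (s≤s hi))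
              λ i i< → subst (6 + q + i ≤_) (sym eq) (≤-trans (≤-reflexive (sym (+-suc (5 + q) i))) (+-monoʳ-≤ (5 + q) i<)))

    column-S : ∀ {off} → off ≡ 3 ⊎ off ≡ 6 + q → ∀ {i u} → Bag B (off + i) u → S u → ⊥
    column-S (inj₁ refl) (_ , eq) (_ , hi) = <⇒≱ (subst (3 ≤_) (sym eq) (m≤m+n 3 _)) hi
    column-S (inj₂ refl) (_ , eq) (_ , hi) = <⇒≱ (subst (3 ≤_) (sym eq) (m≤m+n 3 _)) hi

    column-T : ∀ {off} → off ≡ 3 ⊎ off ≡ 6 + q → ∀ {i u} → i < q → Bag B (off + i) u → T′ u → ⊥
    column-T (inj₁ refl) i< (_ , eq) (_ , lo , _) = <⇒≱ (subst (_< 3 + q) (sym eq) (+-monoʳ-< 3 i<)) lo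
    column-T (inj₂ refl) i< (_ , eq) (_ , _ , hi) = <⇒≱ (subst (5 + q <_) (sym eq) (m≤m+n (6 + q) _)) hi

    column-disjoint : ∀ off {i j : Fin q} {u} → Bag B (off + toℕ i) u → Bag B (off + toℕ j) u → i ≡ j
    column-disjoint off (_ , eq) (_ , eq′) = toℕ-injective (+-cancelˡ-≡ off _ _ (trans (sym eq) eq′))

    private
      edges : List (V × V)
      edges = filter (λ (u , v) → in? P? u v) (cartesianProduct (allFin (order G)) (allFin (order G)))

      edges⇒ : ∀ {u v} → Edge edges u v → In P u v
      edges⇒ (inj₁ e) = proj₂ (∈-filter⁻ (λ (u , v) → in? P? u v) {xs = cartesianProduct (allFin (order G)) (allFin (order G))} e)
      edges⇒ (inj₂ e) = in-sym (proj₂ (∈-filter⁻ (λ (u , v) → in? P? u v) {xs = cartesianProduct (allFin (order G)) (allFin (order G))} e))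

      ⇒edges : ∀ {u v} → In P u v → Edge edges u v
      ⇒edges i = inj₁ (∈-filter⁺ (λ (u , v) → in? P? u v) (∈-cartesianProduct⁺ (∈-allFin _) (∈-allFin _)) i)

      fresh : ∀ X → length X < r → ∀ off → 2 + off ≤ m → ∃[ u ] (P u × (off ≤ γ u × γ u ≤ 2 + off) × u ∉ X)
      fresh X lt off off≤ with inhabited B off (≤-trans (m≤n+m off 2) off≤)
        | inhabited B (1 + off) (≤-trans (m≤n+m (1 + off) 1) off≤) | inhabited B (2 + off) off≤
      ... | a , pa , ea | b , pb , eb | c , pc , ec with a ∈? X | b ∈? X | c ∈? X
      ...   | no a∉ | _ | _ = a , pa , (≤-reflexive (sym ea) , subst (_≤ 2 + off) (sym ea) (m≤n+m off 2)) , a∉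
      ...   | yes _ | no b∉ | _ = b , pb , (subst (off ≤_) (sym eb) (m≤n+m off 1) , subst (_≤ 2 + off) (sym eb) (m≤n+m (1 + off) 1)) , b∉
      ...   | yes _ | yes _ | no c∉ = c , pc , (subst (off ≤_) (sym ec) (m≤n+m off 2) , ≤-reflexive ec) , c∉
      ...   | yes a∈ | yes b∈ | yes c∈ = ⊥-elim (<⇒≱ (≤-trans lt r≤3) (unique-⊆⇒≤
              ((apart (λ ()) ea eb ∷ apart (λ ()) ea ec ∷ []) ∷ (apart (λ ()) eb ec ∷ []) ∷ [] ∷ [])
              (a∈ ∷ b∈ ∷ c∈ ∷ [])))
        where
        apart : ∀ {u v} {i j : ℕ} → i + off ≢ j + off → γ u ≡ i + off → γ v ≡ j + off → u ≢ v
        apart ne e e′ refl = ne (trans (sym e) e′)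

    disjointPaths : DisjointPaths edges S T′ r
    disjointPaths with menger edges r S? T′?
    ... | inj₂ D = D
    ... | inj₁ (X , lt , sep) with fresh X lt 0 (s≤s (s≤s z≤n)) | fresh X lt (3 + q) (<⇒≤ 5+q<m)
    ...   | s , ps , (_ , hi) , s∉ | t , pt , (lo , hi′) , t∉ = ⊥-elim (sep (ps , hi) (pt , lo , hi′) s∉ t∉
            (reach-map (λ (e , (p , x) , (p′ , y)) → ⇒edges (e , p , p′) , x , y) (robust X lt ps pt s∉ t∉)))

    private
      module D = DisjointPaths disjointPaths

    path : ∀ i → Path S T′ (λ u → D.on i u × P u)
    path i = simplePath S? T′? S-T S≁T (D.on-source i , proj₁ (D.source∈ i)) (D.source∈ i) (D.target∈ i)
      (reach-map (λ (e , x , y) → let (e′ , p , p′) = edges⇒ e in e′ , (x , p) , (y , p′)) (D.path i))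

    paths-disjoint : ∀ {i j} → i ≢ j → ∀ {u} → Path.On (path i) u → Path.On (path j) u → ⊥
    paths-disjoint {i} {j} ne o o′ = ne (D.disjoint (proj₁ (proj₁ (Path.inside (path i) o))) (proj₁ (proj₁ (Path.inside (path j) o′))))

    path-P : ∀ i {u} → Path.On (path i) u → P u
    path-P i o = proj₂ (proj₁ (Path.inside (path i) o))

    pathSides : ∀ i → Sides 3 (Path.On (path i)) ⊎ Sides (6 + q) (Path.On (path i))
    pathSides i = sides proj₂ (path i)

  rimNumber≥1 : ∀ k → 1 ≤ rimNumber k
  rimNumber≥1 k = s≤s z≤n

  -- Removing one more vertex leaves `G - v` connected, so Menger's theorem gives two disjoint paths
  -- there. The columns are the bags on the side filled by the first path; each of them contains a
  -- neighbour of `v`.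
  hubStrip : ∀ {k} v (B : Bags (_≢ v) (stripNumber k)) → (∀ i → i ≤ stripNumber k → Touch (_≡ v) (Bag B i)) →
    (∀ i j → suc (suc i) ≤ j → j ≤ stripNumber k → Touch (Bag B i) (Bag B j) → i ≡ 0 × j ≡ stripNumber k) → Outcome (suc k)
  hubStrip {k} v B tv around = finish (pathSides zero)
    where
    robust : ∀ X → length X < 2 → ∀ {u w} → u ≢ v → w ≢ v → u ∉ X → w ∉ X → Reach (In (λ a → a ≢ v × a ∉ X)) u w
    robust X lt p q u∉ w∉ = reach-map (λ (e , a∉ , b∉) → e , (a∉ ∘ here , a∉ ∘ there) , (b∉ ∘ here , b∉ ∘ there))
      (proj₂ three (v ∷ X) lt _ _ (λ { (here e) → p e ; (there u∈) → u∉ u∈ }) (λ { (here e) → q e ; (there w∈) → w∉ w∈ }))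
    open Strip {_≢ v} (λ u → ¬? (u ≟ v)) {rimNumber k} (rimNumber≥1 k) B around {2} (s≤s (s≤s z≤n)) robust
    conn-v : Conn (_≡ v)
    conn-v refl refl = here
    onSide : ∀ off → off ≡ 3 ⊎ off ≡ 6 + rimNumber k → (∀ (i : Fin (rimNumber k)) → off + toℕ i ≤ stripNumber k) →
      Sides off (Path.On (path zero)) → Outcome (suc k)
    onSide off good off≤ hits = columnWheel {k} ≤-refl {_≡ v} (_≟ v) S? T′? conn-v connS connT refl S-T (path zero) (path (suc zero))
      (paths-disjoint λ ())
      (λ { e (inj₁ (inj₁ s)) → proj₁ s e ; e (inj₁ (inj₂ t)) → proj₁ t e ; e (inj₂ (inj₁ o)) → path-P zero o e
         ; e (inj₂ (inj₂ o)) → path-P (suc zero) o e })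
      (λ i → Bag B (off + toℕ i)) (λ i → conn B _) (column-disjoint off)
      (column-S good) (λ {i} → column-T good (toℕ<n i))
      (λ i → let (w , u , ew , b , e) = tv _ (off≤ i) in u , b , inj₂ (w , ew , e)) hits
    finish : _ → Outcome (suc k)
    finish (inj₁ hits) = onSide 3 (inj₁ refl)
      (λ i → ≤-trans (+-monoʳ-≤ 3 (≤-trans (<⇒≤ (toℕ<n i)) (m≤m+n _ _))) (m≤n+m _ 2)) hits
    finish (inj₂ hits) = onSide (6 + rimNumber k) (inj₂ refl)
      (λ i → ≤-trans (≤-reflexive (sym (+-suc (5 + rimNumber k) (toℕ i)))) (+-monoʳ-≤ (5 + rimNumber k) (toℕ<n i))) hits

  strip : ∀ {k} (B : Bags (λ _ → ⊤) (stripNumber k)) →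
    (∀ i j → suc (suc i) ≤ j → j ≤ stripNumber k → Touch (Bag B i) (Bag B j) → i ≡ 0 × j ≡ stripNumber k) → Outcome (suc k)
  strip {k} B around = finish (pathSides zero) (pathSides (suc zero)) (pathSides (suc (suc zero)))
    where
    robust : ∀ X → length X < 3 → ∀ {u w} → ⊤ → ⊤ → u ∉ X → w ∉ X → Reach (In (λ a → ⊤ × a ∉ X)) u w
    robust X lt _ _ u∉ w∉ = reach-map (λ (e , a∉ , b∉) → e , (tt , a∉) , (tt , b∉)) (proj₂ three X (≤-pred lt) _ _ u∉ w∉)
    open Strip {λ _ → ⊤} (λ _ → yes tt) {rimNumber k} (rimNumber≥1 k) B around {3} ≤-refl robust
    onSide : ∀ {a b c : Fin 3} → a ≢ b → a ≢ c → b ≢ c → ∀ off → off ≡ 3 ⊎ off ≡ 6 + rimNumber k →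
      Sides off (Path.On (path a)) → Sides off (Path.On (path b)) → Outcome (suc k)
    onSide {a} {b} {c} a≢b a≢c b≢c off good hitsA hitsB = columnWheel {k} ≤-refl {Path.On (path a)} (Path.on? (path a)) S? T′?
      (conn-bags (Path.bags (path a))) connS connT (proj₁ (proj₂ (inhabited (Path.bags (path a)) 0 z≤n))) S-T (path b) (path c)
      (paths-disjoint b≢c)
      (λ { o (inj₁ (inj₁ s)) → proj₁ (proj₂ (Path.inside (path a) o)) s ; o (inj₁ (inj₂ t)) → proj₂ (proj₂ (Path.inside (path a) o)) t
         ; o (inj₂ (inj₁ o′)) → paths-disjoint a≢b o o′ ; o (inj₂ (inj₂ o′)) → paths-disjoint a≢c o o′ })
      (λ i → Bag B (off + toℕ i)) (λ i → conn B _) (column-disjoint off)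
      (column-S good) (λ {i} → column-T good (toℕ<n i))
      (λ i → let (u , b , o) = hitsA i in u , b , inj₁ o) hitsB
    finish : _ → _ → _ → Outcome (suc k)
    finish (inj₁ x) (inj₁ y) _ = onSide {zero} {suc zero} {suc (suc zero)} (λ ()) (λ ()) (λ ()) 3 (inj₁ refl) x y
    finish (inj₁ x) (inj₂ _) (inj₁ z) = onSide {zero} {suc (suc zero)} {suc zero} (λ ()) (λ ()) (λ ()) 3 (inj₁ refl) x z
    finish (inj₂ _) (inj₁ y) (inj₁ z) = onSide {suc zero} {suc (suc zero)} {zero} (λ ()) (λ ()) (λ ()) 3 (inj₁ refl) y z
    finish (inj₂ x) (inj₂ y) _ = onSide {zero} {suc zero} {suc (suc zero)} (λ ()) (λ ()) (λ ()) _ (inj₂ refl) x y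
    finish (inj₂ x) (inj₁ _) (inj₂ z) = onSide {zero} {suc (suc zero)} {suc zero} (λ ()) (λ ()) (λ ()) _ (inj₂ refl) x z
    finish (inj₁ _) (inj₂ y) (inj₂ z) = onSide {suc zero} {suc (suc zero)} {zero} (λ ()) (λ ()) (λ ()) _ (inj₂ refl) y z

-- Vertices of large degree

twinNumber starNumber hubNumber : ℕ → ℕ
-- Two tags already rule out a heap of distinct pieces; the other summand is the number of
-- neighbouring pieces wanted below a third hub.
twinNumber k = tagNumber (2 + tripleNumber (suc k)) (wheelNumber k)
starNumber k = 2 + twinNumber k
hubNumber k = tagNumber (starNumber k) (cutNumber k (suc (wheelNumber k)) (stripNumber k))

-- Refutes the `heap` outcome of `branch` when `loc` is `id`, where distinct tags have distinct
-- locations.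
two-equal : ∀ {A : Set} {c : A} {xs} → 2 ≤ length xs → Unique xs → All (_≡ c) xs → ⊥
two-equal {xs = _ ∷ []} (s≤s ())
two-equal {xs = _ ∷ _ ∷ _} _ ((ne ∷ _) ∷ _) (refl ∷ refl ∷ _) = ne refl

module Hubs (G : Graph) (simple : IsSimple G) (three : ThreeConnected G) where
  open Targets G simple
  open Rows E E? E-sym
  open Wheels G simple
  open Growth E E? E-sym
  open Strips G simple three

  private
    V : Set
    V = Fin (order G)

  -- Classes 0 and 1 of ψ are the two hubs, class 2 + i is piece i.
  module Twin {k N : ℕ} (large : twinNumber k < N) (ψ : V → ℕ) (ψ< : ∀ u → ψ u < 2 + N)
    (inh : ∀ i → i < 2 + N → ∃[ u ] ψ u ≡ i) (classes : ∀ i → Conn (λ u → ψ u ≡ i))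
    (hubs : ∀ h i → h < 2 → i < N → Touch (λ u → ψ u ≡ h) (λ u → ψ u ≡ 2 + i))
    (connR : Conn (λ u → 2 ≤ ψ u)) where

    Piece : Fin N → V → Set
    Piece i u = ψ u ≡ 2 + toℕ i

    piece? : ∀ i u → Dec (Piece i u)
    piece? i u = ψ u ℕₚ.≟ 2 + toℕ i

    pieceOf : ∀ u → 2 ≤ ψ u → ∃[ i ] Piece i u
    pieceOf u le = fromℕ< lt , trans (sym (m+[n∸m]≡n le)) (cong (2 +_) (sym (toℕ-fromℕ< lt)))
      where
      lt : ψ u ∸ 2 < N
      lt = +-cancelˡ-< 2 _ _ (subst (_< 2 + N) (sym (m+[n∸m]≡n le)) (ψ< u))

    sample : ∀ i → ∃[ u ] Piece i u
    sample i = inh (2 + toℕ i) (+-monoʳ-< 2 (toℕ<n i))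

    same-piece : ∀ {i j u} → Piece i u → Piece j u → i ≡ j
    same-piece p q = toℕ-injective (+-cancelˡ-≡ 2 _ _ (trans (sym p) q))

    -- The pieces are the vertices of a quotient graph, to which `Graphs` and `Growth` apply because
    -- they take the edge relation as a parameter.
    Adjacent : Fin N → Fin N → Set
    Adjacent i j = Touch (Piece i) (Piece j)

    private
      module Q = Graphs Adjacent (λ i j → touch? (piece? i) (piece? j)) (λ {i} {j} → touch-sym {Piece i} {Piece j})
      module QG = Growth Adjacent (λ i j → touch? (piece? i) (piece? j)) (λ {i} {j} → touch-sym {Piece i} {Piece j})

    reachPieces : ∀ {u w i j} → Reach (In (λ v → 2 ≤ ψ v)) u w → Piece i u → Piece j w → Reach (Q.In (λ _ → ⊤)) i j
    reachPieces here p q with same-piece p q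
    ... | refl = here
    reachPieces (step {u} {v} (e , _ , lv) r) p q = let (h , s) = pieceOf v lv in
      step ((u , v , p , s , e) , tt , tt) (reachPieces r s q)

    connQ : Q.Conn (λ _ → ⊤)
    connQ {i} {j} _ _ = let (u , p) = sample i ; (w , q) = sample j in
      reachPieces (connR (subst (2 ≤_) (sym p) (m≤m+n 2 _)) (subst (2 ≤_) (sym q) (m≤m+n 2 _))) p q

    reachUnion : ∀ {X : Fin N → Set} {i j u w} → Reach (Q.In X) i j → X i → Piece i u → Piece j w →
      Reach (In (λ v → ∃[ h ] (Piece h v × X h))) u w
    reachUnion {i = i} here x p q = in-mono (λ s → i , s , x) (classes _ p q)
    reachUnion {i = i} (step {v = h} ((a , b , pa , pb , e) , x , y) r) _ p q =
      reach-trans (in-mono (λ s → i , s , x) (classes _ p pa)) (step (e , (i , pa , x) , (h , pb , y)) (reachUnion r y pb q))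

    conn-union : ∀ {X : Fin N → Set} → Q.Conn X → Conn (λ v → ∃[ h ] (Piece h v × X h))
    conn-union c (i , p , x) (j , q , y) = reachUnion (c x y) x p q

    module _ {l : ℕ} (B : Q.Bags (λ _ → ⊤) l) where
      private
        pieceIndex : ℕ → ℕ
        pieceIndex j with j <? N
        ... | yes lt = Q.index B (fromℕ< lt)
        ... | no _ = 0

        pieceIndex-toℕ : ∀ i → pieceIndex (toℕ i) ≡ Q.index B i
        pieceIndex-toℕ i with toℕ i <? N
        ... | yes lt = cong (Q.index B) (toℕ-injective (toℕ-fromℕ< lt))
        ... | no ¬lt = ⊥-elim (¬lt (toℕ<n i))

        index′ : V → ℕ
        index′ u = pieceIndex (ψ u ∸ 2)

        index′-piece : ∀ {i u} → Piece i u → index′ u ≡ Q.index B i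
        index′-piece {i} p = trans (cong (λ j → pieceIndex (j ∸ 2)) p) (pieceIndex-toℕ i)

        lift : ∀ {h i u} → Piece h u → ⊤ × Q.index B h ≡ i → 2 ≤ ψ u × index′ u ≡ i
        lift p (_ , e) = subst (2 ≤_) (sym p) (m≤m+n 2 _) , trans (index′-piece p) e

        unlift : ∀ {i u} → 2 ≤ ψ u × index′ u ≡ i → ∃[ h ] (Piece h u × (⊤ × Q.index B h ≡ i))
        unlift {u = u} (le , e) = let (h , p) = pieceOf u le in h , p , tt , trans (sym (index′-piece p)) e

      pieceBags : Bags (λ u → 2 ≤ ψ u) l
      pieceBags = record
        { index = index′
        ; index≤ = λ {u} le → let (h , p) = pieceOf u le in subst (_≤ l) (sym (index′-piece p)) (Q.index≤ B tt)
        ; conn = λ i → conn-cong (λ (h , p , x) → lift p x) unlift (conn-union (Q.conn B i))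
        ; touch = λ i lt → let (h , h′ , x , y , t) = Q.touch B i lt in touch-mono (λ p → lift p x) (λ p → lift p y) t
        ; inhabited = λ i le → let (h , x) = Q.inhabited B i le ; (u , p) = sample h in u , lift p x
        }

      hub-touches-bag : ∀ h i → h < 2 → i ≤ l → Touch (λ u → ψ u ≡ h) (Bag pieceBags i)
      hub-touches-bag h i h< i≤ = let (j , x) = Q.inhabited B i i≤ in touch-mono id (λ p → lift p x) (hubs h (toℕ j) h< (toℕ<n j))

    manyNeighbours : ∀ c ws → Unique ws → All (λ w → Adjacent w c × w ≢ c) ws → tripleNumber (suc k) ≤ length ws → Outcome (suc k)
    manyNeighbours c ws uniq adjacent long = tripleHub (suc k) (length ws) long χ (λ u → relabel< (ψ u)) χ-inh χ-conn χ-hubs (s≤s z≤n)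
      where
      names : List ℕ
      names = map toℕ ws
      place : ℕ → ℕ
      place i with Any.any? (i ℕₚ.≟_) names
      ... | yes i∈ = 3 + toℕ (Any.index i∈)
      -- The centre `c` becomes the third hub; every other piece that is not chosen joins hub 0,
      -- which touches all pieces.
      ... | no _ = if i ≡ᵇ toℕ c then 2 else 0
      relabel : ℕ → ℕ
      relabel (suc (suc i)) = place i
      relabel i = i
      χ : V → ℕ
      χ u = relabel (ψ u)
      len : length names ≡ length ws
      len = length-map toℕ ws
      place< : ∀ i → place i < 3 + length ws
      place< i with Any.any? (i ℕₚ.≟_) names
      ... | yes i∈ = +-monoʳ-< 3 (subst (toℕ (Any.index i∈) <_) len (toℕ<n (Any.index i∈)))
      ... | no _ with i ≡ᵇ toℕ c
      ...   | true = s≤s (s≤s (s≤s z≤n))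
      ...   | false = s≤s z≤n
      relabel< : ∀ i → relabel i < 3 + length ws
      relabel< zero = s≤s z≤n
      relabel< (suc zero) = s≤s (s≤s z≤n)
      relabel< (suc (suc i)) = place< i
      names-unique : Unique names
      names-unique = Uniqueₚ.map⁺ toℕ-injective uniq
      place-lookup : ∀ j → place (lookup names j) ≡ 3 + toℕ j
      place-lookup j with Any.any? (lookup names j ℕₚ.≟_) names
      ... | yes i∈ = cong (λ h → 3 + toℕ h) (sym (unique-lookup names-unique j (Any.index i∈) (Anyₚ.lookup-index i∈)))
      ... | no i∉ = ⊥-elim (i∉ (∈-lookup j))
      c∉ : toℕ c ∉ names
      c∉ c∈ with Anyₚ.map⁻ c∈
      ... | w∈ with find w∈
      ...   | w , w∈ws , e = proj₂ (All.lookup adjacent w∈ws) (sym (toℕ-injective e))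
      place-c : place (toℕ c) ≡ 2
      place-c with Any.any? (toℕ c ℕₚ.≟_) names
      ... | yes c∈ = ⊥-elim (c∉ c∈)
      ... | no _ rewrite ≡ᵇ-refl (toℕ c) = refl
      place-inv : ∀ i j → place i ≡ 3 + toℕ j → i ≡ lookup names j
      place-inv i j e with Any.any? (i ℕₚ.≟_) names
      ... | yes i∈ = trans (Anyₚ.lookup-index i∈) (cong (lookup names) (toℕ-injective (+-cancelˡ-≡ 3 _ _ e)))
      ... | no _ with i ≡ᵇ toℕ c
      place-inv i j () | no _ | true
      place-inv i j () | no _ | false
      place-inv-c : ∀ i → place i ≡ 2 → i ≡ toℕ c
      place-inv-c i e with Any.any? (i ℕₚ.≟_) names
      ... | no _ with i ≡ᵇ toℕ c in eq
      ...   | true = ≡ᵇ⇒≡ i (toℕ c) (subst T (sym eq) tt)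
      place-inv-c i () | no _ | false
      place≢1 : ∀ i → place i ≢ 1
      place≢1 i e with Any.any? (i ℕₚ.≟_) names
      place≢1 i () | yes _
      ... | no _ with i ≡ᵇ toℕ c
      place≢1 i () | no _ | true
      place≢1 i () | no _ | false
      chosen : ∀ {j} → j < length ws → ∃[ w ] (Adjacent w c × place (toℕ w) ≡ 3 + j)
      chosen {j} j< = w , proj₁ (All.lookup adjacent (∈-lookup {xs = ws} (fromℕ< j<))) ,
        trans (cong place (sym (lookup-map ws j′ (fromℕ< j<) (trans toℕ-j′ (sym (toℕ-fromℕ< j<))))))
          (trans (place-lookup j′) (cong (3 +_) toℕ-j′))
        where
        w = lookup ws (fromℕ< j<)
        j′ : Fin (length names)
        j′ = fromℕ< (subst (j <_) (sym len) j<)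
        toℕ-j′ : toℕ j′ ≡ j
        toℕ-j′ = toℕ-fromℕ< _
        lookup-map : ∀ (xs : List (Fin N)) (a : Fin (length (map toℕ xs))) (b : Fin (length xs)) → toℕ a ≡ toℕ b →
          lookup (map toℕ xs) a ≡ toℕ (lookup xs b)
        lookup-map (x ∷ xs) zero zero _ = refl
        lookup-map (x ∷ xs) (suc a) (suc b) e = lookup-map xs a b (ℕₚ.suc-injective e)
      χ-inh : ∀ i → i < 3 + length ws → ∃[ u ] χ u ≡ i
      χ-inh zero _ = let (u , e) = inh 0 (s≤s z≤n) in u , cong relabel e
      χ-inh (suc zero) _ = let (u , e) = inh 1 (s≤s (s≤s z≤n)) in u , cong relabel e
      χ-inh (suc (suc zero)) _ = let (u , e) = sample c in u , trans (cong relabel e) place-c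
      χ-inh (suc (suc (suc j))) (s≤s (s≤s (s≤s j<))) = let (w , _ , e) = chosen j< ; (u , p) = sample w in u , trans (cong relabel p) e
      r : ∃[ u ] ψ u ≡ 0
      r = inh 0 (s≤s z≤n)
      χ-conn : ∀ i → Conn (λ u → χ u ≡ i)
      χ-conn zero = conn-root (proj₁ r) λ {u} e → toHub (ψ u) refl e
        where
        toHub : ∀ i {u} → ψ u ≡ i → relabel i ≡ 0 → Reach (In (λ v → χ v ≡ 0)) u (proj₁ r)
        toHub zero p _ = in-mono (cong relabel) (classes 0 p (proj₂ r))
        toHub (suc (suc i)) {u} p e = hop (classes _) (classes 0)
          (touch-sym (hubs 0 i (s≤s z≤n) (+-cancelˡ-< 2 i N (subst (_< 2 + N) p (ψ< u)))))
          (λ q → trans (cong relabel q) e) (cong relabel) p (proj₂ r)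
      χ-conn (suc zero) {u} {v} e e′ = in-mono (cong relabel) (classes 1 (inv (ψ u) e) (inv (ψ v) e′))
        where
        inv : ∀ i → relabel i ≡ 1 → i ≡ 1
        inv (suc zero) _ = refl
        inv (suc (suc i)) e = ⊥-elim (place≢1 i e)
      χ-conn (suc (suc zero)) {u} {v} e e′ = in-mono (λ q → trans (cong relabel q) place-c) (classes (2 + toℕ c) (inv (ψ u) e) (inv (ψ v) e′))
        where
        inv : ∀ i → relabel i ≡ 2 → i ≡ 2 + toℕ c
        inv (suc (suc i)) e = cong (2 +_) (place-inv-c i e)
      χ-conn (suc (suc (suc j))) {u} {v} e e′ with j <? length names
      ... | yes j< = in-mono (λ q → trans (cong relabel q) (trans (cong relabel (sym pu)) e)) (classes _ pu pv)
        where
        inv : ∀ i → relabel i ≡ 3 + j → i ≡ 2 + lookup names (fromℕ< j<)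
        inv (suc (suc i)) e = cong (2 +_) (place-inv i (fromℕ< j<) (trans e (cong (3 +_) (sym (toℕ-fromℕ< j<)))))
        pu = inv (ψ u) e
        pv = inv (ψ v) e′
      ... | no ¬lt = ⊥-elim (¬lt (subst (j <_) (sym len) (+-cancelˡ-< 3 _ _ (subst (_< 3 + length ws) e (relabel< (ψ u))))))
      χ-hubs : ∀ h j → h < 3 → j < length ws → Touch (λ u → χ u ≡ h) (λ u → χ u ≡ 3 + j)
      χ-hubs h j h< j< with chosen j<
      χ-hubs zero j h< j< | w , _ , e = touch-mono (cong relabel) (λ q → trans (cong relabel q) e) (hubs 0 (toℕ w) (s≤s z≤n) (toℕ<n w))
      χ-hubs (suc zero) j h< j< | w , _ , e = touch-mono (cong relabel)
        (λ q → trans (cong relabel q) e) (hubs 1 (toℕ w) (s≤s (s≤s z≤n)) (toℕ<n w))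
      χ-hubs (suc (suc zero)) j h< j< | w , adj , e =
        touch-mono (λ q → trans (cong relabel q) place-c) (λ q → trans (cong relabel q) e) (touch-sym adj)
      χ-hubs (suc (suc (suc h))) j (s≤s (s≤s (s≤s ()))) j< | _

    -- A piece with many neighbouring pieces is a third hub. Otherwise the pieces form a long row
    -- whose bags touch both hubs; merging hub 1 into the last bag closes the row, since hub 1 also
    -- touches the first bag, and hub 0 is the hub of the wheel.
    twin : Outcome (suc k)
    twin with QG.branch id (2 + tripleNumber (suc k)) (λ _ → yes tt) connQ (fromℕ< large) tt (wheelNumber k) (allFin N)
      (Uniqueₚ.allFin⁺ N) (All.tabulate (λ _ → tt)) (subst (twinNumber k <_) (sym (length-tabulate id)) large)
    ... | QG.heap c _ ts long _ uniq at-c = ⊥-elim (two-equal (≤-trans (m≤m+n 2 _) long) uniq at-c)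
    ... | QG.star c P P? _ sub nbr ts long _ inP apart with QG.starNeighbours (λ p → proj₂ (sub p)) nbr apart inP
    ... | ws , len , uniq , adj , _ = manyNeighbours c ws uniq adj (subst (tripleNumber (suc k) ≤_) (sym len) (≤-trans (m≤n+m _ 2) long))
    twin | QG.row B _ _ = wheel {λ u → ψ u ≡ 0} {λ u → ψ u ≡ 1 ⊎ 2 ≤ ψ u} 
      (λ u → ψ u ℕₚ.≟ 0) (λ u → (ψ u ℕₚ.≟ 1) ⊎-dec (2 ≤? ψ u)) (classes 0)
      cover (λ { e (inj₁ e′) → case trans (sym e) e′ of λ () ; e (inj₂ le) → <⇒≢ (≤-trans (s≤s z≤n) le) (sym e) }) {k} (n≤1+n _) rim
      (λ i i≤ → touch-mono id keep (hub-touches-bag B 0 i (s≤s z≤n) i≤))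
      (touch-mono (λ e → inj₁ e , absorb-new R (λ u → ψ u ℕₚ.≟ 1) (classes 1) C-R (wheelNumber k) ≤-refl tC e) keep
        (hub-touches-bag B 1 0 (s≤s (s≤s z≤n)) z≤n))
      where
      R : Bags (λ u → 2 ≤ ψ u) (wheelNumber k)
      R = pieceBags B
      C-R : ∀ {u} → ψ u ≡ 1 → 2 ≤ ψ u → ⊥
      C-R e le = <⇒≢ le (sym e)
      tC : Touch (λ u → ψ u ≡ 1) (Bag R (wheelNumber k))
      tC = hub-touches-bag B 1 (wheelNumber k) (s≤s (s≤s z≤n)) ≤-refl
      rim : Bags (λ u → ψ u ≡ 1 ⊎ 2 ≤ ψ u) (wheelNumber k)
      rim = absorb R (λ u → ψ u ℕₚ.≟ 1) (classes 1) C-R (wheelNumber k) ≤-refl tC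
      keep : ∀ {i u} → Bag R i u → Bag rim i u
      keep (p , e) = inj₂ p , trans (absorb-old R (λ u → ψ u ℕₚ.≟ 1) (classes 1) C-R (wheelNumber k) ≤-refl tC p) e
      cover : ∀ u → ψ u ≡ 0 ⊎ ψ u ≡ 1 ⊎ 2 ≤ ψ u
      cover u with ψ u
      ... | zero = inj₁ refl
      ... | suc zero = inj₂ (inj₁ refl)
      ... | suc (suc i) = inj₂ (inj₂ (s≤s (s≤s z≤n)))

  apart-lookup : ∀ {P ts} → AllPairs (λ s t → ¬ Reach (In P) s t) ts → ∀ i j → Reach (In P) (lookup ts i) (lookup ts j) → i ≡ j
  apart-lookup (a ∷ ap) zero zero r = refl
  apart-lookup (a ∷ ap) zero (suc j) r = ⊥-elim (All.lookup a (∈-lookup j) r)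
  apart-lookup (a ∷ ap) (suc i) zero r = ⊥-elim (All.lookup a (∈-lookup i) (reach-sym in-sym r))
  apart-lookup (a ∷ ap) (suc i) (suc j) r = cong suc (apart-lookup ap i j r)

  connAvoid : ∀ X → length X ≤ 2 → Conn (_∉ X)
  connAvoid X le u∉ v∉ = proj₂ three X le _ _ u∉ v∉

  irreflexive : ∀ {u v} → E u v → u ≢ v
  irreflexive {u} e refl = subst T (proj₂ simple u) e

  module StarHub {k : ℕ} {v c : V} (c≢v : c ≢ v) {P : V → Set} (P? : ∀ u → Dec (P u)) (P-off : ∀ {u} → P u → u ≢ v × u ≢ c)
    (exit : ∀ {u} → P u → ∃[ w ] (E w c × Reach (In P) u w)) (ts : List V) (many : starNumber k ≤ length ts)
    (adjacent : All (E v) ts) (inP : All P ts) (apart : AllPairs (λ s t → ¬ Reach (In P) s t) ts) where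

    private
      Component : Fin (length ts) → V → Set
      Component i u = Reach (In P) (lookup ts i) u

      component? : ∀ u → Dec (∃[ i ] Component i u)
      component? u = any? λ i → reach? (in? P?) (lookup ts i) u

      inComponent : ∀ {i u} → Component i u → P u
      inComponent {i} = reach-end (All.lookup inP (∈-lookup i))

      ψ : V → ℕ
      ψ u with u ≟ v | u ≟ c | component? u
      ... | yes _ | _ | _ = 0
      ... | no _ | yes _ | _ = 1
      ... | no _ | no _ | yes (i , _) = 2 + toℕ i
      -- A junk value: such vertices are not `Done`, and `fill` chooses their class.
      ... | no _ | no _ | no _ = 0

      ψ-v : ψ v ≡ 0
      ψ-v with v ≟ v
      ... | yes _ = refl
      ... | no ne = ⊥-elim (ne refl)

      ψ-c : ψ c ≡ 1
      ψ-c with c ≟ v | c ≟ c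
      ... | yes e | _ = ⊥-elim (c≢v e)
      ... | no _ | yes _ = refl
      ... | no _ | no ne = ⊥-elim (ne refl)

      ψ-component : ∀ {i u} → Component i u → ψ u ≡ 2 + toℕ i
      ψ-component {i} {u} p with u ≟ v | u ≟ c | component? u
      ... | yes e | _ | _ = ⊥-elim (proj₁ (P-off (inComponent p)) e)
      ... | no _ | yes e | _ = ⊥-elim (proj₂ (P-off (inComponent p)) e)
      ... | no _ | no _ | yes (j , q) = cong (λ h → 2 + toℕ h) (apart-lookup apart j i (reach-trans q (reach-sym in-sym p)))
      ... | no _ | no _ | no none = ⊥-elim (none (i , p))

      ψ< : ∀ u → ψ u < 2 + length ts
      ψ< u with u ≟ v | u ≟ c | component? u
      ... | yes _ | _ | _ = s≤s z≤n
      ... | no _ | yes _ | _ = s≤s (s≤s z≤n)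
      ... | no _ | no _ | yes (i , _) = +-monoʳ-< 2 (toℕ<n i)
      ... | no _ | no _ | no _ = s≤s z≤n

      Done : V → Set
      Done u = u ≡ v ⊎ u ≡ c ⊎ ∃[ i ] Component i u

      done? : Decidable Done
      done? u = (u ≟ v) ⊎-dec (u ≟ c) ⊎-dec component? u

      ψv≢ψc : ψ v ≢ ψ c
      ψv≢ψc e = 0≢1+n (trans (sym ψ-v) (trans e ψ-c))

      ψv≢ψ : ∀ {i u} → Component i u → ψ v ≢ ψ u
      ψv≢ψ p e = 0≢1+n (trans (sym ψ-v) (trans e (ψ-component p)))

      ψc≢ψ : ∀ {i u} → Component i u → ψ c ≢ ψ u
      ψc≢ψ p e = 0≢1+n (ℕₚ.suc-injective (trans (sym ψ-c) (trans e (ψ-component p))))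

      classes : ∀ i → Conn (λ u → Done u × ψ u ≡ i)
      classes i (inj₁ refl , _) (inj₁ refl , _) = here
      classes i (inj₁ refl , e) (inj₂ (inj₁ refl) , e′) = ⊥-elim (ψv≢ψc (trans e (sym e′)))
      classes i (inj₁ refl , e) (inj₂ (inj₂ (j , q)) , e′) = ⊥-elim (ψv≢ψ q (trans e (sym e′)))
      classes i (inj₂ (inj₁ refl) , e) (inj₁ refl , e′) = ⊥-elim (ψv≢ψc (trans e′ (sym e)))
      classes i (inj₂ (inj₁ refl) , _) (inj₂ (inj₁ refl) , _) = here
      classes i (inj₂ (inj₁ refl) , e) (inj₂ (inj₂ (j , q)) , e′) = ⊥-elim (ψc≢ψ q (trans e (sym e′)))
      classes i (inj₂ (inj₂ (h , p)) , e) (inj₁ refl , e′) = ⊥-elim (ψv≢ψ p (trans e′ (sym e)))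
      classes i (inj₂ (inj₂ (h , p)) , e) (inj₂ (inj₁ refl) , e′) = ⊥-elim (ψc≢ψ p (trans e′ (sym e)))
      classes i (inj₂ (inj₂ (h , p)) , e) (inj₂ (inj₂ (j , q)) , e′)
        with toℕ-injective (+-cancelˡ-≡ 2 _ _ (trans (sym (ψ-component p)) (trans e (trans (sym e′) (ψ-component q)))))
      ... | refl = in-mono (λ w → inj₂ (inj₂ (h , w)) , trans (ψ-component w) (trans (sym (ψ-component p)) e))
              (conn-component (lookup ts h) p q)

      Rest : V → Set
      Rest u = u ≢ v × u ≢ c

      connRest : Conn Rest
      connRest = conn-cong (λ u∉ → u∉ ∘ here , u∉ ∘ there ∘ here)
        (λ { (ne , _) (here e) → ne e ; (_ , ne) (there (here e)) → ne e ; _ (there (there ())) }) (connAvoid (v ∷ c ∷ []) ≤-refl)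

      first : Fin (length ts)
      first = fromℕ< (≤-trans (s≤s z≤n) many)

      undone : ∀ {u} → ¬ Done u → Rest u × ∃[ w ] (Done w × Reach (In Rest) u w)
      undone ¬d = rest , lookup ts first , inj₂ (inj₂ (first , here)) , connRest rest (P-off (All.lookup inP (∈-lookup first)))
        where rest = ¬d ∘ inj₁ , ¬d ∘ inj₂ ∘ inj₁

    starHub : Outcome (suc k)
    starHub with fill {Rest} done? ψ classes undone
    -- Filling is confined to `Rest`, so the first two classes remain the single vertices `v` and
    -- `c`. The pieces then make up `G - v - c`, which is connected by 3-connectedness.
    ... | χ , keep , χ-conn , origin = Twin.twin {k} {length ts} (≤-trans (n≤1+n _) many) χ χ< χ-inh χ-conn χ-hubs
      (conn-cong (λ {u} r → rest⇒ r (origin u)) (λ le → (λ { refl → <⇒≱ le (≤-trans (≤-reflexive χ-v) z≤n) })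
        , λ { refl → <⇒≱ le (≤-reflexive χ-c) }) connRest)
      where
      χ-v : χ v ≡ 0
      χ-v = trans (keep (inj₁ refl)) ψ-v
      χ-c : χ c ≡ 1
      χ-c = trans (keep (inj₂ (inj₁ refl))) ψ-c
      χ-component : ∀ {i u} → Component i u → χ u ≡ 2 + toℕ i
      χ-component p = trans (keep (inj₂ (inj₂ (_ , p)))) (ψ-component p)
      χ< : ∀ u → χ u < 2 + length ts
      χ< u with origin u
      ... | inj₁ d = subst (_< 2 + length ts) (sym (keep d)) (ψ< u)
      ... | inj₂ (w , _ , _ , e) = subst (_< 2 + length ts) (sym e) (ψ< w)
      rest⇒ : ∀ {u} → Rest u → Done u ⊎ ∃[ w ] (Done w × Rest w × χ u ≡ ψ w) → 2 ≤ χ u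
      rest⇒ (ne , _) (inj₁ (inj₁ e)) = ⊥-elim (ne e)
      rest⇒ (_ , ne) (inj₁ (inj₂ (inj₁ e))) = ⊥-elim (ne e)
      rest⇒ _ (inj₁ (inj₂ (inj₂ (i , p)))) = subst (2 ≤_) (sym (χ-component p)) (m≤m+n 2 _)
      rest⇒ _ (inj₂ (w , inj₁ e , (ne , _) , _)) = ⊥-elim (ne e)
      rest⇒ _ (inj₂ (w , inj₂ (inj₁ e) , (_ , ne) , _)) = ⊥-elim (ne e)
      rest⇒ _ (inj₂ (w , inj₂ (inj₂ (i , p)) , _ , e)) = subst (2 ≤_) (sym (trans e (ψ-component p))) (m≤m+n 2 _)
      χ-inh : ∀ i → i < 2 + length ts → ∃[ u ] χ u ≡ i
      χ-inh zero _ = v , χ-v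
      χ-inh (suc zero) _ = c , χ-c
      χ-inh (suc (suc i)) (s≤s (s≤s i<)) = lookup ts (fromℕ< i<) , trans (χ-component {fromℕ< i<} here) (cong (2 +_) (toℕ-fromℕ< i<))
      χ-hubs : ∀ h i → h < 2 → i < length ts → Touch (λ u → χ u ≡ h) (λ u → χ u ≡ 2 + i)
      χ-hubs zero i _ i< = v , lookup ts (fromℕ< i<) , χ-v , trans (χ-component {fromℕ< i<} here) (cong (2 +_) (toℕ-fromℕ< i<)) ,
        All.lookup adjacent (∈-lookup (fromℕ< i<))
      χ-hubs (suc zero) i _ i< = let (w , e , walk) = exit (All.lookup inP (∈-lookup {xs = ts} (fromℕ< i<))) in
        c , w , χ-c , trans (χ-component {fromℕ< i<} walk) (cong (2 +_) (toℕ-fromℕ< i<)) , E-sym e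
      χ-hubs (suc (suc h)) i (s≤s (s≤s ())) i<

  bigDegree : ∀ {k} v ns → Unique ns → All (E v) ns → hubNumber k < length ns → Outcome (suc k)
  bigDegree {k} v (r ∷ ns) uniq adjacent many
    with branch id (starNumber k) {_≢ v} (λ u → ¬? (u ≟ v))
      (conn-cong (λ u∉ → u∉ ∘ here) (λ { ne (here e) → ne e ; _ (there ()) }) (connAvoid (v ∷ []) (s≤s z≤n)))
      r (λ e → irreflexive (All.head adjacent) (sym e)) (cutNumber k (suc (wheelNumber k)) (stripNumber k)) (r ∷ ns) uniq
      (All.map (λ e e′ → irreflexive e (sym e′)) adjacent) many
  ... | heap c _ ts long _ uniq′ at-c = ⊥-elim (two-equal (≤-trans (m≤m+n 2 _) long) uniq′ at-c)
  ... | star c P P? c≢v sub exit ts long ts∈ inP apart =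
        StarHub.starHub {k} c≢v P? sub exit ts long (All.map (All.lookup adjacent) ts∈) inP apart
  ... | row B _ tagged = finish (rowRamsey (λ u → ¬? (u ≟ v)) B k (suc (wheelNumber k)) (stripNumber k) (n≤1+n _))
    where
    conn-v : Conn (_≡ v)
    conn-v refl refl = here
    cover : ∀ u → u ≡ v ⊎ u ≢ v
    cover u with u ≟ v
    ... | yes e = inj₁ e
    ... | no ne = inj₂ ne
    tv : ∀ i → i ≤ cutNumber k (suc (wheelNumber k)) (stripNumber k) → Touch (_≡ v) (Bag B i)
    tv i i≤ = let (t , t∈ , ne , e) = tagged i i≤ in v , t , refl , (ne , e) , All.lookup adjacent t∈
    finish : RowOutcome B k (suc (wheelNumber k)) (stripNumber k) → Outcome (suc k)
    finish (complete B′ c t) = completeHub (_≟ v) conn-v cover (λ e ne → ne e) B′ (coarse-hub c tv 0 z≤n) t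
    -- The last bag touches bag 0, so the row is closed as it stands and `v` is its hub.
    finish (hubbed B′ c t) = wheel (_≟ v) (λ u → ¬? (u ≟ v)) conn-v cover (λ e ne → ne e) {k} (≤-trans (n≤1+n _) (n≤1+n _)) B′
      (coarse-hub c tv) (touch-sym (t (suc (wheelNumber k)) (s≤s z≤n) ≤-refl))
    finish (cyclic B′ c f) = hubStrip v B′ (coarse-hub c tv) f

-- Ladders, and the theorem

ladderNumber matchNumber crossNumber rowNumber mainNumber : ℕ → ℕ
-- In the hub outcome rung 0 is the hub; its chords to the `rimNumber k` rungs from rung 2 on are
-- divided between the two sides.
ladderNumber k = cutNumber k (suc (rimNumber k)) (stripNumber k)
matchNumber k = ramseyNumber 2 (suc (ladderNumber k))
-- Enough chords at the end bag to produce a vertex of degree above `hubNumber k` or a row inside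
-- the end bag with a chord at each of its bags.
crossNumber k = tagNumber (2 + hubNumber k) (matchNumber k)
rowNumber k = cutNumber k (suc (crossNumber k)) (stripNumber k)
mainNumber k = 4 + tagNumber (2 + hubNumber k) (rowNumber k)

homogeneous⇒pairs : ∀ {c b ys} → Homogeneous 2 c ys b → AllPairs (λ i j → c (i ∷ j ∷ []) ≡ b) ys
homogeneous⇒pairs {ys = []} h = []
homogeneous⇒pairs {c} {b} {y ∷ ys} h = All.tabulate (λ z∈ → h _ (refl ∷ single z∈) refl) ∷
  homogeneous⇒pairs λ zs s → h zs (y ∷ʳ s)
  where
  single : ∀ {z ys} → z ∈ ys → z ∷ [] ⊆ ys
  single (here refl) = refl ∷ minimum _
  single (there z∈) = _ ∷ʳ single z∈

module Ladders (G : Graph) (simple : IsSimple G) (three : ThreeConnected G) where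
  open Targets G simple
  open Rows E E? E-sym
  open Wheels G simple
  open Growth E E? E-sym
  open Strips G simple three
  open Hubs G simple three

  private
    V : Set
    V = Fin (order G)

  record Ladder (L R : V → Set) (m : ℕ) : Set where
    field
      left : Bags L m
      right : Bags R m
      rung : ∀ i → i ≤ m → Touch (Bag left i) (Bag right i)

  module _ {L R : V → Set} (L? : ∀ u → Dec (L u)) (R? : ∀ u → Dec (R u)) (cover : ∀ u → L u ⊎ R u) (L-R : ∀ {u} → L u → R u → ⊥) where

    module Chords {m : ℕ} (left : Bags L (suc m)) (right : Bags R (suc m))
      (rung : ∀ i → i ≤ suc m → Touch (Bag left i) (Bag right i)) where

      A B L⁺ : V → Set
      A u = Bag left 0 u ⊎ Bag right 0 u
      B u = R u × 1 ≤ index right u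
      L⁺ u = L u × 1 ≤ index left u
      A? : Decidable A
      A? u = bag? left L? 0 u ⊎-dec bag? right R? 0 u
      B? : Decidable B
      B? u = R? u ×-dec (1 ≤? index right u)
      P? : ∀ u → Dec (B u ⊎ L⁺ u)
      P? u = B? u ⊎-dec (L? u ×-dec (1 ≤? index left u))
      connB : Conn B
      connB = conn-bags (suffix 1 right)
      B-L : ∀ {u} → B u → L⁺ u → ⊥
      B-L (r , _) (l , _) = L-R l r
      BL : Touch B (Bag (suffix 1 left) 0)
      BL = touch-sym (touch-mono (λ (l , e) → (l , ≤-reflexive (sym e)) , cong (_∸ 1) e)
        (λ (r , e) → r , ≤-reflexive (sym e)) (rung 1 (s≤s z≤n)))
      rim : Bags (λ u → B u ⊎ L⁺ u) (suc m)
      rim = prepend (suffix 1 left) B? connB B-L BL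
      keep : ∀ {i u} → Bag left (suc i) u → Bag rim (suc i) u
      keep {i} (l , e) = inj₂ l⁺ , trans (prepend-suc (suffix 1 left) B? connB B-L BL l⁺) (cong (λ j → suc (j ∸ 1)) e)
        where l⁺ = l , subst (1 ≤_) (sym e) (s≤s z≤n)
      cover′ : ∀ u → A u ⊎ B u ⊎ L⁺ u
      cover′ u with cover u
      cover′ u | inj₁ l with index left u
      ... | zero = inj₁ (inj₁ (l , refl))
      ... | suc _ = inj₂ (inj₂ (l , s≤s z≤n))
      cover′ u | inj₂ r with index right u
      ... | zero = inj₁ (inj₂ (r , refl))
      ... | suc _ = inj₂ (inj₁ (r , s≤s z≤n))
      disjoint : ∀ {u} → A u → B u ⊎ L⁺ u → ⊥
      disjoint (inj₁ (l , _)) (inj₁ (r , _)) = L-R l r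
      disjoint (inj₁ (_ , e)) (inj₂ (_ , lo)) = <⇒≢ lo (sym e)
      disjoint (inj₂ (_ , e)) (inj₁ (_ , lo)) = <⇒≢ lo (sym e)
      disjoint (inj₂ (r , _)) (inj₂ (l , _)) = L-R l r

      -- The far ends of the chords leaving A lie on the left side, which becomes the rim, closed by the right side.
      chordWheel : ∀ {k} {is : List (Fin m)} → Unique is → All (λ i → Touch A (Bag left (2 + toℕ i))) is →
        wheelNumber k < length is → Outcome (suc k)
      chordWheel {k} {is} uniq chords many with labelledCuts (λ j → touch? A? (bag? rim P? j)) (suc m) (wheelNumber k)
        (map (λ i → 2 + toℕ i) is) (Uniqueₚ.map⁺ (λ e → toℕ-injective (+-cancelˡ-≡ 2 _ _ e)) uniq)
        (Allₚ.map⁺ (All.map (λ {i} t → s≤s (toℕ<n i) , touch-mono id keep t) chords))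
        (subst (wheelNumber k <_) (sym (length-map _ is)) many)
      ... | b , C , labels = wheel A? P? (conn-∪ (conn left 0) (conn right 0) (rung 0 z≤n)) cover′ disjoint {k} (n≤1+n _)
        (coarsen rim C) (λ i i≤ → let (x , lo , hi , t) = labels i i≤ in touch-mono id (coarse-bag rim C i≤ lo hi) t)
        (closing (coarsen-coarser rim C) (touch-mono keep
          (λ (r , e) → let b = r , subst (1 ≤_) (sym e) (s≤s z≤n) in inj₁ b , prepend-zero (suffix 1 left) B? connB B-L BL b)
          (rung (suc m) ≤-refl)))

  module _ {L R : V → Set} (L? : ∀ u → Dec (L u)) (R? : ∀ u → Dec (R u)) (cover : ∀ u → L u ⊎ R u) (L-R : ∀ {u} → L u → R u → ⊥) where

    -- Each chord at rung 0 ends on the left or on the right. The side with the majority becomes the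
    -- rim; beyond rung 0, the other side is one connected bag, which the rungs attach to both ends
    -- of this rim.
    hubLadder : ∀ {k} → (lad : Ladder L R (suc (rimNumber k))) → let open Ladder lad in
      (∀ j → 2 ≤ j → j ≤ suc (rimNumber k) → Touch (λ u → Bag left 0 u ⊎ Bag right 0 u) (λ u → Bag left j u ⊎ Bag right j u)) →
      Outcome (suc k)
    hubLadder {k} lad chords with majority side (suc (wheelNumber k)) (suc (wheelNumber k)) (allFin (rimNumber k))
      (≤-reflexive (sym (length-tabulate id)))
      where
      open Ladder lad
      A : V → Set
      A u = Bag left 0 u ⊎ Bag right 0 u
      side : ∀ i → Touch A (Bag left (2 + toℕ i)) ⊎ Touch A (Bag right (2 + toℕ i))
      side i with chords (2 + toℕ i) (m≤m+n 2 _) (s≤s (toℕ<n i))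
      ... | u , v , a , inj₁ b , e = inj₁ (u , v , a , b , e)
      ... | u , v , a , inj₂ b , e = inj₂ (u , v , a , b , e)
    ... | inj₁ (is , s , long , ts) = Chords.chordWheel L? R? cover L-R (Ladder.left lad) (Ladder.right lad) (Ladder.rung lad) {k}
          (allPairs-⊆ s (Uniqueₚ.allFin⁺ _)) ts long
    ... | inj₂ (is , s , long , ts) = Chords.chordWheel R? L? ([ inj₂ , inj₁ ]′ ∘ cover) (λ r l → L-R l r)
          (Ladder.right lad) (Ladder.left lad) (λ i i≤ → touch-sym (Ladder.rung lad i i≤)) {k}
          (allPairs-⊆ s (Uniqueₚ.allFin⁺ _)) (All.map (touch-mono [ inj₂ , inj₁ ]′ id) ts) long

    module _ {m : ℕ} (lad : Ladder L R m) where
      open Ladder lad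

      private
        side : V → ℕ
        side u = if does (L? u) then index left u else index right u

        side-L : ∀ {i u} → Bag left i u → ⊤ × side u ≡ i
        side-L {u = u} (l , e) with L? u
        ... | yes _ = tt , e
        ... | no ¬l = ⊥-elim (¬l l)

        side-R : ∀ {i u} → Bag right i u → ⊤ × side u ≡ i
        side-R {u = u} (r , e) with L? u
        ... | yes l = ⊥-elim (L-R l r)
        ... | no _ = tt , e

        side⁻ : ∀ {i u} → ⊤ × side u ≡ i → Bag left i u ⊎ Bag right i u
        side⁻ {u = u} (_ , e) with cover u
        ... | inj₁ l = inj₁ (l , trans (sym (proj₂ (side-L (l , refl)))) e)
        ... | inj₂ r = inj₂ (r , trans (sym (proj₂ (side-R (r , refl)))) e)

        side≤ : ∀ {i u} → Bag left i u ⊎ Bag right i u → i ≤ m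
        side≤ (inj₁ (l , e)) = subst (_≤ m) e (index≤ left l)
        side≤ (inj₂ (r , e)) = subst (_≤ m) e (index≤ right r)

      rungs : Bags (λ _ → ⊤) m
      rungs = record
        { index = side
        ; index≤ = λ {u} _ → side≤ (side⁻ {side u} {u} (tt , refl))
        ; conn = conn-rungs
        ; touch = λ i lt → touch-mono side-L side-L (touch left i lt)
        ; inhabited = λ i le → let (u , b) = inhabited left i le in u , side-L b
        }
        where
        conn-rungs : ∀ i → Conn (λ u → ⊤ × side u ≡ i)
        conn-rungs i with i ≤? m
        ... | yes le = conn-cong [ side-L , side-R ]′ side⁻ (conn-∪ (conn left i) (conn right i) (rung i le))
        ... | no ¬le = λ p _ → ⊥-elim (¬le (side≤ (side⁻ p)))

      rungs⁻ : ∀ {i u} → Bag rungs i u → Bag left i u ⊎ Bag right i u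
      rungs⁻ = side⁻

    coarsenLadder : ∀ {m l b} → Cuts b m l → Ladder L R l → Ladder L R m
    coarsenLadder {b = b} C lad = record
      { left = coarsen left C
      ; right = coarsen right C
      ; rung = λ i i≤ → touch-mono (coarse-bag left C i≤ ≤-refl (increasing C i i≤)) (coarse-bag right C i≤ ≤-refl (increasing C i i≤))
          (rung (b i) (≤-pred (subst (b i <_) (ends C) (<-≤-trans (increasing C i i≤) (cuts-mono C (s≤s i≤) ≤-refl)))))
      }
      where open Ladder lad

    reverseLadder : ∀ {m} → Ladder L R m → Ladder L R m
    reverseLadder {m} lad = record
      { left = reverse left
      ; right = reverse right
      ; rung = λ i i≤ → touch-mono (reverse-bag′ left i≤) (reverse-bag′ right i≤) (rung (m ∸ i) (m∸n≤m m i))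
      }
      where open Ladder lad

    -- Intervals of rungs are cut by `cutRamsey` itself rather than `rowRamsey`: a hub outcome needs
    -- the two sides kept apart, so the same cut points must be applied to both.
    ladder : ∀ {k} → Ladder L R (ladderNumber k) → Outcome (suc k)
    ladder {k} lad = finish (cutRamsey {λ x y → Touch (Bag W x) (Bag W y)} (λ x y → touch? (bag? W (λ _ → yes tt) x) (bag? W (λ _ → yes tt) y))
      (ladderNumber k) k (suc (rimNumber k)) (stripNumber k) (n≤1+n _))
      where
      open Ladder lad
      W : Bags (λ _ → ⊤) (ladderNumber k)
      W = rungs lad
      module _ {b : ℕ → ℕ} (C : Cuts b (suc (rimNumber k)) (ladderNumber k)) where
        coarseRung : ∀ {j x u} → j ≤ suc (rimNumber k) → b j ≤ x → x < b (suc j) → Bag W x u →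
          Bag (coarsen left C) j u ⊎ Bag (coarsen right C) j u
        coarseRung j≤ lo hi w = [ inj₁ ∘ coarse-bag left C j≤ lo hi , inj₂ ∘ coarse-bag right C j≤ lo hi ]′ (rungs⁻ lad w)
        coarseTouch : ∀ {i j} → i ≤ suc (rimNumber k) → j ≤ suc (rimNumber k) → CutTouch (λ x y → Touch (Bag W x) (Bag W y)) b i j →
          Touch (λ u → Bag (coarsen left C) i u ⊎ Bag (coarsen right C) i u) (λ u → Bag (coarsen left C) j u ⊎ Bag (coarsen right C) j u)
        coarseTouch i≤ j≤ (x , x< , y , y< , bx , by , t) = touch-mono (coarseRung i≤ bx x<) (coarseRung j≤ by y<) t
      finish : CutOutcome (λ x y → Touch (Bag W x) (Bag W y)) k (suc (rimNumber k)) (stripNumber k) (ladderNumber k) → Outcome (suc k)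
      finish (complete b C t) = completeRow (coarsen W C) (λ _ → tt) λ i j lt j≤ →
        nearOrFar (coarsen W C) lt j≤ λ far → cutTouch⇒touch W C (≤-trans (<⇒≤ lt) j≤) j≤ (t i j far j≤)
      finish (firstHub b C t) = hubLadder {k} (coarsenLadder C lad) λ j 2≤j j≤ → coarseTouch C z≤n j≤ (t j 2≤j j≤)
      finish (lastHub b C t) = hubLadder {k} (reverseLadder (coarsenLadder C lad)) λ j 2≤j j≤ →
        touch-sym (touch-mono (flip j≤) (flip z≤n) (coarseTouch C (m∸n≤m M j) ≤-refl (t (M ∸ j) (within j 2≤j j≤))))
        where
        M : ℕ
        M = suc (rimNumber k)
        flip : ∀ {i} → i ≤ M → ∀ {u} → Bag (coarsen left C) (M ∸ i) u ⊎ Bag (coarsen right C) (M ∸ i) u →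
          Bag (reverse (coarsen left C)) i u ⊎ Bag (reverse (coarsen right C)) i u
        flip i≤ = [ inj₁ ∘ reverse-bag′ (coarsen left C) i≤ , inj₂ ∘ reverse-bag′ (coarsen right C) i≤ ]′
        within : ∀ j → 2 ≤ j → j ≤ M → suc (suc (M ∸ j)) ≤ M
        within j 2≤j j≤ = subst (2 + (M ∸ j) ≤_) (m+[n∸m]≡n j≤) (+-monoˡ-≤ (M ∸ j) 2≤j)
      finish (cyclic b C f) = strip (coarsen W C) λ i j far j≤ t → f i j far j≤ (touch⇒cutTouch W C t)

    -- The left row is cut at `ys` and the right row at the images under `σ`. As `σ` increases on
    -- `ys`, the ends of each matched pair fall into intervals with the same number.
    matchedLadder : ∀ {l l′ m} (left : Bags L l) (right : Bags R l′) ys (σ : ℕ → ℕ) → Sorted ys → AllPairs (λ i j → σ i < σ j) ys →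
      All (λ i → i ≤ l × σ i ≤ l′ × Touch (Bag left i) (Bag right (σ i))) ys → m < length ys → Ladder L R m
    matchedLadder {l} {l′} {m} left right ys σ sorted increase matched long = record
      { left = coarsen left C ; right = coarsen right C′
      ; rung = λ i i≤ → touch-mono
          (coarse-bag left C i≤ (cut-≤ ys m l i i≤) (<-cut sorted long (All.map proj₁ matched) i i≤))
          (coarse-bag right C′ i≤ (subst (cut zs m l′ i ≤_) (nth-map i (≤-<-trans i≤ long)) (cut-≤ zs m l′ i i≤))
            (subst (_< cut zs m l′ (suc i)) (nth-map i (≤-<-trans i≤ long)) (<-cut sorted′ long′ bounded′ i i≤)))
          (proj₂ (proj₂ (nth-All matched (≤-<-trans i≤ long))))
      }
      where
      zs : List ℕ
      zs = map σ ys
      sorted′ : Sorted zs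
      sorted′ = AllPairsₚ.map⁺ increase
      long′ : m < length zs
      long′ = subst (m <_) (sym (length-map σ ys)) long
      bounded′ : All (_≤ l′) zs
      bounded′ = Allₚ.map⁺ (All.map (proj₁ ∘ proj₂) matched)
      C : Cuts (cut ys m l) m l
      C = cut-Cuts sorted long (All.map proj₁ matched)
      C′ : Cuts (cut zs m l′) m l′
      C′ = cut-Cuts sorted′ long′ bounded′
      nth-map : ∀ i → i < length ys → nth zs i ≡ σ (nth ys i)
      nth-map = go ys
        where
        go : ∀ ys i → i < length ys → nth (map σ ys) i ≡ σ (nth ys i)
        go (y ∷ ys) zero _ = refl
        go (y ∷ ys) (suc i) (s≤s lt) = go ys i lt

  module CrossHub {k : ℕ} (B : Bags (λ _ → ⊤) (suc (crossNumber k)))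
    (hubTouches : ∀ j → 1 ≤ j → j ≤ suc (crossNumber k) → Touch (Bag B 0) (Bag B j)) where
    private
      Tag : Set
      Tag = Fin (suc (crossNumber k))

      chord : ∀ (t : Tag) → Touch (Bag B 0) (Bag B (suc (toℕ t)))
      chord t = hubTouches (suc (toℕ t)) (s≤s z≤n) (toℕ<n t)

      loc end : Tag → V
      loc t = proj₁ (chord t)
      end t = proj₁ (proj₂ (chord t))

      L R : V → Set
      L = Bag B 0
      R u = ⊤ × 1 ≤ index B u

      right : Bags R (crossNumber k)
      right = suffix 1 B

      end-right : ∀ t → Bag right (toℕ t) (end t)
      end-right t = let (_ , e) = proj₁ (proj₂ (proj₂ (proj₂ (chord t)))) in
        (tt , subst (1 ≤_) (sym e) (s≤s z≤n)) , cong (_∸ 1) e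

      L? : Decidable L
      L? = bag? B (λ _ → yes tt) 0

      R? : Decidable R
      R? u = yes tt ×-dec (1 ≤? index B u)

      cover : ∀ u → L u ⊎ R u
      cover u with index B u
      ... | zero = inj₁ (tt , refl)
      ... | suc _ = inj₂ (tt , s≤s z≤n)

      L-R : ∀ {u} → L u → R u → ⊥
      L-R (_ , e) (_ , lo) = <⇒≢ lo (sym e)

      module Matching (left : Bags L (matchNumber k)) (tagOf : ℕ → Tag)
        (tagged : ∀ i → i ≤ matchNumber k → L (loc (tagOf i)) × index left (loc (tagOf i)) ≡ i) where

        τ : ℕ → ℕ
        τ i = toℕ (tagOf i)

        τ-injective : ∀ {i j} → i ≤ matchNumber k → j ≤ matchNumber k → τ i ≡ τ j → i ≡ j
        τ-injective i≤ j≤ e = trans (sym (proj₂ (tagged _ i≤)))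
          (trans (cong (index left ∘ loc) (toℕ-injective e)) (proj₂ (tagged _ j≤)))

        chordTouch : ∀ i → i ≤ matchNumber k → Touch (Bag left i) (Bag right (τ i))
        chordTouch i i≤ = loc (tagOf i) , end (tagOf i) , tagged i i≤ , end-right (tagOf i) ,
          proj₂ (proj₂ (proj₂ (proj₂ (chord (tagOf i)))))

        colour : List ℕ → Bool
        colour (i ∷ j ∷ []) = ⌊ τ i <? τ j ⌋
        colour _ = false

        τ≤ : ∀ i → τ i ≤ crossNumber k
        τ≤ i = ≤-pred (toℕ<n (tagOf i))

        -- An Erdős-Szekeres step by Ramsey's theorem for pairs. Different left bags carry different
        -- chords, so `τ` is injective and the failure to increase means a strict decrease;
        -- reversing the right row then makes the matching increasing.
        matching : Outcome (suc k)
        matching with ramsey 2 (suc (ladderNumber k)) colour (upTo (suc (matchNumber k)))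
          (subst (matchNumber k ≤_) (sym (length-upTo (suc (matchNumber k)))) (n≤1+n _))
        ... | ys , s , long , b , h = finish b (homogeneous⇒pairs h)
          where
          sorted : Sorted ys
          sorted = allPairs-⊆ s (sorted-upTo _)
          bounded : All (_≤ matchNumber k) ys
          bounded = All-resp-⊆ s (All.tabulate λ i∈ → ≤-pred (∈-upTo⁻ i∈))
          decreasing : ∀ {ys} → Sorted ys → All (_≤ matchNumber k) ys → AllPairs (λ i j → ⌊ τ i <? τ j ⌋ ≡ false) ys →
            AllPairs (λ i j → crossNumber k ∸ τ i < crossNumber k ∸ τ j) ys
          decreasing [] [] [] = []
          decreasing (lts ∷ st) (i≤ ∷ bd) (nots ∷ ap) = All.tabulate (λ {j} j∈ →
            ∸-monoʳ-< (≤∧≢⇒< (≮⇒≥ (⌊⌋-false (τ _ <? τ _) (All.lookup nots j∈)))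
              (λ e → <⇒≢ (All.lookup lts j∈) (sym (τ-injective (All.lookup bd j∈) i≤ e)))) (τ≤ _)) ∷ decreasing st bd ap
          finish : ∀ b → AllPairs (λ i j → ⌊ τ i <? τ j ⌋ ≡ b) ys → Outcome (suc k)
          finish true up = ladder L? R? cover L-R {k} (matchedLadder L? R? cover L-R left right ys τ sorted
            (AllPairs.map (λ {i} {j} → ⌊⌋-true (τ i <? τ j)) up) (All.map (λ {i} i≤ → i≤ , τ≤ i , chordTouch i i≤) bounded) long)
          finish false down = ladder L? R? cover L-R {k} (matchedLadder L? R? cover L-R left (reverse right) ys
            (λ i → crossNumber k ∸ τ i) sorted
            (decreasing sorted bounded down)
            (All.map (λ {i} i≤ → i≤ , m∸n≤m _ (τ i) , touch-mono id (reverse-bag right (τ≤ i)) (chordTouch i i≤)) bounded) long)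

    -- The tags are the chords, located at their ends in bag 0. Their other ends lie in different
    -- bags, so chords in a heap also lead to distinct neighbours of one vertex, and both `star` and
    -- `heap` give a large degree.
    crossHub : Outcome (suc k)
    crossHub with branch loc (2 + hubNumber k) L? (conn B 0) (loc zero) (proj₁ (proj₂ (proj₂ (chord zero)))) (matchNumber k)
      (allFin (suc (crossNumber k))) (Uniqueₚ.allFin⁺ _) (All.tabulate λ {t} _ → proj₁ (proj₂ (proj₂ (chord t))))
      (subst (crossNumber k <_) (sym (length-tabulate id)) (n<1+n _))
    ... | star c P P? c∈ sub exit ts long _ inP apart with starNeighbours {loc = loc} (λ p → proj₂ (sub p)) exit apart inP
    ...   | ws , len , uniq , adjacent , _ = bigDegree c ws uniq (All.map (E-sym ∘ proj₁) adjacent)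
            (subst (hubNumber k <_) (sym len) (≤-trans (n≤1+n _) long))
    crossHub | heap c _ ts long _ uniq at-c = bigDegree c (map end ts) (Uniqueₚ.map⁺ end-injective uniq)
      (Allₚ.map⁺ (All.map (λ {t} e → subst (λ v → E v (end t)) e (proj₂ (proj₂ (proj₂ (proj₂ (chord t)))))) at-c))
      (subst (hubNumber k <_) (sym (length-map end ts)) (≤-trans (n≤1+n _) long))
      where
      end-injective : ∀ {s t} → end s ≡ end t → s ≡ t
      end-injective {s} {t} e = toℕ-injective (trans (sym (proj₂ (end-right s))) (trans (cong (index right) e) (proj₂ (end-right t))))
    crossHub | row left _ tagged = Matching.matching left tagOf tagOf-tagged
      where
      tagOf : ℕ → Tag
      tagOf i with i ≤? matchNumber k
      ... | yes le = proj₁ (tagged i le)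
      ... | no _ = zero
      tagOf-tagged : ∀ i → i ≤ matchNumber k → L (loc (tagOf i)) × index left (loc (tagOf i)) ≡ i
      tagOf-tagged i i≤ with i ≤? matchNumber k
      ... | yes le = proj₂ (proj₂ (tagged i le))
      ... | no ¬le = ⊥-elim (¬le i≤)

  unavoidable : ∀ k → mainNumber k ≤ order G → Outcome (suc k)
  unavoidable k large with branch id (2 + hubNumber k) {λ _ → ⊤} (λ _ → yes tt)
    (allConn G simple three) (fromℕ< (≤-trans (s≤s z≤n) (proj₁ three))) tt
    (rowNumber k) (allFin (order G)) (Uniqueₚ.allFin⁺ _) (All.tabulate λ _ → tt)
    (subst (tagNumber (2 + hubNumber k) (rowNumber k) <_) (sym (length-tabulate id)) (≤-trans (m≤n+m _ 3) large))
  ... | star c P P? c∈ sub exit ts long _ inP apart with starNeighbours (λ p → proj₂ (sub p)) exit apart inP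
  ...   | ws , len , uniq , adjacent , _ = bigDegree c ws uniq (All.map (E-sym ∘ proj₁) adjacent)
          (subst (hubNumber k <_) (sym len) (≤-trans (n≤1+n _) long))
  unavoidable k large | heap c _ ts long _ uniq at-c = ⊥-elim (two-equal (≤-trans (m≤m+n 2 _) long) uniq at-c)
  unavoidable k large | row B _ _ = finish (rowRamsey (λ _ → yes tt) B k (suc (crossNumber k)) (stripNumber k) (n≤1+n _))
    where
    finish : RowOutcome B k (suc (crossNumber k)) (stripNumber k) → Outcome (suc k)
    finish (complete B′ _ t) = completeRow B′ (λ _ → tt) t
    finish (hubbed B′ _ t) = CrossHub.crossHub B′ t
    finish (cyclic B′ _ f) = strip B′ f

theorem1p6 : Σ (ℕ → ℕ) λ f →
    (k : ℕ) → 3 < k → (G : Graph) → IsSimple G → ThreeConnected G → f k ≤ order G →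
    IsParallelMinor (K3kPrime k) G ⊎ IsParallelMinor (Wheel k) G ⊎
    IsParallelMinor (DoubleFan k) G ⊎ IsParallelMinor (Kcomplete k) G
theorem1p6 = (λ { zero → 0 ; (suc k) → mainNumber k }) , λ
  { zero () ; (suc k) _ G simple three large → Ladders.unavoidable G simple three k large }
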